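{- For any finite set $F$ of positive integers there is an infinite subset $N$ of $2\mathbb{N}$ (the set of even positive integers) such that for each $d\in N$ there exist infinitely many Salem numbers $\alpha$ of degree $d$ having the property that $\alpha^{n}-1$ is a unit for all $n\in F$.
   Context: A Salem number is a real algebraic integer greater than $1$ whose other conjugates all lie in the closed unit disc, with at least one conjugate lying on the unit circle. Conjugates and degree are taken over $\mathbb{Q}$. A unit is an algebraic integer whose inverse is also an algebraic integer (equivalently, an algebraic integer of norm $\pm 1$ over $\mathbb{Q}$). -}

module Defs where

open import Algebra.Bundles.Raw using (RawRing)
import Algebra.Definitions.RawSemiring as RawSemiringDefinitions
open import Data.Integer.Base using (ℤ)
open import Data.Nat.Base as ℕ using (ℕ; _⊔_)
import Data.Nat.Properties as ℕ
open import Data.Product.Base using (Σ-syntax; ∃-syntax; _×_; _,_)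
open import Data.Rational.Base as ℚ using (ℚ; 0ℚ; 1ℚ; ½; ∣_∣; 1/_; positive)
import Data.Rational.Properties as ℚ
open import Data.Rational.Solver using (module +-*-Solver)
open import Data.Vec.Base using (Vec; []; _∷_; map)
open import Function.Definitions using (Injective)
open import Level as Level using (Level; 0ℓ)
open import Relation.Binary.Core using (Rel)
open import Relation.Binary.PropositionalEquality using (_≡_; refl; sym; cong)
open import Relation.Nullary.Negation using (¬_)
open import Relation.Unary using (Pred)

private
  variable
    a p ℓ : Level

-- Real numbers: Cauchy sequences of rationals, each carrying a modulus of
-- convergence, with `_≃_` as equality. Ring operations are pointwise.

CauchySequence : (ℕ → ℚ) → Set
CauchySequence x =
  ∀ ε → 0ℚ ℚ.< ε → ∃[ N ] ∀ m n → N ℕ.≤ m → N ℕ.≤ n → ∣ x m ℚ.- x n ∣ ℚ.≤ ε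

record ℝ : Set where
  constructor mkℝ
  field
    seq    : ℕ → ℚ
    cauchy : CauchySequence seq

open ℝ public

Eventually : Pred ℕ 0ℓ → Set
Eventually P = ∃[ N ] ∀ n → N ℕ.≤ n → P n

infix 4 _≃_ _≤_ _<_

_≃_ : Rel ℝ 0ℓ
x ≃ y = ∀ ε → 0ℚ ℚ.< ε → Eventually λ n → ∣ seq x n ℚ.- seq y n ∣ ℚ.≤ ε

_≤_ : Rel ℝ 0ℓ
x ≤ y = ∀ ε → 0ℚ ℚ.< ε → Eventually λ n → seq x n ℚ.≤ seq y n ℚ.+ ε

_<_ : Rel ℝ 0ℓ
x < y = ∃[ ε ] 0ℚ ℚ.< ε × Eventually λ n → seq x n ℚ.+ ε ℚ.≤ seq y n

private
  open ℚ.≤-Reasoning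
  open +-*-Solver

  -- Abstract: only the sequence of a real is ever meant to be unfolded.
  abstract
    +-interchange : ∀ a b c d →
      (a ℚ.+ b) ℚ.- (c ℚ.+ d) ≡ (a ℚ.- c) ℚ.+ (b ℚ.- d)
    +-interchange =
      solve 4 (λ a b c d → (a :+ b) :- (c :+ d) := (a :- c) :+ (b :- d)) refl

    p≡p-q+q : ∀ p q → p ≡ (p ℚ.- q) ℚ.+ q
    p≡p-q+q = solve 2 (λ p q → p := (p :- q) :+ q) refl

    *-difference : ∀ a b c d →
      a ℚ.* b ℚ.- c ℚ.* d ≡ a ℚ.* (b ℚ.- d) ℚ.+ d ℚ.* (a ℚ.- c)
    *-difference =
      solve 4 (λ a b c d → a :* b :- c :* d := a :* (b :- d) :+ d :* (a :- c)) refl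

    0<½*ε : ∀ {ε} → 0ℚ ℚ.< ε → 0ℚ ℚ.< ½ ℚ.* ε
    0<½*ε {ε} 0<ε =
      ℚ.positive⁻¹ _ {{ℚ.pos*pos⇒pos ½ ε {{positive 0<ε}}}}

    const-cauchy : ∀ q → CauchySequence λ _ → q
    const-cauchy q ε 0<ε = 0 , λ _ _ _ _ → begin
      ∣ q ℚ.- q ∣  ≡⟨ cong ∣_∣ (ℚ.+-inverseʳ q) ⟩
      0ℚ           <⟨ 0<ε ⟩
      ε            ∎

    +-cauchy : ∀ {x y} → CauchySequence x → CauchySequence y →
               CauchySequence λ n → x n ℚ.+ y n
    +-cauchy {x} {y} cx cy ε 0<ε
      with cx (½ ℚ.* ε) (0<½*ε 0<ε) | cy (½ ℚ.* ε) (0<½*ε 0<ε)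
    ... | M , hx | N , hy = M ⊔ N , λ m n M⊔N≤m M⊔N≤n → begin
      ∣ (x m ℚ.+ y m) ℚ.- (x n ℚ.+ y n) ∣
        ≡⟨ cong ∣_∣ (+-interchange (x m) (y m) (x n) (y n)) ⟩
      ∣ (x m ℚ.- x n) ℚ.+ (y m ℚ.- y n) ∣
        ≤⟨ ℚ.∣p+q∣≤∣p∣+∣q∣ (x m ℚ.- x n) (y m ℚ.- y n) ⟩
      ∣ x m ℚ.- x n ∣ ℚ.+ ∣ y m ℚ.- y n ∣
        ≤⟨ ℚ.+-mono-≤ (hx m n (ℕ.m⊔n≤o⇒m≤o M N M⊔N≤m) (ℕ.m⊔n≤o⇒m≤o M N M⊔N≤n))
                      (hy m n (ℕ.m⊔n≤o⇒n≤o M N M⊔N≤m) (ℕ.m⊔n≤o⇒n≤o M N M⊔N≤n)) ⟩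
      ½ ℚ.* ε ℚ.+ ½ ℚ.* ε
        ≡⟨ sym (ℚ.*-distribʳ-+ ε ½ ½) ⟩
      1ℚ ℚ.* ε
        ≡⟨ ℚ.*-identityˡ ε ⟩
      ε ∎

    neg-cauchy : ∀ {x} → CauchySequence x → CauchySequence λ n → ℚ.- x n
    neg-cauchy {x} cx ε 0<ε with cx ε 0<ε
    ... | N , h = N , λ m n N≤m N≤n → begin
      ∣ ℚ.- x m ℚ.- ℚ.- x n ∣  ≡⟨ cong ∣_∣ (sym (ℚ.neg-distrib-+ (x m) (ℚ.- x n))) ⟩
      ∣ ℚ.- (x m ℚ.- x n) ∣    ≡⟨ ℚ.∣-p∣≡∣p∣ (x m ℚ.- x n) ⟩
      ∣ x m ℚ.- x n ∣          ≤⟨ h m n N≤m N≤n ⟩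
      ε                        ∎

    bounded : ∀ {x} → CauchySequence x →
              ∃[ B ] 0ℚ ℚ.< B × Eventually λ n → ∣ x n ∣ ℚ.≤ B
    bounded {x} cx with cx 1ℚ (ℚ.positive⁻¹ 1ℚ)
    ... | N , h = 1ℚ ℚ.+ ∣ x N ∣
                , ℚ.+-mono-<-≤ (ℚ.positive⁻¹ 1ℚ) (ℚ.0≤∣p∣ (x N))
                , N , λ n N≤n → begin
      ∣ x n ∣
        ≡⟨ cong ∣_∣ (p≡p-q+q (x n) (x N)) ⟩
      ∣ (x n ℚ.- x N) ℚ.+ x N ∣
        ≤⟨ ℚ.∣p+q∣≤∣p∣+∣q∣ (x n ℚ.- x N) (x N) ⟩
      ∣ x n ℚ.- x N ∣ ℚ.+ ∣ x N ∣
        ≤⟨ ℚ.+-monoˡ-≤ ∣ x N ∣ (h n N N≤n ℕ.≤-refl) ⟩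
      1ℚ ℚ.+ ∣ x N ∣ ∎

    *-bound : ∀ {p q B C} → ∣ p ∣ ℚ.≤ B → 0ℚ ℚ.≤ C → ∣ q ∣ ℚ.≤ C →
              ∣ p ℚ.* q ∣ ℚ.≤ B ℚ.* C
    *-bound {p} {q} {B} {C} p≤B 0≤C q≤C = begin
      ∣ p ℚ.* q ∣      ≡⟨ ℚ.∣p*q∣≡∣p∣*∣q∣ p q ⟩
      ∣ p ∣ ℚ.* ∣ q ∣  ≤⟨ ℚ.*-monoˡ-≤-nonNeg ∣ p ∣ {{ℚ.nonNegative (ℚ.0≤∣p∣ p)}} q≤C ⟩
      ∣ p ∣ ℚ.* C      ≤⟨ ℚ.*-monoʳ-≤-nonNeg C {{ℚ.nonNegative 0≤C}} p≤B ⟩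
      B ℚ.* C          ∎

    0<+ : ∀ {p q} → 0ℚ ℚ.< p → 0ℚ ℚ.< q → 0ℚ ℚ.< p ℚ.+ q
    0<+ = ℚ.+-mono-<

    divide : ∀ {D ε} → 0ℚ ℚ.< D → 0ℚ ℚ.< ε → ∃[ δ ] 0ℚ ℚ.< δ × D ℚ.* δ ≡ ε
    divide {D} {ε} 0<D 0<ε = D⁻¹ ℚ.* ε , 0<δ , (begin-equality
      D ℚ.* (D⁻¹ ℚ.* ε)  ≡⟨ sym (ℚ.*-assoc D D⁻¹ ε) ⟩
      (D ℚ.* D⁻¹) ℚ.* ε  ≡⟨ cong (ℚ._* ε) (ℚ.*-inverseʳ D {{D≢0}}) ⟩
      1ℚ ℚ.* ε           ≡⟨ ℚ.*-identityˡ ε ⟩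
      ε                  ∎)
      where
      D≢0 : ℚ.NonZero D
      D≢0 = ℚ.pos⇒nonZero D {{positive 0<D}}

      D⁻¹ : ℚ
      D⁻¹ = (1/ D) {{D≢0}}

      0<δ : 0ℚ ℚ.< D⁻¹ ℚ.* ε
      0<δ = ℚ.positive⁻¹ (D⁻¹ ℚ.* ε)
        {{ℚ.pos*pos⇒pos D⁻¹ {{ℚ.1/pos⇒pos D {{positive 0<D}}}} ε {{positive 0<ε}}}}

    *-difference-bound : ∀ {B C δ} → 0ℚ ℚ.≤ δ → ∀ a b c d →
      ∣ a ∣ ℚ.≤ B → ∣ d ∣ ℚ.≤ C → ∣ a ℚ.- c ∣ ℚ.≤ δ → ∣ b ℚ.- d ∣ ℚ.≤ δ →
      ∣ a ℚ.* b ℚ.- c ℚ.* d ∣ ℚ.≤ (B ℚ.+ C) ℚ.* δ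
    *-difference-bound {B} {C} {δ} 0≤δ a b c d a≤B d≤C a-c≤δ b-d≤δ = begin
      ∣ a ℚ.* b ℚ.- c ℚ.* d ∣
        ≡⟨ cong ∣_∣ (*-difference a b c d) ⟩
      ∣ a ℚ.* (b ℚ.- d) ℚ.+ d ℚ.* (a ℚ.- c) ∣
        ≤⟨ ℚ.∣p+q∣≤∣p∣+∣q∣ (a ℚ.* (b ℚ.- d)) (d ℚ.* (a ℚ.- c)) ⟩
      ∣ a ℚ.* (b ℚ.- d) ∣ ℚ.+ ∣ d ℚ.* (a ℚ.- c) ∣
        ≤⟨ ℚ.+-mono-≤ (*-bound {a} {b ℚ.- d} a≤B 0≤δ b-d≤δ)
                      (*-bound {d} {a ℚ.- c} d≤C 0≤δ a-c≤δ) ⟩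
      B ℚ.* δ ℚ.+ C ℚ.* δ
        ≡⟨ sym (ℚ.*-distribʳ-+ δ B C) ⟩
      (B ℚ.+ C) ℚ.* δ ∎

    *-cauchy : ∀ {x y} → CauchySequence x → CauchySequence y →
               CauchySequence λ n → x n ℚ.* y n
    *-cauchy {x} {y} cx cy ε 0<ε =
      let
        B , 0<B , K , x≤B = bounded cx
        C , 0<C , L , y≤C = bounded cy
        δ , 0<δ , [B+C]δ≡ε = divide {B ℚ.+ C} {ε} (0<+ {B} {C} 0<B 0<C) 0<ε
        M , hx = cx δ 0<δ
        N , hy = cy δ 0<δ
      in (K ⊔ L) ⊔ (M ⊔ N) , λ m n R≤m R≤n →
      let
        KL≤m = ℕ.m⊔n≤o⇒m≤o (K ⊔ L) (M ⊔ N) R≤m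
        MN≤m = ℕ.m⊔n≤o⇒n≤o (K ⊔ L) (M ⊔ N) R≤m
        KL≤n = ℕ.m⊔n≤o⇒m≤o (K ⊔ L) (M ⊔ N) R≤n
        MN≤n = ℕ.m⊔n≤o⇒n≤o (K ⊔ L) (M ⊔ N) R≤n
      in ℚ.≤-trans
        (*-difference-bound {B} {C} {δ} (ℚ.<⇒≤ 0<δ) (x m) (y m) (x n) (y n)
          (x≤B m (ℕ.m⊔n≤o⇒m≤o K L KL≤m))
          (y≤C n (ℕ.m⊔n≤o⇒n≤o K L KL≤n))
          (hx m n (ℕ.m⊔n≤o⇒m≤o M N MN≤m) (ℕ.m⊔n≤o⇒m≤o M N MN≤n))
          (hy m n (ℕ.m⊔n≤o⇒n≤o M N MN≤m) (ℕ.m⊔n≤o⇒n≤o M N MN≤n)))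
        (ℚ.≤-reflexive [B+C]δ≡ε)

infixl 6 _+ʳ_
infixl 7 _*ʳ_
infix  8 -ʳ_

ℚ⇒ℝ : ℚ → ℝ
ℚ⇒ℝ q = mkℝ (λ _ → q) (const-cauchy q)

0ℝ 1ℝ : ℝ
0ℝ = ℚ⇒ℝ 0ℚ
1ℝ = ℚ⇒ℝ 1ℚ

_+ʳ_ _*ʳ_ : ℝ → ℝ → ℝ
x +ʳ y = mkℝ (λ n → seq x n ℚ.+ seq y n) (+-cauchy {seq x} {seq y} (cauchy x) (cauchy y))
x *ʳ y = mkℝ (λ n → seq x n ℚ.* seq y n) (*-cauchy {seq x} {seq y} (cauchy x) (cauchy y))

-ʳ_ : ℝ → ℝ
-ʳ x = mkℝ (λ n → ℚ.- seq x n) (neg-cauchy {seq x} (cauchy x))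

record ℂ : Set where
  constructor _+i_
  field
    re im : ℝ

open ℂ public

ℝ⇒ℂ : ℝ → ℂ
ℝ⇒ℂ x = x +i 0ℝ

ℚ⇒ℂ : ℚ → ℂ
ℚ⇒ℂ q = ℝ⇒ℂ (ℚ⇒ℝ q)

infix 4 _≃ᶜ_

_≃ᶜ_ : Rel ℂ 0ℓ
z ≃ᶜ w = re z ≃ re w × im z ≃ im w

-- ∣z∣²
normSq : ℂ → ℝ
normSq z = re z *ʳ re z +ʳ im z *ʳ im z

ℂ-rawRing : RawRing 0ℓ 0ℓ
ℂ-rawRing = record
  { Carrier = ℂ
  ; _≈_     = _≃ᶜ_
  ; _+_     = λ z w → (re z +ʳ re w) +i (im z +ʳ im w)
  ; _*_     = λ z w → (re z *ʳ re w +ʳ -ʳ (im z *ʳ im w))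
                   +i (re z *ʳ im w +ʳ im z *ʳ re w)
  ; -_      = λ z → (-ʳ re z) +i (-ʳ im z)
  ; 0#      = ℝ⇒ℂ 0ℝ
  ; 1#      = ℝ⇒ℂ 1ℝ
  }

open RawRing ℂ-rawRing public
  using (_+_; _*_; -_) renaming (0# to 0ℂ; 1# to 1ℂ)
open RawSemiringDefinitions (RawRing.rawSemiring ℂ-rawRing) public
  using (_^_)

-- c₀ ∷ … ∷ c_{d-1} ∷ [] stands for X^d + c_{d-1} X^{d-1} + … + c₀.
Monic : Set → ℕ → Set
Monic R d = Vec R d

eval : ∀ {d} → Monic ℚ d → ℂ → ℂ
eval []       z = 1ℂ
eval (c ∷ cs) z = ℚ⇒ℂ c + z * eval cs z

IsRoot : ∀ {d} → Monic ℚ d → ℂ → Set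
IsRoot f z = eval f z ≃ᶜ 0ℂ

IsMinimalPolynomial : ∀ {d} → Monic ℚ d → ℂ → Set
IsMinimalPolynomial {d} f z =
  IsRoot f z × (∀ {e} (g : Monic ℚ e) → IsRoot g z → d ℕ.≤ e)

HasDegree : ℂ → ℕ → Set
HasDegree z d = Σ[ f ∈ Monic ℚ d ] IsMinimalPolynomial f z

IsConjugate : ℂ → ℂ → Set
IsConjugate z w =
  ∃[ d ] Σ[ f ∈ Monic ℚ d ] IsMinimalPolynomial f z × IsRoot f w

IsAlgebraicInteger : ℂ → Set
IsAlgebraicInteger z = ∃[ d ] Σ[ f ∈ Monic ℤ d ] IsRoot (map (ℚ._/ 1) f) z

IsUnit : ℂ → Set
IsUnit z = IsAlgebraicInteger z × ∃[ w ] z * w ≃ᶜ 1ℂ × IsAlgebraicInteger w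

record IsSalem (α : ℝ) : Set where
  field
    isAlgebraicInteger : IsAlgebraicInteger (ℝ⇒ℂ α)
    1<α                : 1ℝ < α
    others≤1           : ∀ w → IsConjugate (ℝ⇒ℂ α) w → ¬ w ≃ᶜ ℝ⇒ℂ α → normSq w ≤ 1ℝ
    -- Such a w is automatically different from α, as 1 < α.
    onUnitCircle       : ∃[ w ] IsConjugate (ℝ⇒ℂ α) w × normSq w ≃ 1ℝ

-- P holds of infinitely many elements, counted up to _≈_.
Infinite : {A : Set a} → Rel A ℓ → Pred A p → Set (a Level.⊔ ℓ Level.⊔ p)
Infinite {A = A} _≈_ P =
  Σ[ f ∈ (ℕ → A) ] Injective _≡_ _≈_ f × (∀ i → P (f i))

-- For odd k and a large integer a let
--
--   f(z) = (z² − a z + 1)(z + 1)(z^k − 1)(z^(k+1) − 1) − z^(k+2) = z^(k+2) R(z + z⁻¹),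
--
-- where R(t) = (t − a) D(t) − 1 and D is monic with k + 1 simple roots in [−2, 2].
-- At a root α of f the product on the left is a unit, hence so is α^n − 1 whenever
-- n divides k + 1.  The polynomial D changes sign at the points 2 cos (2πi/(2k+1)),
-- and for large a so does R, which therefore has k + 1 roots in (−2, 2) and one
-- large root; this makes the large root α of f a Salem number once f is irreducible.
--
-- R is irreducible because R(a) = −1: a factor T of R over ℚ without the large root
-- takes an integral value at a which divides −1, while |T(a)| = ∏ |a − b| ≥ 2 over its
-- roots b ∈ [−2, 2].  If α had degree less than twice that of R, a relation
-- U(β) + V(β) α⁻¹ = 0 with β = α + α⁻¹ and U monic of degree below deg R would give a
-- zero of the norm U² + U V t + V² at β, hence at a root b ∈ (−2, 2), where this form
-- is definite; so U(b) = 0, which contradicts the irreducibility of R.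
module Submission where

open import Algebra.Bundles using (CommutativeRing)
open import Algebra.Morphism.Structures using (IsRingHomomorphism)
open import Data.Integer.Base as ℤ using (ℤ)
open import Data.Rational.Base as ℚ using (ℚ)

-- The factors z^k - 1 and z^(k+1) - 1 give the units, but their product has odd degree; z + 1 makes
-- the degree even, so that the whole is a power of z times a polynomial in z + z⁻¹. The parameter a
-- yields infinitely many Salem numbers of one degree, and k yields the degrees.
--
-- Equality and order of Cauchy reals are undecidable, which shapes the analytic half. Roots are
-- found by bisection with sign tests at rational points. The cosines are algebraic: 2 cos (π/(2k +
-- 1)) is the largest root of a Chebyshev polynomial, and since strict inequalities persist nearby,
-- a rational approximation serves as well. Case distinctions about real or complex numbers are made
-- under double negation, which suffices because they end in a contradiction or in a stable
-- statement `≤` or `≃`.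
--
-- That T(a) is an integer does not rest on the lemma of Gauss: T(a) is rational and a product of
-- differences of algebraic integers, so the closure of these under ring operations and the rational
-- root theorem give it.

-- Solving ring identities with integer coefficients over an arbitrary commutative ring.

module IntegerCoefficients {c ℓ} (R : CommutativeRing c ℓ) where

  open import Algebra.Solver.Ring.AlmostCommutativeRing
    using (_-Raw-AlmostCommutative⟶_; fromCommutativeRing)
  open import Data.Integer.Base as ℤ using (ℤ; +_; -[1+_]; _⊖_)
  import Data.Integer.Properties as ℤ
  open import Data.Maybe.Base using (Maybe; just; nothing)
  open import Data.Nat.Base as ℕ using (ℕ; zero; suc)
  open import Relation.Binary.PropositionalEquality as ≡ using (_≡_)
  open import Relation.Nullary.Decidable using (yes; no)

  open CommutativeRing R
  open import Algebra.Properties.Ring ring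
    using (-‿distribˡ-*; -‿distribʳ-*; -0#≈0#; -‿involutive; -‿+-comm)
  open import Algebra.Properties.Semiring.Mult.TCOptimised semiring
    using (_×_; ×-homo-+; ×1-homo-*; 1+×)
  open import Relation.Binary.Reasoning.Setoid setoid

  -- With the optimised multiples, `1 × 1#` is `1#` by definition, so that the solver constants `:1`
  -- and `:2` evaluate to the terms `1#` and `1# + 1#` of the statements.
  ⟦_⟧ : ℤ → Carrier
  ⟦ + n ⟧      = n × 1#
  ⟦ -[1+ n ] ⟧ = - (suc n × 1#)

  private
    cancel : ∀ x y z → (x + y) - (x + z) ≈ y - z
    cancel x y z = begin
      (x + y) - (x + z)        ≈⟨ +-congˡ (sym (-‿+-comm x z)) ⟩
      (x + y) + (- x - z)      ≈⟨ +-congʳ (+-comm x y) ⟩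
      (y + x) + (- x - z)      ≈⟨ +-assoc y x _ ⟩
      y + (x + (- x - z))      ≈⟨ +-congˡ (sym (+-assoc x (- x) (- z))) ⟩
      y + ((x - x) - z)        ≈⟨ +-congˡ (+-congʳ (-‿inverseʳ x)) ⟩
      y + (0# - z)             ≈⟨ +-congˡ (+-identityˡ _) ⟩
      y - z                    ∎

    ⊖-homo : ∀ m n → ⟦ m ⊖ n ⟧ ≈ m × 1# - n × 1#
    ⊖-homo m zero = sym (trans (+-congˡ -0#≈0#) (+-identityʳ _))
    ⊖-homo zero (suc n) = sym (+-identityˡ _)
    ⊖-homo (suc m) (suc n) = begin
      ⟦ suc m ⊖ suc n ⟧                   ≡⟨ ≡.cong ⟦_⟧ (ℤ.[1+m]⊖[1+n]≡m⊖n m n) ⟩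
      ⟦ m ⊖ n ⟧                           ≈⟨ ⊖-homo m n ⟩
      m × 1# - n × 1#                     ≈⟨ sym (cancel 1# _ _) ⟩
      (1# + m × 1#) - (1# + n × 1#)       ≈⟨ +-cong (sym (1+× m 1#)) (-‿cong (sym (1+× n 1#))) ⟩
      suc m × 1# - suc n × 1#             ∎

    +-homo : ∀ i j → ⟦ i ℤ.+ j ⟧ ≈ ⟦ i ⟧ + ⟦ j ⟧
    +-homo (+ m)    (+ n)    = ×-homo-+ 1# m n
    +-homo (+ m)    -[1+ n ] = ⊖-homo m (suc n)
    +-homo -[1+ m ] (+ n)    = trans (⊖-homo n (suc m)) (+-comm _ _)
    +-homo -[1+ m ] -[1+ n ] = begin
      - (suc (suc (m ℕ.+ n)) × 1#)        ≡⟨ ≡.cong (λ k → - (k × 1#)) (≡.sym (ℕ+-suc (suc m) n)) ⟩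
      - ((suc m ℕ.+ suc n) × 1#)          ≈⟨ -‿cong (×-homo-+ 1# (suc m) (suc n)) ⟩
      - (suc m × 1# + suc n × 1#)         ≈⟨ sym (-‿+-comm _ _) ⟩
      - (suc m × 1#) - (suc n × 1#)       ∎
      where open import Data.Nat.Properties using () renaming (+-suc to ℕ+-suc)

    neg-homo : ∀ i → ⟦ ℤ.- i ⟧ ≈ - ⟦ i ⟧
    neg-homo (+ zero)  = sym -0#≈0#
    neg-homo (+ suc n) = refl
    neg-homo -[1+ n ]  = sym (-‿involutive _)

    *-homo-+ : ∀ m j → ⟦ + m ℤ.* j ⟧ ≈ ⟦ + m ⟧ * ⟦ j ⟧
    *-homo-+ m (+ n) = begin
      ⟦ + m ℤ.* + n ⟧        ≡⟨ ≡.cong ⟦_⟧ (≡.sym (ℤ.pos-* m n)) ⟩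
      (m ℕ.* n) × 1#         ≈⟨ ×1-homo-* m n ⟩
      (m × 1#) * (n × 1#)    ∎
    *-homo-+ m -[1+ n ] = begin
      ⟦ + m ℤ.* -[1+ n ] ⟧          ≡⟨ ≡.cong ⟦_⟧ (≡.sym (ℤ.neg-distribʳ-* (+ m) (+ suc n))) ⟩
      ⟦ ℤ.- (+ m ℤ.* + suc n) ⟧     ≈⟨ neg-homo (+ m ℤ.* + suc n) ⟩
      - ⟦ + m ℤ.* + suc n ⟧         ≈⟨ -‿cong (*-homo-+ m (+ suc n)) ⟩
      - ((m × 1#) * (suc n × 1#))   ≈⟨ -‿distribʳ-* _ _ ⟩
      (m × 1#) * - (suc n × 1#)     ∎

    *-homo : ∀ i j → ⟦ i ℤ.* j ⟧ ≈ ⟦ i ⟧ * ⟦ j ⟧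
    *-homo (+ m)    j = *-homo-+ m j
    *-homo -[1+ m ] j = begin
      ⟦ -[1+ m ] ℤ.* j ⟧          ≡⟨ ≡.cong ⟦_⟧ (≡.sym (ℤ.neg-distribˡ-* (+ suc m) j)) ⟩
      ⟦ ℤ.- (+ suc m ℤ.* j) ⟧     ≈⟨ neg-homo (+ suc m ℤ.* j) ⟩
      - ⟦ + suc m ℤ.* j ⟧         ≈⟨ -‿cong (*-homo-+ (suc m) j) ⟩
      - ((suc m × 1#) * ⟦ j ⟧)    ≈⟨ -‿distribˡ-* _ _ ⟩
      - (suc m × 1#) * ⟦ j ⟧      ∎

    morphism : ℤ.+-*-rawRing -Raw-AlmostCommutative⟶ fromCommutativeRing R
    morphism = record
      { ⟦_⟧    = ⟦_⟧
      ; +-homo = +-homo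
      ; *-homo = *-homo
      ; -‿homo = neg-homo
      ; 0-homo = refl
      ; 1-homo = refl
      }

    equal? : ∀ i j → Maybe (⟦ i ⟧ ≈ ⟦ j ⟧)
    equal? i j with i ℤ.≟ j
    ... | yes ≡.refl = just refl
    ... | no _       = nothing

  open import Algebra.Solver.Ring ℤ.+-*-rawRing (fromCommutativeRing R) morphism equal? public
    using (Polynomial; solve; con; _:=_; _:+_; _:*_; _:-_; :-_; _:^_)

  :0 :1 :2 :4 : ∀ {n} → Polynomial n
  :0 = con (+ 0)
  :1 = con (+ 1)
  :2 = con (+ 2)
  :4 = con (+ 4)

-- Chebyshev polynomials and the polynomials f, D and R.

module Chebyshev {c ℓ} (R : CommutativeRing c ℓ) where

  open import Algebra.Bundles using (CommutativeRing; Semiring)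

  open import Data.Nat.Base as ℕ using (ℕ; zero; suc)
  import Data.Nat.Properties as ℕ
  import Data.Nat.Solver
  private module N = Data.Nat.Solver.+-*-Solver
  open import Relation.Binary.PropositionalEquality as ≡ using (_≡_)

  open CommutativeRing R
  open IntegerCoefficients R
  open import Algebra.Definitions.RawSemiring (Semiring.rawSemiring semiring) using (_^_)
  open import Relation.Binary.Reasoning.Setoid setoid

  -- For x = 2 cos θ: S x n = sin nθ / sin θ and C x n = 2 cos nθ.
  S C : Carrier → ℕ → Carrier
  S x zero          = 0#
  S x (suc zero)    = 1#
  S x (suc (suc n)) = x * S x (suc n) - S x n
  C x zero          = 1# + 1#
  C x (suc zero)    = x
  C x (suc (suc n)) = x * C x (suc n) - C x n

  S-cong : ∀ {x y} → x ≈ y → ∀ n → S x n ≈ S y n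
  S-cong x≈y zero          = refl
  S-cong x≈y (suc zero)    = refl
  S-cong x≈y (suc (suc n)) =
    +-cong (*-cong x≈y (S-cong x≈y (suc n))) (-‿cong (S-cong x≈y n))

  C-cong : ∀ {x y} → x ≈ y → ∀ n → C x n ≈ C y n
  C-cong x≈y zero          = refl
  C-cong x≈y (suc zero)    = x≈y
  C-cong x≈y (suc (suc n)) =
    +-cong (*-cong x≈y (C-cong x≈y (suc n))) (-‿cong (C-cong x≈y n))

  private
    step-cong : ∀ x {a b a′ b′} → a ≈ a′ → b ≈ b′ → x * a - b ≈ x * a′ - b′
    step-cong x p q = +-cong (*-congˡ p) (-‿cong q)

  -- The addition formula 2 cos nθ sin θ = 2 sin (n+1)θ - 2 cos θ sin nθ; it turns identities about
  -- `C` into identities about `S`.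
  C-via-S : ∀ x n → C x n ≈ (1# + 1#) * S x (suc n) - x * S x n
  C-via-S x zero =
    solve 1 (λ x → :2 := :2 :* :1 :- x :* :0) refl x
  C-via-S x (suc zero) =
    solve 1 (λ x → x := :2 :* (x :* :1 :- :0) :- x :* :1) refl x
  C-via-S x (suc (suc n)) = begin
    x * C x (suc n) - C x n
      ≈⟨ step-cong x (C-via-S x (suc n)) (C-via-S x n) ⟩
    x * ((1# + 1#) * S x (suc (suc n)) - x * S x (suc n))
      - ((1# + 1#) * S x (suc n) - x * S x n)
      ≈⟨ solve 3 (λ x a b → x :* (:2 :* (x :* b :- a) :- x :* b) :- (:2 :* b :- x :* a)
           := :2 :* (x :* (x :* b :- a) :- b) :- x :* (x :* b :- a)) refl x (S x n) (S x (suc n)) ⟩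
    (1# + 1#) * S x (suc (suc (suc n))) - x * S x (suc (suc n)) ∎

  -- The quadratic form b² - x b a + a² is invariant under the step (a, b) ↦ (b, x b - a) of the
  -- recurrence.
  cassini : ∀ x n → S x (suc n) * S x (suc n) - x * S x (suc n) * S x n + S x n * S x n ≈ 1#
  cassini x zero = solve 1 (λ x → :1 :* :1 :- x :* :1 :* :0 :+ :0 :* :0 := :1) refl x
  cassini x (suc n) = trans
    (solve 3 (λ x a b → let b′ = x :* b :- a in
       b′ :* b′ :- x :* b′ :* b :+ b :* b := b :* b :- x :* b :* a :+ a :* a)
       refl x (S x n) (S x (suc n)))
    (cassini x n)

  -- The formula S(m+k) = S(m) S(k+1) - S(m-1) S(k), with S(m-1) written as x S(m) - S(m+1) so that
  -- m = 0 is included.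
  S-+ : ∀ x m k → S x (m ℕ.+ k) ≈ S x m * S x (suc k) + S x (suc m) * S x k - x * S x m * S x k
  S-+ x zero k =
    solve 3 (λ x a b → a := :0 :* b :+ :1 :* a :- x :* :0 :* a) refl x (S x k) (S x (suc k))
  S-+ x (suc zero) k =
    solve 3 (λ x a b → b := :1 :* b :+ (x :* :1 :- :0) :* a :- x :* :1 :* a)
      refl x (S x k) (S x (suc k))
  S-+ x (suc (suc m)) k = begin
    x * S x (suc (m ℕ.+ k)) - S x (m ℕ.+ k)
      ≈⟨ step-cong x (S-+ x (suc m) k) (S-+ x m k) ⟩
    _ ≈⟨ solve 5 (λ x p r a b →
           x :* (r :* b :+ (x :* r :- p) :* a :- x :* r :* a)
             :- (p :* b :+ r :* a :- x :* p :* a)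
           := let r′ = x :* r :- p in
              r′ :* b :+ (x :* r′ :- r) :* a :- x :* r′ :* a)
           refl x (S x m) (S x (suc m)) (S x k) (S x (suc k)) ⟩
    _ ∎

  S-+-suc : ∀ x m k → S x (suc (m ℕ.+ k)) ≈ S x (suc m) * S x (suc k) - S x m * S x k
  S-+-suc x zero k =
    solve 2 (λ a b → b := :1 :* b :- :0 :* a) refl (S x k) (S x (suc k))
  S-+-suc x (suc zero) k =
    solve 3 (λ x a b → x :* b :- a := (x :* :1 :- :0) :* b :- :1 :* a)
      refl x (S x k) (S x (suc k))
  S-+-suc x (suc (suc m)) k = begin
    x * S x (suc (suc (m ℕ.+ k))) - S x (suc (m ℕ.+ k))
      ≈⟨ step-cong x (S-+-suc x (suc m) k) (S-+-suc x m k) ⟩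
    _ ≈⟨ solve 5 (λ x p r a b →
           x :* ((x :* r :- p) :* b :- r :* a) :- (r :* b :- p :* a)
           := let r′ = x :* r :- p in
              (x :* r′ :- r) :* b :- r′ :* a)
           refl x (S x m) (S x (suc m)) (S x k) (S x (suc k)) ⟩
    _ ∎

  -- The sum-to-product formula for cosines. After the addition theorems, `C x j` is the only term
  -- that is not quadratic in `S x k` and `S x (suc k)`; multiplying it by the left side of
  -- `cassini` at k, which is 1, makes the claim a polynomial identity.
  C-+ : ∀ x j k → C x (j ℕ.+ k ℕ.+ k) + C x j ≈ C x k * C x (j ℕ.+ k)
  C-+ x j k = begin
    C x (j ℕ.+ k ℕ.+ k) + C x j
      ≈⟨ +-cong (C-via-S x (j ℕ.+ k ℕ.+ k)) (trans (C-via-S x j) (sym (*-identityʳ _))) ⟩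
    (1# + 1#) * S x (suc (j ℕ.+ k ℕ.+ k)) - x * S x (j ℕ.+ k ℕ.+ k)
      + ((1# + 1#) * S x (suc j) - x * S x j) * 1#
      ≈⟨ +-cong (+-cong (*-congˡ (S-+-suc x (j ℕ.+ k) k)) (-‿cong (*-congˡ (S-+ x (j ℕ.+ k) k))))
                (*-congˡ (sym (cassini x k))) ⟩
    (1# + 1#) * (S x (suc (j ℕ.+ k)) * b - S x (j ℕ.+ k) * a)
      - x * (S x (j ℕ.+ k) * b + S x (suc (j ℕ.+ k)) * a - x * S x (j ℕ.+ k) * a)
      + ((1# + 1#) * r - x * p) * (b * b - x * b * a + a * a)
      ≈⟨ +-congʳ (+-cong (*-congˡ (+-cong (*-congʳ r′) (-‿cong (*-congʳ p′))))
           (-‿cong (*-congˡ (+-cong (+-cong (*-congʳ p′) (*-congʳ r′))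
              (-‿cong (*-congʳ (*-congˡ p′))))))) ⟩
    _ ≈⟨ solve 5 (λ x p r a b →
           let p′ = p :* b :+ r :* a :- x :* p :* a
               r′ = r :* b :- p :* a in
           :2 :* (r′ :* b :- p′ :* a) :- x :* (p′ :* b :+ r′ :* a :- x :* p′ :* a)
             :+ (:2 :* r :- x :* p) :* (b :* b :- x :* b :* a :+ a :* a)
           := (:2 :* b :- x :* a) :* (:2 :* r′ :- x :* p′)) refl x p r a b ⟩
    _ ≈⟨ *-cong (sym (C-via-S x k))
           (+-cong (*-congˡ (sym r′)) (-‿cong (*-congˡ (sym p′)))) ⟩
    C x k * ((1# + 1#) * S x (suc (j ℕ.+ k)) - x * S x (j ℕ.+ k))
      ≈⟨ *-congˡ (sym (C-via-S x (j ℕ.+ k))) ⟩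
    C x k * C x (j ℕ.+ k) ∎
    where
    p = S x j
    r = S x (suc j)
    a = S x k
    b = S x (suc k)
    p′ = S-+ x j k
    r′ = S-+-suc x j k

  private
    +⇒- : ∀ {x y z} → x + y ≈ z → x ≈ z - y
    +⇒- {x} {y} {z} h = trans (solve 2 (λ x y → x := x :+ y :- y) refl x y) (+-congʳ h)

    C-≡ : ∀ x {m n} → m ≡ n → C x m ≈ C x n
    C-≡ x ≡.refl = refl

  C-∘ : ∀ x j m → C (C x j) m ≈ C x (m ℕ.* j)
  C-∘ x j zero          = refl
  C-∘ x j (suc zero)    = C-≡ x (≡.sym (ℕ.+-identityʳ j))
  C-∘ x j (suc (suc m)) = begin
    C x j * C (C x j) (suc m) - C (C x j) m
      ≈⟨ step-cong (C x j) (C-∘ x j (suc m)) (C-∘ x j m) ⟩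
    C x j * C x (j ℕ.+ m ℕ.* j) - C x (m ℕ.* j)
      ≈⟨ step-cong (C x j) (C-≡ x (ℕ.+-comm j (m ℕ.* j))) refl ⟩
    C x j * C x (m ℕ.* j ℕ.+ j) - C x (m ℕ.* j)
      ≈⟨ sym (+⇒- (C-+ x (m ℕ.* j) j)) ⟩
    C x (m ℕ.* j ℕ.+ j ℕ.+ j)
      ≈⟨ C-≡ x (N.solve 2 (λ m j → m N.:* j N.:+ j N.:+ j N.:= j N.:+ (j N.:+ m N.:* j)) ≡.refl m j) ⟩
    C x (j ℕ.+ (j ℕ.+ m ℕ.* j)) ∎

  4# : Carrier
  4# = 1# + 1# + 1# + 1#

  -- Both sides are 4 sin² nθ. Again the constant is made quadratic by `cassini`.
  4-C² : ∀ x n → 4# - C x n * C x n ≈ (4# - x * x) * (S x n * S x n)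
  4-C² x n = begin
    4# - C x n * C x n
      ≈⟨ +-cong (sym (trans (*-congˡ (cassini x n)) (*-identityʳ 4#)))
                (-‿cong (*-cong (C-via-S x n) (C-via-S x n))) ⟩
    _ ≈⟨ solve 3 (λ x a b →
           :4 :* (b :* b :- x :* b :* a :+ a :* a)
             :- (:2 :* b :- x :* a) :* (:2 :* b :- x :* a)
           := (:4 :- x :* x) :* (a :* a)) refl x (S x n) (S x (suc n)) ⟩
    _ ∎

  C-C : ∀ x n → C x n - C x (suc (suc n)) ≈ (4# - x * x) * S x (suc n)
  C-C x n = begin
    C x n - C x (suc (suc n))
      ≈⟨ +-cong (C-via-S x n) (-‿cong (C-via-S x (suc (suc n)))) ⟩
    _ ≈⟨ solve 3 (λ x a b → let b′ = x :* b :- a in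
           :2 :* b :- x :* a :- (:2 :* (x :* b′ :- b) :- x :* b′)
           := (:4 :- x :* x) :* b) refl x (S x n) (S x (suc n)) ⟩
    _ ∎

  S-double : ∀ x n → S x (n ℕ.+ n) ≈ S x n * C x n
  S-double x n = begin
    S x (n ℕ.+ n) ≈⟨ S-+ x n n ⟩
    _ ≈⟨ solve 3 (λ x a b → a :* b :+ b :* a :- x :* a :* a := a :* (:2 :* b :- x :* a))
           refl x (S x n) (S x (suc n)) ⟩
    _ ≈⟨ *-congˡ (sym (C-via-S x n)) ⟩
    S x n * C x n ∎

  C-double : ∀ x n → C x (n ℕ.+ n) + (1# + 1#) ≈ C x n * C x n
  C-double x n = C-+ x 0 n

  -- One step of the Christoffel-Darboux formula. The determinant of consecutive values at y and x
  -- grows by the last term, so it stays nonnegative when y ≥ x and the values are positive.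
  christoffel : ∀ x y n →
    S y (suc (suc n)) * S x (suc n) - S y (suc n) * S x (suc (suc n))
      ≈ S y (suc n) * S x n - S y n * S x (suc n) + (y - x) * (S y (suc n) * S x (suc n))
  christoffel x y n =
    solve 6 (λ x y a b a′ b′ →
      (y :* b′ :- a′) :* b :- b′ :* (x :* b :- a)
      := b′ :* a :- a′ :* b :+ (y :- x) :* (b′ :* b))
      refl x y (S x n) (S x (suc n)) (S y n) (S y (suc n))

  C-at-2 : ∀ n → C (1# + 1#) n ≈ 1# + 1#
  C-at-2 zero          = refl
  C-at-2 (suc zero)    = refl
  C-at-2 (suc (suc n)) = trans (step-cong (1# + 1#) (C-at-2 (suc n)) (C-at-2 n))
    (solve 0 (:2 :* :2 :- :2 := :2) refl)

  C-at--2 : ∀ n → C (- (1# + 1#)) (suc n) ≈ - C (- (1# + 1#)) n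
  C-at--2 zero    = refl
  C-at--2 (suc n) = begin
    - (1# + 1#) * C _ (suc n) - C _ n
      ≈⟨ solve 2 (λ a b → :- :2 :* b :- a := :- :2 :* b :+ :- a) refl (C _ n) (C _ (suc n)) ⟩
    - (1# + 1#) * C _ (suc n) + - C _ n
      ≈⟨ +-congˡ (sym (C-at--2 n)) ⟩
    - (1# + 1#) * C _ (suc n) + C _ (suc n)
      ≈⟨ solve 1 (λ b → :- :2 :* b :+ b := :- b) refl (C _ (suc n)) ⟩
    - C _ (suc n) ∎

  ^-inverse : ∀ {z z′} → z * z′ ≈ 1# → ∀ n → z ^ n * z′ ^ n ≈ 1#
  ^-inverse zz′≈1 zero    = *-identityʳ 1#
  ^-inverse {z} {z′} zz′≈1 (suc n) = begin
    z * z ^ n * (z′ * z′ ^ n)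
      ≈⟨ solve 4 (λ z z′ u u′ → z :* u :* (z′ :* u′) := z :* z′ :* (u :* u′))
           refl z z′ (z ^ n) (z′ ^ n) ⟩
    z * z′ * (z ^ n * z′ ^ n)
      ≈⟨ *-cong zz′≈1 (^-inverse zz′≈1 n) ⟩
    1# * 1# ≈⟨ *-identityʳ 1# ⟩
    1# ∎

  C-z+z⁻¹ : ∀ {z z′} → z * z′ ≈ 1# → ∀ n → C (z + z′) n ≈ z ^ n + z′ ^ n
  C-z+z⁻¹ zz′≈1 zero       = refl
  C-z+z⁻¹ zz′≈1 (suc zero) = +-cong (sym (*-identityʳ _)) (sym (*-identityʳ _))
  C-z+z⁻¹ {z} {z′} zz′≈1 (suc (suc n)) = begin
    (z + z′) * C (z + z′) (suc n) - C (z + z′) n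
      ≈⟨ step-cong (z + z′) (C-z+z⁻¹ zz′≈1 (suc n)) (C-z+z⁻¹ zz′≈1 n) ⟩
    (z + z′) * (z * u + z′ * u′) - (u + u′)
      ≈⟨ solve 4 (λ z z′ u u′ → (z :+ z′) :* (z :* u :+ z′ :* u′) :- (u :+ u′)
           := z :* (z :* u) :+ z′ :* (z′ :* u′) :+ z :* z′ :* (u :+ u′) :- (u :+ u′))
           refl z z′ u u′ ⟩
    z * (z * u) + z′ * (z′ * u′) + z * z′ * (u + u′) - (u + u′)
      ≈⟨ +-congʳ (+-congˡ (trans (*-congʳ zz′≈1) (*-identityˡ _))) ⟩
    z * (z * u) + z′ * (z′ * u′) + (u + u′) - (u + u′)
      ≈⟨ solve 2 (λ a b → a :+ b :- b := a) refl _ _ ⟩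
    z * (z * u) + z′ * (z′ * u′) ∎
    where
    u = z ^ n
    u′ = z′ ^ n

  -- D k (z + z⁻¹) = z^(-k-1) (z + 1)(z^k − 1)(z^(k+1) − 1).
  D : ℕ → Carrier → Carrier
  D k t = C t (suc k) + C t k - t - (1# + 1#)

  -- This is R, whose roots are the traces z + z⁻¹ of the roots z of f; f itself is `salem`.
  trace : ℕ → Carrier → Carrier → Carrier
  trace k a t = (t - a) * D k t - 1#

  salem : ℕ → Carrier → Carrier → Carrier
  salem k a z =
    (z * z - a * z + 1#) * (z + 1#) * (z ^ k - 1#) * (z ^ suc k - 1#) - z ^ suc (suc k)

  D-cong : ∀ k {x y} → x ≈ y → D k x ≈ D k y
  D-cong k x≈y =
    +-congʳ (+-cong (+-cong (C-cong x≈y (suc k)) (C-cong x≈y k)) (-‿cong x≈y))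

  trace-cong : ∀ k a {x y} → x ≈ y → trace k a x ≈ trace k a y
  trace-cong k a x≈y = +-congʳ (*-cong (+-congʳ x≈y) (D-cong k x≈y))

  salem-cong : ∀ k a {x y} → x ≈ y → salem k a x ≈ salem k a y
  salem-cong k a {x} {y} x≈y =
    +-cong (*-cong (*-cong (*-cong (+-congʳ (+-cong (*-cong x≈y x≈y) (-‿cong (*-congˡ x≈y))))
      (+-congʳ x≈y)) (+-congʳ (^-cong k))) (+-congʳ (^-cong (suc k)))) (-‿cong (^-cong (suc (suc k))))
    where
    ^-cong : ∀ n → x ^ n ≈ y ^ n
    ^-cong zero    = refl
    ^-cong (suc n) = *-cong x≈y (^-cong n)

  -- Expanding with z′ and u′ = z′^k as independent variables, they survive only in the products e =
  -- z z′ and g = u u′; putting both equal to 1 gives f.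
  salem-trace : ∀ k a {z z′} → z * z′ ≈ 1# →
                salem k a z ≈ z ^ suc (suc k) * trace k a (z + z′)
  salem-trace k a {z} {z′} zz′≈1 = sym (begin
    z * (z * u) * ((z + z′ - a) * (C (z + z′) (suc k) + C (z + z′) k - (z + z′) - (1# + 1#)) - 1#)
      ≈⟨ *-congˡ (+-congʳ (*-congˡ (+-congʳ (+-congʳ
           (+-cong (C-z+z⁻¹ zz′≈1 (suc k)) (C-z+z⁻¹ zz′≈1 k)))))) ⟩
    z * (z * u) * ((z + z′ - a) * (z * u + z′ * u′ + (u + u′) - (z + z′) - (1# + 1#)) - 1#)
      ≈⟨ solve 5 (λ z z′ u u′ a →
           z :* (z :* u) :* ((z :+ z′ :- a) :*
             (z :* u :+ z′ :* u′ :+ (u :+ u′) :- (z :+ z′) :- :2) :- :1)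
           := let e = z :* z′
                  g = u :* u′ in
              (z :* z :+ e :- a :* z) :*
                (z :* z :* u :* u :+ e :* g :+ z :* u :* u :+ z :* g
                 :- z :* z :* u :- e :* u :- :2 :* (z :* u))
              :- z :* (z :* u)) refl z z′ u u′ a ⟩
    poly (z * z′) (u * u′)
      ≈⟨ +-congʳ (*-cong (+-congʳ (+-congˡ zz′≈1))
           (+-congʳ (+-cong (+-congʳ (+-cong (+-congʳ (+-congˡ (*-cong zz′≈1 uu′≈1)))
              (*-congˡ uu′≈1))) (-‿cong (*-congʳ zz′≈1))))) ⟩
    poly 1# 1#
      ≈⟨ solve 3 (λ z u a →
            (z :* z :+ :1 :- a :* z) :*
                (z :* z :* u :* u :+ :1 :* :1 :+ z :* u :* u :+ z :* :1
                 :- z :* z :* u :- :1 :* u :- :2 :* (z :* u))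
              :- z :* (z :* u)
            := (z :* z :- a :* z :+ :1) :* (z :+ :1) :* (u :- :1) :* (z :* u :- :1)
              :- z :* (z :* u)) refl z u a ⟩
    salem k a z ∎)
    where
    u = z ^ k
    u′ = z′ ^ k
    uu′≈1 = ^-inverse zz′≈1 k
    poly : Carrier → Carrier → Carrier
    poly e g =
      (z * z + e - a * z) *
        (z * z * u * u + e * g + z * u * u + z * g - z * z * u - e * u - (1# + 1#) * (z * u))
      - z * (z * u)

  D-at-2 : ∀ k → D k (1# + 1#) ≈ 0#
  D-at-2 k = trans (+-congʳ (+-congʳ (+-cong (C-at-2 (suc k)) (C-at-2 k))))
    (solve 0 (:2 :+ :2 :- :2 :- :2 := :0) refl)

  D-at--2 : ∀ k → D k (- (1# + 1#)) ≈ 0#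
  D-at--2 k = trans (+-congʳ (+-congʳ (+-congʳ (C-at--2 k))))
    (solve 1 (λ x → :- x :+ x :- :- :2 :- :2 := :0) refl (C (- (1# + 1#)) k))

  -- With all `C` taken at c, sum-to-product turns C(2i(k+1)) + C(2ik) into C(i) C(i(2k+1)), and
  -- C(2i) + 2 = C(i)². This is the origin of the sample points: for c = 2 cos (π/(2k+1)) the inner
  -- value C(2k+1) is -2, and D becomes C(i) (±2 - C(i)) with alternating sign.
  D-at-C : ∀ k c i → D k (C c (i ℕ.+ i)) ≈ C c i * (C (C c (suc (k ℕ.+ k))) i - C c i)
  D-at-C k c i = begin
    C x (suc k) + C x k - x - (1# + 1#)
      ≈⟨ +-congʳ (+-congʳ (+-cong (C-∘ c (i ℕ.+ i) (suc k)) (C-∘ c (i ℕ.+ i) k))) ⟩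
    C c (i ℕ.+ i ℕ.+ k ℕ.* (i ℕ.+ i)) + C c (k ℕ.* (i ℕ.+ i)) - x - (1# + 1#)
      ≈⟨ +-congʳ (+-congʳ (+-congʳ (C-≡ c (N.solve 2 (λ k i →
           i N.:+ i N.:+ k N.:* (i N.:+ i) N.:= k N.:* (i N.:+ i) N.:+ i N.:+ i) ≡.refl k i)))) ⟩
    C c (j ℕ.+ i ℕ.+ i) + C c j - x - (1# + 1#)
      ≈⟨ +-congʳ (+-congʳ (C-+ c j i)) ⟩
    C c i * C c (j ℕ.+ i) - x - (1# + 1#)
      ≈⟨ solve 3 (λ p x t → p :- x :- t := p :- (x :+ t)) refl _ x (1# + 1#) ⟩
    C c i * C c (j ℕ.+ i) - (x + (1# + 1#))
      ≈⟨ +-congˡ (-‿cong (C-double c i)) ⟩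
    C c i * C c (j ℕ.+ i) - C c i * C c i
      ≈⟨ solve 2 (λ s t → s :* t :- s :* s := s :* (t :- s)) refl (C c i) (C c (j ℕ.+ i)) ⟩
    C c i * (C c (j ℕ.+ i) - C c i)
      ≈⟨ *-congˡ (+-congʳ (trans (C-≡ c (N.solve 2 (λ k i →
           k N.:* (i N.:+ i) N.:+ i N.:= i N.:* (N.con 1 N.:+ (k N.:+ k))) ≡.refl k i))
           (sym (C-∘ c (suc (k ℕ.+ k)) i)))) ⟩
    C c i * (C (C c (suc (k ℕ.+ k))) i - C c i) ∎
    where
    x = C c (i ℕ.+ i)
    j = k ℕ.* (i ℕ.+ i)

  sign : ℕ → Carrier
  sign zero    = 1#
  sign (suc i) = - sign i

  sign² : ∀ i → sign i * sign i ≈ 1#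
  sign² zero    = *-identityʳ 1#
  sign² (suc i) = trans (solve 1 (λ s → :- s :* :- s := s :* s) refl (sign i)) (sign² i)

  sign-double : ∀ i → sign (i ℕ.+ i) ≈ 1#
  sign-double zero    = refl
  sign-double (suc i) = begin
    - sign (i ℕ.+ suc i)   ≡⟨ ≡.cong (λ j → - sign j) (ℕ.+-suc i i) ⟩
    - - sign (i ℕ.+ i)     ≈⟨ solve 1 (λ s → :- :- s := s) refl _ ⟩
    sign (i ℕ.+ i)         ≈⟨ sign-double i ⟩
    1#                     ∎

  C-at--2-sign : ∀ i → C (- (1# + 1#)) i ≈ sign i * (1# + 1#)
  C-at--2-sign zero    = sym (*-identityˡ _)
  C-at--2-sign (suc i) = trans (C-at--2 i) (trans (-‿cong (C-at--2-sign i))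
    (solve 2 (λ s t → :- (s :* t) := :- s :* t) refl (sign i) (1# + 1#)))

-- Polynomial functions with prescribed coefficients: degrees, division, roots.

module Polynomials {c ℓ} (R : CommutativeRing c ℓ) where

  open import Algebra.Bundles using (CommutativeRing; RawRing; Semiring)

  open import Algebra.Morphism.Structures using (IsRingHomomorphism)
  open import Data.List.Base using (List; []; _∷_; length; foldr)
  open import Data.List.Relation.Unary.All as All using (All; []; _∷_)
  open import Data.List.Relation.Unary.AllPairs using (AllPairs; []; _∷_)
  open import Data.Nat.Base as ℕ using (ℕ; zero; suc; z≤n; s≤s)
  import Data.Nat.Properties as ℕ
  open import Data.Product.Base using (Σ-syntax; ∃-syntax; _×_; _,_)
  open import Data.Vec.Base as Vec using (Vec; []; _∷_)
  open import Level using (_⊔_)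
  open import Relation.Binary.PropositionalEquality as ≡ using (_≡_)
  open import Relation.Nullary.Negation using (¬_; contradiction)

  open CommutativeRing R
  open IntegerCoefficients R
  open import Algebra.Definitions.RawSemiring (Semiring.rawSemiring semiring) using (_^_)
  open import Algebra.Properties.Semiring.Exp semiring using (^-homo-*)
  open import Relation.Binary.Reasoning.Setoid setoid

  -- low (c₀ ∷ … ∷ c_{d-1} ∷ []) x = c₀ + … + c_{d-1} x^(d-1), and monic adds x^d.
  low monic : ∀ {d} → Vec Carrier d → Carrier → Carrier
  low []         x = 0#
  low (c ∷ cs)   x = c + x * low cs x
  monic []       x = 1#
  monic (c ∷ cs) x = c + x * monic cs x

  monic-cong : ∀ {d} (f : Vec Carrier d) {x y} → x ≈ y → monic f x ≈ monic f y
  monic-cong []      x≈y = refl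
  monic-cong (c ∷ f) x≈y = +-congˡ (*-cong x≈y (monic-cong f x≈y))

  monic-low : ∀ {d} (f : Vec Carrier d) x → monic f x ≈ low f x + x ^ d
  monic-low []      x = sym (+-identityˡ 1#)
  monic-low (c ∷ f) x = trans (+-congˡ (*-congˡ (monic-low f x)))
    (solve 4 (λ c x l t → c :+ x :* (l :+ t) := c :+ x :* l :+ x :* t) refl c x _ _)

  -- Synthetic division by x - b: the coefficients are the Horner values at b of the tails of f.
  quotient : ∀ {d} → Vec Carrier (suc d) → Carrier → Vec Carrier d
  quotient (c ∷ [])           b = []
  quotient (c ∷ f@(_ ∷ _)) b = monic f b ∷ quotient f b

  factor : ∀ {d} (f : Vec Carrier (suc d)) b x →
           monic f x ≈ monic f b + (x - b) * monic (quotient f b) x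
  factor (c ∷ []) b x =
    solve 3 (λ c b x → c :+ x :* :1 := c :+ b :* :1 :+ (x :- b) :* :1) refl c b x
  factor (c ∷ f@(_ ∷ _)) b x = begin
    c + x * monic f x
      ≈⟨ +-congˡ (*-congˡ (factor f b x)) ⟩
    c + x * (monic f b + (x - b) * monic (quotient f b) x)
      ≈⟨ solve 5 (λ c b x v q → c :+ x :* (v :+ (x :- b) :* q)
           := c :+ b :* v :+ (x :- b) :* (v :+ x :* q)) refl c b x _ _ ⟩
    c + b * monic f b + (x - b) * (monic f b + x * monic (quotient f b) x) ∎

  ∏[x-_] : List Carrier → Carrier → Carrier
  ∏[x- bs ] x = foldr (λ b p → (x - b) * p) 1# bs

  -- Functions on P that are polynomials, with coefficients in K, of a fixed
  -- function X: of degree below d, respectively monic of degree d.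
  module WithCoefficients
    {k ℓ′} (K : RawRing k ℓ′) (ι : RawRing.Carrier K → Carrier)
    (ι-hom : IsRingHomomorphism K (CommutativeRing.rawRing R) ι)
    {p} {P : Set p} (X : P → Carrier)
    where

    private module K = RawRing K
    open IsRingHomomorphism ι-hom

    Low Monic : ℕ → (P → Carrier) → Set _
    Low   d F = Σ[ f ∈ Vec K.Carrier d ] ∀ p → low   (Vec.map ι f) (X p) ≈ F p
    Monic d F = Σ[ f ∈ Vec K.Carrier d ] ∀ p → monic (Vec.map ι f) (X p) ≈ F p

    Low-≈ : ∀ {d F G} → (∀ p → F p ≈ G p) → Low d F → Low d G
    Low-≈ F≈G (f , h) = f , λ p → trans (h p) (F≈G p)

    Monic-≈ : ∀ {d F G} → (∀ p → F p ≈ G p) → Monic d F → Monic d G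
    Monic-≈ F≈G (f , h) = f , λ p → trans (h p) (F≈G p)

    Low-0 : ∀ {d} → Low d (λ _ → 0#)
    Low-0 {zero}  = [] , λ _ → refl
    Low-0 {suc d} = let f , h = Low-0 {d} in
      K.0# ∷ f , λ p → trans (+-cong 0#-homo (trans (*-congˡ (h p)) (zeroʳ _))) (+-identityˡ 0#)

    Low-X : ∀ {d F} → Low d F → Low (suc d) (λ p → X p * F p)
    Low-X (f , h) = K.0# ∷ f , λ p →
      trans (+-cong 0#-homo (*-congˡ (h p))) (+-identityˡ _)

    Low-suc : ∀ {d F} → Low d F → Low (suc d) F
    Low-suc {F = F} ([] , h) = Low-≈ h (Low-0 {1})
    Low-suc (c ∷ f , h) =
      let g , h′ = Low-suc (f , λ _ → refl) in
      c ∷ g , λ p → trans (+-congˡ (*-congˡ (h′ p))) (h p)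

    Low-weaken : ∀ {d e F} → d ℕ.≤ e → Low d F → Low e F
    Low-weaken {d} {e} {F} d≤e u = ≡.subst (λ n → Low n F) (ℕ.m∸n+n≡m d≤e) (go (e ℕ.∸ d))
      where
      go : ∀ n → Low (n ℕ.+ d) F
      go zero    = u
      go (suc n) = Low-suc (go n)

    Low-+ : ∀ {d F G} → Low d F → Low d G → Low d (λ p → F p + G p)
    Low-+ ([] , u) ([] , v) = [] , λ p →
      trans (sym (+-identityˡ 0#)) (+-cong (u p) (v p))
    Low-+ {F = F} {G} (a ∷ f , u) (b ∷ g , v) =
      let s , h = Low-+ (f , λ _ → refl) (g , λ _ → refl) in
      a K.+ b ∷ s , λ p → begin
        ι (a K.+ b) + X p * low (Vec.map ι s) (X p)
          ≈⟨ +-cong (+-homo a b) (*-congˡ (h p)) ⟩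
        ι a + ι b + X p * (low (Vec.map ι f) (X p) + low (Vec.map ι g) (X p))
          ≈⟨ solve 5 (λ a b x f g →
               a :+ b :+ x :* (f :+ g) := (a :+ x :* f) :+ (b :+ x :* g)) refl _ _ _ _ _ ⟩
        (ι a + X p * low (Vec.map ι f) (X p)) + (ι b + X p * low (Vec.map ι g) (X p))
          ≈⟨ +-cong (u p) (v p) ⟩
        F p + G p ∎

    Low-scale : ∀ a {d F} → Low d F → Low d (λ p → ι a * F p)
    Low-scale a ([] , u) = [] , λ p → trans (sym (zeroʳ _)) (*-congˡ (u p))
    Low-scale a {F = F} (c ∷ f , u) =
      let s , h = Low-scale a (f , λ _ → refl) in
      a K.* c ∷ s , λ p → begin
        ι (a K.* c) + X p * low (Vec.map ι s) (X p)
          ≈⟨ +-cong (*-homo a c) (*-congˡ (h p)) ⟩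
        ι a * ι c + X p * (ι a * low (Vec.map ι f) (X p))
          ≈⟨ solve 4 (λ a c x f → a :* c :+ x :* (a :* f) := a :* (c :+ x :* f)) refl _ _ _ _ ⟩
        ι a * (ι c + X p * low (Vec.map ι f) (X p))
          ≈⟨ *-congˡ (u p) ⟩
        ι a * F p ∎

    Low-neg : ∀ {d F} → Low d F → Low d (λ p → - F p)
    Low-neg {F = F} u = Low-≈ (λ p → begin
      ι (K.- K.1#) * F p  ≈⟨ *-congʳ (trans (-‿homo K.1#) (-‿cong 1#-homo)) ⟩
      - 1# * F p          ≈⟨ solve 1 (λ x → :- :1 :* x := :- x) refl (F p) ⟩
      - F p               ∎) (Low-scale (K.- K.1#) u)

    Low-- : ∀ {d F G} → Low d F → Low d G → Low d (λ p → F p - G p)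
    Low-- u v = Low-+ u (Low-neg v)

    Low-const : ∀ a {d} → Low (suc d) (λ _ → ι a)
    Low-const a = Low-weaken (s≤s z≤n) (a ∷ [] , λ p →
      trans (+-congˡ (zeroʳ _)) (+-identityʳ _))

    Low-* : ∀ {d e F G} → Low d F → Low e G → Low (d ℕ.+ e) (λ p → F p * G p)
    Low-* {e = e} {F} {G} ([] , u) v =
      Low-≈ (λ p → trans (sym (zeroˡ _)) (*-congʳ (u p))) Low-0
    Low-* {suc d} {e} {F} {G} (a ∷ f , u) v =
      Low-≈ (λ p → trans
        (solve 4 (λ a x f g → a :* g :+ x :* (f :* g) := (a :+ x :* f) :* g) refl _ _ _ _)
        (*-congʳ (u p)))
      (Low-+ (Low-weaken (ℕ.m≤n+m e (suc d)) (Low-scale a v))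
             (Low-X (Low-* (f , λ _ → refl) v)))

    Low-X^ : ∀ m {d F} → Low d F → Low (m ℕ.+ d) (λ p → X p ^ m * F p)
    Low-X^ zero    u = Low-≈ (λ p → sym (*-identityˡ _)) u
    Low-X^ (suc m) u = Low-≈ (λ p → sym (*-assoc _ _ _)) (Low-X (Low-X^ m u))

    Monic⇒Low : ∀ {d F} → Monic d F → Low d (λ p → F p - X p ^ d)
    Monic⇒Low {d} {F} (f , u) = f , λ p → begin
      low (Vec.map ι f) (X p)
        ≈⟨ solve 2 (λ l t → l := l :+ t :- t) refl _ (X p ^ d) ⟩
      low (Vec.map ι f) (X p) + X p ^ d - X p ^ d
        ≈⟨ +-congʳ (trans (sym (monic-low (Vec.map ι f) (X p))) (u p)) ⟩
      F p - X p ^ d ∎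

    Low⇒Monic : ∀ {d F} → Low d (λ p → F p - X p ^ d) → Monic d F
    Low⇒Monic {d} {F} (f , u) = f , λ p → begin
      monic (Vec.map ι f) (X p)
        ≈⟨ monic-low (Vec.map ι f) (X p) ⟩
      low (Vec.map ι f) (X p) + X p ^ d
        ≈⟨ +-congʳ (u p) ⟩
      F p - X p ^ d + X p ^ d
        ≈⟨ solve 2 (λ x t → x :- t :+ t := x) refl (F p) (X p ^ d) ⟩
      F p ∎

    Monic-1 : Monic 0 (λ _ → 1#)
    Monic-1 = [] , λ _ → refl

    Monic-X : ∀ {d F} → Monic d F → Monic (suc d) (λ p → X p * F p)
    Monic-X (f , h) = K.0# ∷ f , λ p →
      trans (+-cong 0#-homo (*-congˡ (h p))) (+-identityˡ _)

    Monic-X^ : ∀ d → Monic d (λ p → X p ^ d)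
    Monic-X^ zero    = Monic-1
    Monic-X^ (suc d) = Monic-X (Monic-X^ d)

    Monic-+ : ∀ {d F G} → Monic d F → Low d G → Monic d (λ p → F p + G p)
    Monic-+ {d} {F} {G} u v = Low⇒Monic (Low-≈
      (λ p → solve 3 (λ f g x → f :- x :+ g := f :+ g :- x) refl (F p) (G p) (X p ^ d))
      (Low-+ (Monic⇒Low u) v))

    Monic-- : ∀ {d F G} → Monic d F → Low d G → Monic d (λ p → F p - G p)
    Monic-- u v = Monic-+ u (Low-neg v)

    weakenMonic : ∀ {d F} → Monic d F → Low (suc d) F
    weakenMonic (f , u) = go f (λ _ → refl) u
      where
      go : ∀ {d} {F G : P → Carrier} (f : Vec K.Carrier d) →
           (∀ p → F p ≈ G p) → (∀ p → monic (Vec.map ι f) (X p) ≈ F p) → Low (suc d) G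
      go []      e u = Low-≈ (λ p → trans 1#-homo (trans (u p) (e p))) (Low-const K.1#)
      go (c ∷ f) e u = Low-≈ (λ p → trans (u p) (e p))
        (Low-+ (Low-const c) (Low-X (go f (λ _ → refl) λ _ → refl)))

    -- With s and t the leading powers of F and G, the difference F G - s t is s (G - t) + t (F - s)
    -- + (F - s)(G - t), and each term has degree below d + e.
    Monic-* : ∀ {d e F G} → Monic d F → Monic e G → Monic (d ℕ.+ e) (λ p → F p * G p)
    Monic-* {d} {e} {F} {G} u v = Low⇒Monic (Low-≈
      (λ p → trans
        (solve 4 (λ f g s t → s :* (g :- t) :+ t :* (f :- s) :+ (f :- s) :* (g :- t)
            := f :* g :- s :* t) refl (F p) (G p) (X p ^ d) (X p ^ e))
        (+-congˡ (-‿cong (sym (^-homo-* (X p) d e)))))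
      (Low-+ (Low-+ (Low-X^ d v′)
                    (≡.subst (λ n → Low n (λ p → X p ^ e * (F p - X p ^ d))) (ℕ.+-comm e d) (Low-X^ e u′)))
             (Low-* u′ v′)))
      where
      u′ = Monic⇒Low u
      v′ = Monic⇒Low v

    Low-last : ∀ {d F} → Low (suc d) F → ∃[ a ] Low d (λ p → F p - ι a * X p ^ d)
    Low-last {zero} {F} (c ∷ [] , u) = c , [] , λ p → begin
      0#                       ≈⟨ solve 2 (λ c x → :0 := c :+ x :* :0 :- c :* :1) refl (ι c) (X p) ⟩
      ι c + X p * 0# - ι c * 1# ≈⟨ +-congʳ (u p) ⟩
      F p - ι c * 1#           ∎
    Low-last {suc d} {F} (c ∷ f , u) =
      let a , v = Low-last (f , λ _ → refl) in
      a , Low-≈ (λ p → trans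
            (solve 5 (λ c x f a t → c :+ x :* (f :- a :* t) := c :+ x :* f :- a :* (x :* t))
              refl (ι c) (X p) (low (Vec.map ι f) (X p)) (ι a) (X p ^ d))
            (+-congʳ (u p)))
          (Low-+ (Low-const c) (Low-X v))

    -- If f = F Q + S, then c + X f = F (X Q) + (c + X S). Subtracting a F, with a the coefficient
    -- of c + X S at X^d, makes the remainder short again, and a is added to the quotient.
    divide : ∀ {m d} (f : Vec K.Carrier (m ℕ.+ d)) {F} → Monic d F →
             ∃[ Q ] ∃[ S ] Monic m Q × Low d S ×
             (∀ p → monic (Vec.map ι f) (X p) ≈ F p * Q p + S p)
    divide {zero} f {F} u =
      (λ _ → 1#) , (λ p → monic (Vec.map ι f) (X p) - F p) , Monic-1 ,
      Low-≈ (λ p → solve 3 (λ f g t → f :- t :- (g :- t) := f :- g) refl _ _ _)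
        (Low-- (Monic⇒Low (f , λ _ → refl)) (Monic⇒Low u)) ,
      λ p → solve 2 (λ f g → f := g :* :1 :+ (f :- g)) refl _ _
    divide {suc m} {d} (c ∷ f) {F} u =
      let Q , S , v , w , h = divide {m} f u
          a , w′ = Low-last (Low-+ (Low-const c) (Low-X w)) in
      (λ p → X p * Q p + ι a) , _ , Monic-+ (Monic-X v) (Low-const a) ,
      Low-- w′ (Low-scale a (Monic⇒Low u)) ,
      λ p → trans (+-congˡ (*-congˡ (h p)))
        (solve 7 (λ c x f q s a t → c :+ x :* (f :* q :+ s)
           := f :* (x :* q :+ a) :+ (c :+ x :* s :- a :* t :- a :* (f :- t)))
           refl (ι c) (X p) (F p) (Q p) (S p) (ι a) (X p ^ d))

    division : ∀ {m d F G} → d ℕ.≤ m → Monic m F → Monic d G →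
               ∃[ Q ] ∃[ S ] Monic (m ℕ.∸ d) Q × Low d S × (∀ p → F p ≈ G p * Q p + S p)
    division {m} {d} {F} d≤m u v =
      let f , h = ≡.subst (λ n → Monic n F) (≡.sym (ℕ.m∸n+n≡m d≤m)) u
          Q , S , w , l , e = divide {m ℕ.∸ d} {d} f v in
      Q , S , w , l , λ p → trans (sym (h p)) (e p)

  -- The form that holds constructively in ℝ and ℂ, where it cannot be decided which factor
  -- vanishes.
  record IsDomain : Set (c ⊔ ℓ) where
    field
      1≉0    : ¬ 1# ≈ 0#
      domain : ∀ {x y} → x * y ≈ 0# → ¬ x ≈ 0# → y ≈ 0#

  module Roots (isDomain : IsDomain) where

    open IsDomain isDomain

    Distinct : List Carrier → Set _
    Distinct = AllPairs λ x y → ¬ x ≈ y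

    -- One linear factor is removed at a time; a later root b′ remains a root of the quotient
    -- because b′ - b is not zero.
    splitRoots : ∀ {d} (f : Vec Carrier d) bs → Distinct bs → All (λ b → monic f b ≈ 0#) bs →
                 ∃[ e ] Σ[ g ∈ Vec Carrier e ]
                   length bs ℕ.+ e ≡ d × (∀ x → monic f x ≈ ∏[x- bs ] x * monic g x)
    splitRoots f [] _ _ = _ , f , ≡.refl , λ x → sym (*-identityˡ _)
    splitRoots [] (b ∷ bs) _ (1≈0 ∷ _) = contradiction 1≈0 1≉0
    splitRoots f@(_ ∷ _) (b ∷ bs) (b∉bs ∷ distinct) (fb≈0 ∷ fbs≈0) =
      let e , g , len , h = splitRoots (quotient f b) bs distinct
            (All.zipWith (λ (b≉b′ , fb′≈0) → root b≉b′ fb′≈0) (b∉bs , fbs≈0)) in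
      e , g , ≡.cong suc len , λ x → begin
        monic f x                                     ≈⟨ factored x ⟩
        (x - b) * monic (quotient f b) x              ≈⟨ *-congˡ (h x) ⟩
        (x - b) * (∏[x- bs ] x * monic g x)           ≈⟨ sym (*-assoc _ _ _) ⟩
        (x - b) * ∏[x- bs ] x * monic g x             ∎
      where
      factored : ∀ x → monic f x ≈ (x - b) * monic (quotient f b) x
      factored x = trans (factor f b x) (trans (+-congʳ fb≈0) (+-identityˡ _))

      root : ∀ {b′} → ¬ b ≈ b′ → monic f b′ ≈ 0# → monic (quotient f b) b′ ≈ 0#
      root {b′} b≉b′ fb′≈0 = domain (trans (sym (factored b′)) fb′≈0) λ b′-b≈0 →
        b≉b′ (begin
          b                ≈⟨ solve 2 (λ b b′ → b := b′ :- (b′ :- b)) refl b b′ ⟩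
          b′ - (b′ - b)    ≈⟨ +-congˡ (-‿cong b′-b≈0) ⟩
          b′ - 0#          ≈⟨ solve 1 (λ b → b :- :0 := b) refl b′ ⟩
          b′               ∎)

    length-roots : ∀ {d} (f : Vec Carrier d) bs → Distinct bs → All (λ b → monic f b ≈ 0#) bs →
                   length bs ℕ.≤ d
    length-roots f bs distinct roots =
      let e , _ , len , _ = splitRoots f bs distinct roots in
      ≡.subst (length bs ℕ.≤_) len (ℕ.m≤m+n (length bs) e)

    allRoots : ∀ {d} (f : Vec Carrier d) bs → Distinct bs → All (λ b → monic f b ≈ 0#) bs →
               length bs ≡ d → ∀ x → monic f x ≈ ∏[x- bs ] x
    allRoots f bs distinct roots ≡.refl x with splitRoots f bs distinct roots
    ... | zero , [] , len , h = trans (h x) (*-identityʳ _)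
    ... | suc e , _ , len , _ = contradiction len (ℕ.m+1+n≢m (length bs))

    ∏≈0 : ∀ bs x → ∏[x- bs ] x ≈ 0# → All (λ b → ¬ x ≈ b) bs → 1# ≈ 0#
    ∏≈0 [] x h _ = h
    ∏≈0 (b ∷ bs) x h (x≉b ∷ x∉bs) = ∏≈0 bs x (domain h λ x-b≈0 → x≉b (begin
      x            ≈⟨ solve 2 (λ x b → x := x :- b :+ b) refl x b ⟩
      x - b + b    ≈⟨ +-congʳ x-b≈0 ⟩
      0# + b       ≈⟨ +-identityˡ b ⟩
      b            ∎)) x∉bs

-- Sums and products of algebraic integers.

module Integrality
  {c ℓ} (R : CommutativeRing c ℓ) (ι : ℤ → CommutativeRing.Carrier R)
  (ι-hom : IsRingHomomorphism ℤ.+-*-rawRing (CommutativeRing.rawRing R) ι)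
  where

  open import Algebra.Bundles using (CommutativeRing; Semiring)
  open import Algebra.Morphism.Structures using (IsRingHomomorphism)
  open import Data.Integer.Base as ℤ using (ℤ; +_)
  import Data.Integer.Properties as ℤ

  open import Data.Fin.Base as Fin using (Fin; zero; suc; punchIn; remQuot; combine; toℕ; fromℕ<)
  import Data.Fin.Properties as Fin
  open import Data.List.Base using (List; []; _∷_)
  open import Data.List.Relation.Unary.All using (All; []; _∷_)
  open import Data.Nat.Base as ℕ using (ℕ; zero; suc; z≤n; s≤s)
  import Data.Nat.Properties as ℕ
  open import Data.Product.Base using (Σ-syntax; ∃-syntax; _×_; _,_; proj₁; proj₂)
  open import Data.Sum.Base using (inj₁; inj₂)
  open import Data.Unit.Base using (⊤; tt)
  open import Data.Vec.Base as Vec using (Vec; []; _∷_)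
  open import Level using (_⊔_)
  open import Relation.Binary.PropositionalEquality as ≡ using (_≡_; _≢_)

  open CommutativeRing R hiding (zero)
  open IntegerCoefficients R hiding (⟦_⟧)
  open Polynomials R
  open IsRingHomomorphism ι-hom
  open import Algebra.Definitions.RawSemiring (Semiring.rawSemiring semiring) using (_^_)
  open import Relation.Binary.Reasoning.Setoid setoid

  IsIntegral : Carrier → Set _
  IsIntegral x = ∃[ d ] Σ[ f ∈ Vec ℤ d ] monic (Vec.map ι f) x ≈ 0#

  private
    sum : ∀ {n} → (Fin n → Carrier) → Carrier
    sum {zero}  f = 0#
    sum {suc n} f = f zero + sum (λ j → f (suc j))

    sum-cong : ∀ {n} {f g : Fin n → Carrier} → (∀ j → f j ≈ g j) → sum f ≈ sum g
    sum-cong {zero}  h = refl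
    sum-cong {suc n} h = +-cong (h zero) (sum-cong λ j → h (suc j))

    sum-linear : ∀ {n} a b (f g : Fin n → Carrier) →
                 sum (λ j → a * f j - b * g j) ≈ a * sum f - b * sum g
    sum-linear {zero}  a b f g = solve 2 (λ a b → :0 := a :* :0 :- b :* :0) refl a b
    sum-linear {suc n} a b f g = trans
      (+-congˡ (sum-linear a b (λ j → f (suc j)) (λ j → g (suc j))))
      (solve 6 (λ a b f g s t → a :* f :- b :* g :+ (a :* s :- b :* t)
        := a :* (f :+ s) :- b :* (g :+ t)) refl _ _ _ _ _ _)

    -- Index 1 is the pivot, so that index 0 survives every elimination step: the last equation is
    -- to be one for `v zero`, which will be 1.
    κ : ∀ {n} → Fin (suc n) → Fin (suc (suc n))
    κ = punchIn (suc zero)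

    sum-κ : ∀ {n} (f : Fin (suc (suc n)) → Carrier) →
            sum f ≈ 0# → sum (λ j → f (κ j)) ≈ - f (suc zero)
    sum-κ f h = trans
      (solve 3 (λ a b s → a :+ s := a :+ (b :+ s) :- b) refl _ (f (suc zero)) _)
      (trans (+-congʳ h) (+-identityˡ _))

  module _ (y : Carrier) where
    open WithCoefficients ℤ.+-*-rawRing ι ι-hom {P = ⊤} (λ _ → y)

    -- Fraction-free elimination keeps the degrees in y of the diagonal entries
    -- above those of the others, so it ends with a monic polynomial in y.
    eliminate : ∀ n r (p : Fin (suc n) → Fin (suc n) → Carrier) (v : Fin (suc n) → Carrier) →
                (∀ i → Monic r (λ _ → p i i)) →
                (∀ i j → i ≢ j → Low r (λ _ → p i j)) →
                (∀ i → sum (λ j → p i j * v j) ≈ 0#) →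
                ∃[ d ] ∃[ z ] Monic d (λ _ → z) × z * v zero ≈ 0#
    eliminate zero r p v diagonal off rows =
      r , p zero zero , diagonal zero , trans (sym (+-identityʳ _)) (rows zero)
    eliminate (suc n) r p v diagonal off rows =
      eliminate n (r ℕ.+ r) p′ (λ j → v (κ j))
        (λ i → Monic-- (Monic-* (diagonal i1) (diagonal (κ i)))
                       (Low-* (off (κ i) i1 (κ≢1 i)) (off i1 (κ i) (λ e → κ≢1 i (≡.sym e)))))
        (λ i j i≢j → Low-- (monicLow (diagonal i1) (off (κ i) (κ j) λ e → i≢j (Fin.punchIn-injective i1 i j e)))
                           (Low-* (off (κ i) i1 (κ≢1 i)) (off i1 (κ j) (λ e → κ≢1 j (≡.sym e)))))
        rows′
      where
      i1 : Fin (suc (suc n))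
      i1 = suc zero

      κ≢1 : ∀ i → κ i ≢ i1
      κ≢1 i = Fin.punchInᵢ≢i i1 i

      p′ : Fin (suc n) → Fin (suc n) → Carrier
      p′ i j = p i1 i1 * p (κ i) (κ j) - p (κ i) i1 * p i1 (κ j)

      monicLow : ∀ {F G} → Monic r F → Low r G → Low (r ℕ.+ r) (λ u → F u * G u)
      monicLow {F} {G} m l = Low-≈
        (λ _ → solve 3 (λ f g t → t :* g :+ (f :- t) :* g := f :* g) refl (F tt) (G tt) (y ^ r))
        (Low-+ (Low-X^ r l) (Low-* (Monic⇒Low m) l))

      rows′ : ∀ i → sum (λ j → p′ i j * v (κ j)) ≈ 0#
      rows′ i = begin
        sum (λ j → p′ i j * v (κ j))
          ≈⟨ sum-cong (λ j → solve 5 (λ a b c d v → (a :* b :- c :* d) :* v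
               := a :* (b :* v) :- c :* (d :* v)) refl a (p (κ i) (κ j)) b (p i1 (κ j)) (v (κ j))) ⟩
        sum (λ j → a * (p (κ i) (κ j) * v (κ j)) - b * (p i1 (κ j) * v (κ j)))
          ≈⟨ sum-linear a b (λ j → p (κ i) (κ j) * v (κ j)) (λ j → p i1 (κ j) * v (κ j)) ⟩
        a * sum (λ j → p (κ i) (κ j) * v (κ j)) - b * sum (λ j → p i1 (κ j) * v (κ j))
          -- Omitting the pivot column leaves minus its term in either row, and cross-multiplication
          -- makes the two terms cancel.
          ≈⟨ +-cong (*-congˡ (sum-κ (λ j → p (κ i) j * v j) (rows (κ i))))
                    (-‿cong (*-congˡ (sum-κ (λ j → p i1 j * v j) (rows i1)))) ⟩
        a * - (b * v i1) - b * - (a * v i1)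
          ≈⟨ solve 3 (λ a b v → a :* :- (b :* v) :- b :* :- (a :* v) := :0) refl a b (v i1) ⟩
        0# ∎
        where
        a = p i1 i1
        b = p (κ i) i1

  -- An inductive closure lets memberships be built without coordinates; `combination` extracts the
  -- integer coefficients afterwards.
  data Span {n} (v : Fin n → Carrier) : Carrier → Set (c ⊔ ℓ) where
    gen   : ∀ i → Span v (v i)
    zero  : Span v 0#
    add   : ∀ {x y} → Span v x → Span v y → Span v (x + y)
    scale : ∀ a {x} → Span v x → Span v (ι a * x)
    resp  : ∀ {x y} → x ≈ y → Span v x → Span v y

  private
    δ : ∀ {n} → Fin n → Fin n → ℤ
    δ zero    zero    = + 1
    δ zero    (suc j) = + 0
    δ (suc i) zero    = + 0
    δ (suc i) (suc j) = δ i j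

    δ-diagonal : ∀ {n} (i : Fin n) → δ i i ≡ + 1
    δ-diagonal zero    = ≡.refl
    δ-diagonal (suc i) = δ-diagonal i

    δ-off : ∀ {n} (i j : Fin n) → i ≢ j → δ i j ≡ + 0
    δ-off zero    zero    i≢j with () ← i≢j ≡.refl
    δ-off zero    (suc j) i≢j = ≡.refl
    δ-off (suc i) zero    i≢j = ≡.refl
    δ-off (suc i) (suc j) i≢j = δ-off i j λ e → i≢j (≡.cong suc e)

    sum-zero : ∀ {n} (v : Fin n → Carrier) → sum (λ j → ι (+ 0) * v j) ≈ 0#
    sum-zero {zero}  v = refl
    sum-zero {suc n} v = trans
      (+-cong (trans (*-congʳ 0#-homo) (zeroˡ _)) (sum-zero (λ j → v (suc j)))) (+-identityˡ 0#)

    sum-δ : ∀ {n} i (v : Fin n → Carrier) → sum (λ j → ι (δ i j) * v j) ≈ v i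
    sum-δ zero v = trans
      (+-cong (trans (*-congʳ 1#-homo) (*-identityˡ _)) (sum-zero (λ j → v (suc j)))) (+-identityʳ _)
    sum-δ (suc i) v = trans
      (+-cong (trans (*-congʳ 0#-homo) (zeroˡ _)) (sum-δ i (λ j → v (suc j)))) (+-identityˡ _)

    sum-+ : ∀ {n} (f g : Fin n → Carrier) → sum (λ j → f j + g j) ≈ sum f + sum g
    sum-+ {zero}  f g = sym (+-identityˡ 0#)
    sum-+ {suc n} f g = trans (+-congˡ (sum-+ (λ j → f (suc j)) (λ j → g (suc j))))
      (solve 4 (λ f g s t → f :+ g :+ (s :+ t) := f :+ s :+ (g :+ t)) refl _ _ _ _)

    sum-* : ∀ {n} a (f : Fin n → Carrier) → sum (λ j → a * f j) ≈ a * sum f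
    sum-* {zero}  a f = sym (zeroʳ a)
    sum-* {suc n} a f = trans (+-congˡ (sum-* a (λ j → f (suc j)))) (sym (distribˡ a _ _))

  combination : ∀ {n} {v : Fin n → Carrier} {x} → Span v x →
                Σ[ a ∈ (Fin n → ℤ) ] sum (λ j → ι (a j) * v j) ≈ x
  combination {v = v} (gen i) = δ i , sum-δ i v
  combination {v = v} zero = (λ _ → + 0) , sum-zero v
  combination {v = v} (add x y) =
    let a , h = combination x
        b , k = combination y in
    (λ j → a j ℤ.+ b j) , trans
      (sum-cong λ j → trans (*-congʳ (+-homo (a j) (b j))) (distribʳ (v j) _ _))
      (trans (sum-+ (λ j → ι (a j) * v j) (λ j → ι (b j) * v j)) (+-cong h k))
  combination {v = v} (scale b x) =
    let a , h = combination x in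
    (λ j → b ℤ.* a j) , trans
      (sum-cong λ j → trans (*-congʳ (*-homo b (a j))) (*-assoc _ _ (v j)))
      (trans (sum-* (ι b) (λ j → ι (a j) * v j)) (*-congˡ h))
  combination (resp x≈y x) = let a , h = combination x in a , trans h x≈y

  -- The determinant trick. If y v = A v with an integer matrix A, then y I - A annihilates v, and
  -- `eliminate`, in place of the determinant, gives a monic integer polynomial in y that
  -- annihilates `v zero`, hence 1.
  stable⇒integral : ∀ {n} (v : Fin (suc n) → Carrier) y → v zero ≈ 1# →
                    (∀ i → Span v (y * v i)) → IsIntegral y
  stable⇒integral {n} v y v0≈1 h =
    let d , z , (f , fy≈z) , zv0≈0 = eliminate y n 1 p v diagonal off rows in
    d , f , trans (fy≈z tt) (trans (sym (trans (*-congˡ v0≈1) (*-identityʳ z))) zv0≈0)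
    where
    open WithCoefficients ℤ.+-*-rawRing ι ι-hom {P = ⊤} (λ _ → y)
    a : Fin (suc n) → Fin (suc n) → ℤ
    a i = proj₁ (combination (h i))

    p : Fin (suc n) → Fin (suc n) → Carrier
    p i j = y * ι (δ i j) - 1# * ι (a i j)

    diagonal : ∀ i → Monic 1 (λ _ → p i i)
    diagonal i = ℤ.- a i i ∷ [] , λ _ → begin
      ι (ℤ.- a i i) + y * 1#
        ≈⟨ +-congʳ (-‿homo (a i i)) ⟩
      - ι (a i i) + y * 1#
        ≈⟨ solve 2 (λ a y → :- a :+ y :* :1 := y :* :1 :- :1 :* a) refl _ y ⟩
      y * 1# - 1# * ι (a i i)
        ≈⟨ +-congʳ (*-congˡ (sym (trans (reflexive (≡.cong ι (δ-diagonal i))) 1#-homo))) ⟩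
      p i i ∎

    off : ∀ i j → i ≢ j → Low 1 (λ _ → p i j)
    off i j i≢j = ℤ.- a i j ∷ [] , λ _ → begin
      ι (ℤ.- a i j) + y * 0#
        ≈⟨ +-congʳ (-‿homo (a i j)) ⟩
      - ι (a i j) + y * 0#
        ≈⟨ solve 2 (λ a y → :- a :+ y :* :0 := y :* :0 :- :1 :* a) refl _ y ⟩
      y * 0# - 1# * ι (a i j)
        ≈⟨ +-congʳ (*-congˡ (sym (trans (reflexive (≡.cong ι (δ-off i j i≢j))) 0#-homo))) ⟩
      p i j ∎

    rows : ∀ i → sum (λ j → p i j * v j) ≈ 0#
    rows i = begin
      sum (λ j → p i j * v j)
        ≈⟨ sum-cong (λ j → solve 4 (λ y d a v → (y :* d :- :1 :* a) :* v
             := y :* (d :* v) :- :1 :* (a :* v)) refl y (ι (δ i j)) (ι (a i j)) (v j)) ⟩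
      sum (λ j → y * (ι (δ i j) * v j) - 1# * (ι (a i j) * v j))
        ≈⟨ sum-linear y 1# (λ j → ι (δ i j) * v j) (λ j → ι (a i j) * v j) ⟩
      y * sum (λ j → ι (δ i j) * v j) - 1# * sum (λ j → ι (a i j) * v j)
        ≈⟨ +-cong (*-congˡ (sum-δ i v)) (-‿cong (*-congˡ (proj₂ (combination (h i))))) ⟩
      y * v i - 1# * (y * v i)
        ≈⟨ solve 1 (λ t → t :- :1 :* t := :0) refl (y * v i) ⟩
      0# ∎

  private
    lowSpan : ∀ {n} {v : Fin n → Carrier} x t {d} (f : Vec ℤ d) i →
              (∀ j → j ℕ.< d → Span v (x ^ (i ℕ.+ j) * t)) →
              Span v (x ^ i * low (Vec.map ι f) x * t)
    lowSpan x t [] i h = resp (solve 2 (λ x t → :0 := x :* :0 :* t) refl _ t) zero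
    lowSpan {v = v} x t (c ∷ f) i h = resp
      (solve 5 (λ u c x l t → c :* (u :* t) :+ x :* u :* l :* t := u :* (c :+ x :* l) :* t)
        refl (x ^ i) (ι c) x (low (Vec.map ι f) x) t)
      (add (scale c (≡.subst (λ k → Span v (x ^ k * t)) (ℕ.+-identityʳ i) (h 0 (s≤s z≤n))))
           (lowSpan x t f (suc i) λ j j<d →
             ≡.subst (λ k → Span v (x ^ k * t)) (ℕ.+-suc i j) (h (suc j) (s≤s j<d))))

    -- Raises the largest admissible exponent from d - 1 to d, since f(x) = 0 expresses x^d by lower
    -- powers.
    powerSpan : ∀ {n} {v : Fin n → Carrier} x t {d} (f : Vec ℤ d) →
                monic (Vec.map ι f) x ≈ 0# → (∀ j → j ℕ.< d → Span v (x ^ j * t)) →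
                ∀ j → j ℕ.≤ d → Span v (x ^ j * t)
    powerSpan x t {d} f fx≈0 h j j≤d with ℕ.m≤n⇒m<n∨m≡n j≤d
    ... | inj₁ j<d = h j j<d
    ... | inj₂ ≡.refl = resp
      (begin
        ι (ℤ.- + 1) * (1# * l * t)
          ≈⟨ *-congʳ (trans (-‿homo (+ 1)) (-‿cong 1#-homo)) ⟩
        - 1# * (1# * l * t)
          ≈⟨ solve 3 (λ l t u → :- :1 :* (:1 :* l :* t) := u :* t :- (l :+ u) :* t) refl l t (x ^ d) ⟩
        x ^ d * t - (l + x ^ d) * t
          ≈⟨ +-congˡ (-‿cong (*-congʳ (trans (sym (monic-low (Vec.map ι f) x)) fx≈0))) ⟩
        x ^ d * t - 0# * t
          ≈⟨ solve 2 (λ u t → u :* t :- :0 :* t := u :* t) refl (x ^ d) t ⟩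
        x ^ d * t ∎)
      (scale (ℤ.- + 1) (lowSpan x t f 0 h))
      where
      l = low (Vec.map ι f) x

  module _ (x y : Carrier) {r s} (f : Vec ℤ (suc r)) (g : Vec ℤ (suc s))
           (fx≈0 : monic (Vec.map ι f) x ≈ 0#) (gy≈0 : monic (Vec.map ι g) y ≈ 0#) where

    private
      monomial : Fin (suc r) × Fin (suc s) → Carrier
      monomial (i , j) = x ^ toℕ i * y ^ toℕ j

      v : Fin (suc (suc r ℕ.* suc s)) → Carrier
      -- This entry repeats the monomial with exponents 0 and 0, so that `v zero` is 1 by definition
      -- and not only through `remQuot`.
      v zero    = 1#
      v (suc k) = monomial (remQuot (suc s) k)

      small : ∀ i j → i ℕ.< suc r → j ℕ.< suc s → Span v (x ^ i * y ^ j)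
      small i j i<r j<s = resp
        (reflexive (≡.trans
          (≡.cong monomial (Fin.remQuot-combine (fromℕ< i<r) (fromℕ< j<s)))
          (≡.cong₂ (λ i j → x ^ i * y ^ j) (Fin.toℕ-fromℕ< i<r) (Fin.toℕ-fromℕ< j<s))))
        (gen (suc (combine (fromℕ< i<r) (fromℕ< j<s))))

      largeX : ∀ i j → i ℕ.≤ suc r → j ℕ.< suc s → Span v (x ^ i * y ^ j)
      largeX i j i≤r j<s = powerSpan x (y ^ j) f fx≈0 (λ i i<r → small i j i<r j<s) i i≤r

      largeY : ∀ i j → i ℕ.< suc r → j ℕ.≤ suc s → Span v (y ^ j * x ^ i)
      largeY i j i<r j≤s = powerSpan y (x ^ i) g gy≈0
        (λ j j<s → resp (*-comm _ _) (small i j i<r j<s)) j j≤s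

      spanned : ∀ z → (∀ i → Span v (z * v i)) → ∀ {w} → Span v w → Span v (z * w)
      spanned z h (gen i)       = h i
      spanned z h zero          = resp (sym (zeroʳ z)) zero
      spanned z h (add a b)     = resp (sym (distribˡ z _ _)) (add (spanned z h a) (spanned z h b))
      spanned z h (scale a {w} b) = resp
        (solve 3 (λ z a w → a :* (z :* w) := z :* (a :* w)) refl z (ι a) w) (scale a (spanned z h b))
      spanned z h (resp e a)    = resp (*-congˡ e) (spanned z h a)

      xv : ∀ i → Span v (x * v i)
      xv zero    = resp (*-identityʳ _) (largeX 1 0 (s≤s z≤n) (s≤s z≤n))
      xv (suc k) = let i , j = remQuot (suc s) k in
        resp (*-assoc x _ _) (largeX (suc (toℕ i)) (toℕ j) (Fin.toℕ<n i) (Fin.toℕ<n j))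

      yv : ∀ i → Span v (y * v i)
      yv zero    = resp (*-identityʳ _) (largeY 0 1 (s≤s z≤n) (s≤s z≤n))
      yv (suc k) = let i , j = remQuot (suc s) k in
        resp (solve 3 (λ y a b → y :* b :* a := y :* (a :* b)) refl y _ _)
          (largeY (toℕ i) (suc (toℕ j)) (Fin.toℕ<n i) (Fin.toℕ<n j))

    private
      integral-+′ : IsIntegral (x + y)
      integral-+′ = stable⇒integral v (x + y) refl λ i →
        resp (sym (distribʳ (v i) x y)) (add (xv i) (yv i))

      integral-*′ : IsIntegral (x * y)
      integral-*′ = stable⇒integral v (x * y) refl λ i →
        resp (sym (*-assoc x y (v i))) (spanned x xv (yv i))

    integral-+-* : IsIntegral (x + y) × IsIntegral (x * y)
    integral-+-* = integral-+′ , integral-*′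

  private
    closed : ∀ {x y} → IsIntegral x → IsIntegral y → IsIntegral (x + y) × IsIntegral (x * y)
    -- A root of the monic polynomial of degree 0 means 1 ≈ 0, and then the same polynomial serves
    -- for every element.
    closed (zero  , [] , 1≈0) _ = (0 , [] , 1≈0) , (0 , [] , 1≈0)
    closed (suc _ , _ , _) (zero  , [] , 1≈0) = (0 , [] , 1≈0) , (0 , [] , 1≈0)
    closed (suc _ , f , h) (suc _ , g , k) = integral-+-* _ _ f g h k

  integral-+ : ∀ {x y} → IsIntegral x → IsIntegral y → IsIntegral (x + y)
  integral-+ u v = proj₁ (closed u v)

  integral-* : ∀ {x y} → IsIntegral x → IsIntegral y → IsIntegral (x * y)
  integral-* u v = proj₂ (closed u v)

  integral-≈ : ∀ {x y} → x ≈ y → IsIntegral x → IsIntegral y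
  integral-≈ x≈y (d , f , h) = d , f , trans (monic-cong (Vec.map ι f) (sym x≈y)) h

  integral-ι : ∀ a → IsIntegral (ι a)
  integral-ι a = 1 , ℤ.- a ∷ [] , (begin
    ι (ℤ.- a) + ι a * 1#  ≈⟨ +-congʳ (-‿homo a) ⟩
    - ι a + ι a * 1#      ≈⟨ solve 1 (λ a → :- a :+ a :* :1 := :0) refl (ι a) ⟩
    0#                    ∎)

  integral-1 : IsIntegral 1#
  integral-1 = integral-≈ 1#-homo (integral-ι (+ 1))

  integral-neg : ∀ {x} → IsIntegral x → IsIntegral (- x)
  integral-neg {x} u = integral-≈
    (begin
      ι (ℤ.- + 1) * x  ≈⟨ *-congʳ (trans (-‿homo (+ 1)) (-‿cong 1#-homo)) ⟩
      - 1# * x         ≈⟨ solve 1 (λ x → :- :1 :* x := :- x) refl x ⟩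
      - x              ∎)
    (integral-* (integral-ι (ℤ.- + 1)) u)

  integral-- : ∀ {x y} → IsIntegral x → IsIntegral y → IsIntegral (x - y)
  integral-- u v = integral-+ u (integral-neg v)

  integral-^ : ∀ {x} → IsIntegral x → ∀ n → IsIntegral (x ^ n)
  integral-^ u zero    = integral-1
  integral-^ u (suc n) = integral-* u (integral-^ u n)

  integral-monic : ∀ {d} (f : Vec ℤ d) {x} → IsIntegral x → IsIntegral (monic (Vec.map ι f) x)
  integral-monic []      u = integral-1
  integral-monic (c ∷ f) u = integral-+ (integral-ι c) (integral-* u (integral-monic f u))

  integral-∏ : ∀ bs {x} → IsIntegral x → All IsIntegral bs → IsIntegral (∏[x- bs ] x)
  integral-∏ []       u []       = integral-1
  integral-∏ (b ∷ bs) u (v ∷ vs) = integral-* (integral-- u v) (integral-∏ bs u vs)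

-- Signs at 2 cos (π/(2k + 1)), derived from the laws of positivity.

module Positivity {c ℓ} (R : CommutativeRing c ℓ) where

  open import Level as Level using (_⊔_)

  open CommutativeRing R

  record PositiveCone p : Set (c ⊔ ℓ ⊔ Level.suc p) where
    field
      Pos        : Carrier → Set p
      Pos-resp   : ∀ {x y} → x ≈ y → Pos x → Pos y
      Pos-1      : Pos 1#
      Pos-+      : ∀ {x y} → Pos x → Pos y → Pos (x + y)
      Pos-*      : ∀ {x y} → Pos x → Pos y → Pos (x * y)
      Pos-cancel : ∀ {x y} → Pos (x * y) → Pos y → Pos x
      domain     : ∀ {x y} → x * y ≈ 0# → Pos x → y ≈ 0#

  -- The signs of D at the points 2 cos 2iθ when θ = π / (2k + 1).
  module Signs {p} (cone : PositiveCone p) where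

    open PositiveCone cone
    open import Data.Nat.Base as ℕ using (ℕ; zero; suc; z≤n; s≤s)
    import Data.Nat.Properties as ℕ
    open import Data.Product.Base using (_×_; _,_; proj₁)
    open import Relation.Binary.PropositionalEquality as ≡ using (_≡_)

    open IntegerCoefficients R
    open Chebyshev R
    open import Relation.Binary.Reasoning.Setoid setoid

    2# : Carrier
    2# = 1# + 1#

    Pos-2 : Pos 2#
    Pos-2 = Pos-+ Pos-1 Pos-1

    module _ (x : Carrier) where

      T : ℕ → Carrier
      T zero    = 0#
      T (suc n) = T n + S x (suc n)

      -- The sum telescopes, as (2 - x) S(n) is minus the second difference of `S` at n. It serves
      -- to prove 2 - x positive: at the angle in question the right side is 2, and all terms of the
      -- sum are positive.
      S-T : ∀ n → (2# - x) * T n ≈ 1# - (S x (suc n) - S x n)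
      S-T zero = solve 1 (λ x → (:2 :- x) :* :0 := :1 :- (:1 :- :0)) refl x
      S-T (suc n) = begin
        (2# - x) * (T n + S x (suc n))
          ≈⟨ distribˡ _ _ _ ⟩
        (2# - x) * T n + (2# - x) * S x (suc n)
          ≈⟨ +-congʳ (S-T n) ⟩
        1# - (S x (suc n) - S x n) + (2# - x) * S x (suc n)
          ≈⟨ solve 3 (λ x a b → :1 :- (b :- a) :+ (:2 :- x) :* b
               := :1 :- (x :* b :- a :- b)) refl x (S x n) (S x (suc n)) ⟩
        1# - (S x (suc (suc n)) - S x (suc n)) ∎

      Pos-T : ∀ n → (∀ j → j ℕ.≤ n → Pos (S x (suc j))) → Pos (T (suc n))
      Pos-T zero    h = Pos-resp (sym (+-identityˡ _)) (h 0 z≤n)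
      Pos-T (suc n) h = Pos-+ (Pos-T n λ j j≤n → h j (ℕ.m≤n⇒m≤1+n j≤n)) (h (suc n) ℕ.≤-refl)

    -- The hypotheses on `S` characterise x = 2 cos (π/(2k + 1)) without speaking of angles: a root
    -- of S(2k+1) at which all earlier values are positive.
    module AtAngle
      {k} (1≤k : 1 ℕ.≤ k) (x : Carrier)
      (S≈0 : S x (suc (k ℕ.+ k)) ≈ 0#)
      (Pos-S : ∀ j → j ℕ.< k ℕ.+ k → Pos (S x (suc j)))
      where

      private
        q-1 q-2 : ℕ
        q-1 = k ℕ.+ k
        q-2 = ℕ.pred q-1

        q-1≡ : q-1 ≡ suc q-2
        q-1≡ = ≡.sym (ℕ.suc-pred q-1 {{ℕ.>-nonZero (ℕ.≤-trans 1≤k (ℕ.m≤m+n k k))}})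

        last : Carrier
        last = S x q-1

        Pos-last : Pos last
        Pos-last = ≡.subst (λ n → Pos (S x n)) (≡.sym q-1≡)
          (Pos-S q-2 (≡.subst (suc q-2 ℕ.≤_) (≡.sym q-1≡) ℕ.≤-refl))

        -- Since S(2k+1) vanishes, `cassini` reduces to the statement that the square of `last` is
        -- 1; positivity picks the root 1.
        last≈1 : last ≈ 1#
        last≈1 = begin
          last                   ≈⟨ solve 1 (λ s → s := s :- :1 :+ :1) refl last ⟩
          last - 1# + 1#         ≈⟨ +-congʳ (domain product≈0 (Pos-+ Pos-last Pos-1)) ⟩
          0# + 1#                ≈⟨ +-identityˡ 1# ⟩
          1#                     ∎
          where
          product≈0 : (last + 1#) * (last - 1#) ≈ 0#
          product≈0 = begin
            (last + 1#) * (last - 1#)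
              ≈⟨ solve 2 (λ s x → (s :+ :1) :* (s :- :1) := :0 :* :0 :- x :* :0 :* s :+ s :* s :- :1)
                   refl last x ⟩
            0# * 0# - x * 0# * last + last * last - 1#
              ≈⟨ +-congʳ (+-congʳ (+-cong (*-cong (sym S≈0) (sym S≈0))
                   (-‿cong (*-congʳ (*-congˡ (sym S≈0)))))) ⟩
            _ ≈⟨ +-congʳ (cassini x q-1) ⟩
            1# - 1# ≈⟨ -‿inverseʳ 1# ⟩
            0# ∎

        C-q : C x (suc q-1) ≈ - 2#
        C-q = begin
          C x (suc q-1)
            ≈⟨ C-via-S x (suc q-1) ⟩
          2# * (x * S x (suc q-1) - last) - x * S x (suc q-1)
            ≈⟨ +-cong (*-congˡ (+-cong (*-congˡ S≈0) (-‿cong last≈1))) (-‿cong (*-congˡ S≈0)) ⟩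
          2# * (x * 0# - 1#) - x * 0#
            ≈⟨ solve 1 (λ x → :2 :* (x :* :0 :- :1) :- x :* :0 := :- :2) refl x ⟩
          - 2# ∎

        Pos-2-x : Pos (2# - x)
        Pos-2-x = Pos-cancel
          (Pos-resp (sym (trans (S-T x q-1)
            (trans (+-congˡ (-‿cong (+-cong S≈0 (-‿cong last≈1))))
              (solve 0 (:1 :- (:0 :- :1) := :2) refl)))) Pos-2)
          (≡.subst (λ n → Pos (T x n)) (≡.sym q-1≡)
            (Pos-T x q-2 λ j j≤ → Pos-S j (≡.subst (suc j ℕ.≤_) (≡.sym q-1≡) (s≤s j≤))))

        Pos-x : Pos x
        Pos-x = Pos-resp (solve 1 (λ x → x :* :1 :- :0 := x) refl x)
          (Pos-S 1 (ℕ.+-mono-≤ 1≤k 1≤k))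

      Pos-4-x² : Pos (4# - x * x)
      Pos-4-x² = Pos-resp (solve 1 (λ x → (:2 :- x) :* (:2 :+ x) := :4 :- x :* x) refl x)
        (Pos-* Pos-2-x (Pos-+ Pos-2 Pos-x))

      module _ {i} (i<k : i ℕ.< k) where

        private
          s : Carrier
          s = C x (suc i)

          Pos-Si : Pos (S x (suc i))
          Pos-Si = Pos-S i (ℕ.≤-trans i<k (ℕ.m≤m+n k k))

        -- In S(2j) = S(j) C(j) with j = i + 1 ≤ k both values of `S` are among the positive ones.
        Pos-C : Pos s
        Pos-C = Pos-cancel
          (Pos-resp (trans (S-double x (suc i)) (*-comm _ _))
            (Pos-S (i ℕ.+ suc i) (ℕ.+-mono-≤ i<k i<k)))
          Pos-Si

        private
          -- The product (2 - s)(2 + s) = (4 - x²) S(i+1)² is positive, and the positive factor 2 +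
          -- s can be cancelled.
          Pos-2-s : Pos (2# - s)
          Pos-2-s = Pos-cancel
            (Pos-resp (trans (sym (4-C² x (suc i)))
                (solve 1 (λ s → :4 :- s :* s := (:2 :- s) :* (:2 :+ s)) refl s))
              (Pos-* Pos-4-x² (Pos-* Pos-Si Pos-Si)))
            (Pos-+ Pos-2 Pos-C)

          -- Both signs are carried along because passing from j to `suc j` exchanges them.
          Pos-2-sign*s : ∀ j → Pos (2# - sign j * s) × Pos (2# + sign j * s)
          Pos-2-sign*s zero =
            Pos-resp (solve 1 (λ s → :2 :- s := :2 :- :1 :* s) refl s) Pos-2-s ,
            Pos-resp (solve 1 (λ s → :2 :+ s := :2 :+ :1 :* s) refl s) (Pos-+ Pos-2 Pos-C)
          Pos-2-sign*s (suc j) = let p , q = Pos-2-sign*s j in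
            Pos-resp (solve 2 (λ e s → :2 :+ e :* s := :2 :- :- e :* s) refl (sign j) s) q ,
            Pos-resp (solve 2 (λ e s → :2 :- e :* s := :2 :+ :- e :* s) refl (sign j) s) p

        -- By `D-at-C` and C(2k+1) = -2 the value is e s (2e - s) with e² = 1, which equals s (2 - e
        -- s).
        Pos-sign*D : Pos (sign (suc i) * D k (C x (suc i ℕ.+ suc i)))
        Pos-sign*D = Pos-resp (sym (begin
          e * D k (C x (suc i ℕ.+ suc i))
            ≈⟨ *-congˡ (D-at-C k x (suc i)) ⟩
          e * (s * (C (C x (suc q-1)) (suc i) - s))
            ≈⟨ *-congˡ (*-congˡ (+-congʳ (trans (C-cong C-q (suc i)) (C-at--2-sign (suc i))))) ⟩
          e * (s * (e * 2# - s))
            ≈⟨ solve 2 (λ e s → e :* (s :* (e :* :2 :- s)) := s :* (e :* e :* :2 :- e :* s)) refl e s ⟩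
          s * (e * e * 2# - e * s)
            ≈⟨ *-congˡ (+-congʳ (trans (*-congʳ (sign² (suc i))) (*-identityˡ 2#))) ⟩
          s * (2# - e * s) ∎))
          (Pos-* Pos-C (proj₁ (Pos-2-sign*s (suc i))))
          where e = sign (suc i)

-- Inequalities, integers and limits in ℚ.

module Rationals where

  open import Algebra.Morphism.Structures using (IsRingHomomorphism)
  open import Data.Integer.Base as ℤ using (ℤ; +_; -[1+_])
  import Data.Integer.Properties as ℤ
  open import Data.Nat.Base as ℕ using (ℕ; zero; suc; z≤n; s≤s)
  import Data.Nat.Properties as ℕ
  import Data.Nat.Coprimality as ℕ
  open import Data.Product.Base using (∃-syntax; _×_; _,_)
  open import Data.Rational.Base
  open import Data.Rational.Properties
  open import Data.Rational.Solver using (module +-*-Solver)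
  import Data.Rational.Unnormalised.Base as ℚᵘ
  import Data.Rational.Unnormalised.Properties as ℚᵘ
  open import Data.Sum.Base using (inj₁; inj₂)
  open import Relation.Binary.PropositionalEquality
  open +-*-Solver

  0≤+ : ∀ {p q} → 0ℚ ≤ p → 0ℚ ≤ q → 0ℚ ≤ p + q
  0≤+ = +-mono-≤

  0<+≤ : ∀ {p q} → 0ℚ < p → 0ℚ ≤ q → 0ℚ < p + q
  0<+≤ = +-mono-<-≤

  0≤+< : ∀ {p q} → 0ℚ ≤ p → 0ℚ < q → 0ℚ < p + q
  0≤+< = +-mono-≤-<

  0≤* : ∀ {p q} → 0ℚ ≤ p → 0ℚ ≤ q → 0ℚ ≤ p * q
  0≤* {p} {q} 0≤p 0≤q =
    nonNegative⁻¹ _ {{nonNeg*nonNeg⇒nonNeg p {{nonNegative 0≤p}} q {{nonNegative 0≤q}}}}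

  0<* : ∀ {p q} → 0ℚ < p → 0ℚ < q → 0ℚ < p * q
  0<* {p} {q} 0<p 0<q =
    positive⁻¹ _ {{pos*pos⇒pos p {{positive 0<p}} q {{positive 0<q}}}}

  ≤⇒0≤ : ∀ {p q} → p ≤ q → 0ℚ ≤ q - p
  ≤⇒0≤ {p} {q} p≤q = subst (_≤ q - p) (+-inverseʳ p) (+-monoˡ-≤ (- p) p≤q)

  <⇒0< : ∀ {p q} → p < q → 0ℚ < q - p
  <⇒0< {p} {q} p<q = subst (_< q - p) (+-inverseʳ p) (+-monoˡ-< (- p) p<q)

  -- The form in which inequalities are proved from here on: the solver identifies the difference
  -- with an expression that is visibly nonnegative.
  ≤-by : ∀ {p q r} → 0ℚ ≤ r → q - p ≡ r → p ≤ q
  ≤-by {p} {q} 0≤r refl = subst₂ _≤_ (+-identityˡ p)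
    (solve 2 (λ p q → q :- p :+ p := q) refl p q) (+-monoˡ-≤ p 0≤r)

  <-by : ∀ {p q r} → 0ℚ < r → q - p ≡ r → p < q
  <-by {p} {q} 0<r refl = subst₂ _<_ (+-identityˡ p)
    (solve 2 (λ p q → q :- p :+ p := q) refl p q) (+-monoˡ-< p 0<r)

  0≤p² : ∀ p → 0ℚ ≤ p * p
  0≤p² p with ≤-total 0ℚ p
  ... | inj₁ 0≤p = 0≤* 0≤p 0≤p
  ... | inj₂ p≤0 = subst (0ℚ ≤_) (solve 1 (λ p → (con 0ℚ :- p) :* (con 0ℚ :- p) := p :* p) refl p)
    (0≤* (≤⇒0≤ p≤0) (≤⇒0≤ p≤0))

  ∣∣≤ : ∀ {p ε} → p ≤ ε → - p ≤ ε → ∣ p ∣ ≤ ε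
  ∣∣≤ {p} p≤ε -p≤ε with ∣p∣≡p∨∣p∣≡-p p
  ... | inj₁ e = subst (_≤ _) (sym e) p≤ε
  ... | inj₂ e = subst (_≤ _) (sym e) -p≤ε

  p≤∣p∣ : ∀ p → p ≤ ∣ p ∣
  p≤∣p∣ p with ≤-total 0ℚ p
  ... | inj₁ 0≤p = ≤-reflexive (sym (0≤p⇒∣p∣≡p 0≤p))
  ... | inj₂ p≤0 = ≤-trans p≤0 (0≤∣p∣ p)

  -p≤∣p∣ : ∀ p → - p ≤ ∣ p ∣
  -p≤∣p∣ p = subst (- p ≤_) (∣-p∣≡∣p∣ p) (p≤∣p∣ (- p))

  ∣p-q∣≡∣q-p∣ : ∀ p q → ∣ p - q ∣ ≡ ∣ q - p ∣
  ∣p-q∣≡∣q-p∣ p q = trans (sym (∣-p∣≡∣p∣ (p - q)))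
    (cong ∣_∣ (solve 2 (λ p q → :- (p :- q) := q :- p) refl p q))

  ∣∣-triangle : ∀ p q r → ∣ p - r ∣ ≤ ∣ p - q ∣ + ∣ q - r ∣
  ∣∣-triangle p q r = subst (λ t → ∣ t ∣ ≤ ∣ p - q ∣ + ∣ q - r ∣)
    (solve 3 (λ p q r → p :- q :+ (q :- r) := p :- r) refl p q r)
    (∣p+q∣≤∣p∣+∣q∣ (p - q) (q - r))

  0<½ : 0ℚ < ½
  0<½ = positive⁻¹ ½

  0<1 : 0ℚ < 1ℚ
  0<1 = positive⁻¹ 1ℚ

  0≤1 : 0ℚ ≤ 1ℚ
  0≤1 = <⇒≤ 0<1

  0<½* : ∀ {ε} → 0ℚ < ε → 0ℚ < ½ * ε
  0<½* = 0<* 0<½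

  ½+½ : ∀ ε → ½ * ε + ½ * ε ≡ ε
  ½+½ = solve 1 (λ ε → con ½ :* ε :+ con ½ :* ε := ε) refl

  inverse : ∀ {p} → 0ℚ < p → ∃[ r ] 0ℚ < r × p * r ≡ 1ℚ
  inverse {p} 0<p =
    let instance
          p>0 = positive 0<p
          p≢0 = pos⇒nonZero p
    in 1/ p , positive⁻¹ (1/ p) {{1/pos⇒pos p}} , *-inverseʳ p

  private
    uncancel : ∀ {p r} → p * r ≡ 1ℚ → ∀ q → r * (p * q) ≡ q
    uncancel {p} {r} pr≡1 q = trans
      (solve 3 (λ p r q → r :* (p :* q) := p :* r :* q) refl p r q)
      (trans (cong (_* q) pr≡1) (*-identityˡ q))

  0≤-cancel : ∀ {p q} → 0ℚ < p → 0ℚ ≤ p * q → 0ℚ ≤ q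
  0≤-cancel {p} {q} 0<p 0≤pq =
    let r , 0<r , pr≡1 = inverse 0<p in
    subst (0ℚ ≤_) (uncancel {p} pr≡1 q) (0≤* (<⇒≤ 0<r) 0≤pq)

  0<-cancel : ∀ {p q} → 0ℚ < p → 0ℚ < p * q → 0ℚ < q
  0<-cancel {p} {q} 0<p 0<pq =
    let r , 0<r , pr≡1 = inverse 0<p in
    subst (0ℚ <_) (uncancel {p} pr≡1 q) (0<* 0<r 0<pq)

  *-mono : ∀ {p q r s} → 0ℚ ≤ p → 0ℚ ≤ s → p ≤ q → r ≤ s → p * r ≤ q * s
  *-mono {p} {q} {r} {s} 0≤p 0≤s p≤q r≤s = ≤-by
    (0≤+ (0≤* (≤⇒0≤ p≤q) 0≤s) (0≤* 0≤p (≤⇒0≤ r≤s)))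
    (solve 4 (λ p q r s → q :* s :- p :* r := (q :- p) :* s :+ p :* (s :- r)) refl p q r s)

  fromℤ : ℤ → ℚ
  fromℤ i = i / 1

  private
    fromℤ-mkℚ : ∀ i → fromℤ i ≡ mkℚ i 0 (ℕ.sym (ℕ.1-coprimeTo _))
    fromℤ-mkℚ i = ↥p/↧p≡p (mkℚ i 0 (ℕ.sym (ℕ.1-coprimeTo _)))

  toℚᵘ-fromℤ : ∀ i → toℚᵘ (fromℤ i) ℚᵘ.≃ ℚᵘ.mkℚᵘ i 0
  toℚᵘ-fromℤ i = ℚᵘ.≃-reflexive (cong toℚᵘ (fromℤ-mkℚ i))

  fromℤ-+ : ∀ i j → fromℤ (i ℤ.+ j) ≡ fromℤ i + fromℤ j
  fromℤ-+ i j = toℚᵘ-injective (ℚᵘ.≃-trans (toℚᵘ-fromℤ (i ℤ.+ j)) (ℚᵘ.≃-sym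
    (ℚᵘ.≃-trans (toℚᵘ-homo-+ (fromℤ i) (fromℤ j))
      (ℚᵘ.≃-trans (ℚᵘ.+-cong (toℚᵘ-fromℤ i) (toℚᵘ-fromℤ j))
        (ℚᵘ.≃-reflexive (cong (λ k → ℚᵘ.mkℚᵘ k 0)
          (cong₂ ℤ._+_ (ℤ.*-identityʳ i) (ℤ.*-identityʳ j))))))))

  denominator*p≡numerator : ∀ p → fromℤ (↧ p) * p ≡ fromℤ (↥ p)
  denominator*p≡numerator p@(mkℚ i d-1 _) = toℚᵘ-injective
    (ℚᵘ.≃-trans (toℚᵘ-homo-* (fromℤ (↧ p)) p)
      (ℚᵘ.≃-trans (ℚᵘ.*-congʳ {toℚᵘ p} (toℚᵘ-fromℤ (↧ p)))
        (ℚᵘ.≃-trans (ℚᵘ.*≡* cross) (ℚᵘ.≃-sym (toℚᵘ-fromℤ i)))))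
    where
    cross : + suc d-1 ℤ.* i ℤ.* + 1 ≡ i ℤ.* + suc (d-1 ℕ.+ 0)
    cross = trans (ℤ.*-identityʳ _) (trans (ℤ.*-comm (+ suc d-1) i)
      (cong (λ n → i ℤ.* + suc n) (sym (ℕ.+-identityʳ d-1))))

  fromℤ-* : ∀ i j → fromℤ (i ℤ.* j) ≡ fromℤ i * fromℤ j
  fromℤ-* i j = toℚᵘ-injective (ℚᵘ.≃-trans (toℚᵘ-fromℤ (i ℤ.* j)) (ℚᵘ.≃-sym
    (ℚᵘ.≃-trans (toℚᵘ-homo-* (fromℤ i) (fromℤ j))
      (ℚᵘ.*-cong (toℚᵘ-fromℤ i) (toℚᵘ-fromℤ j)))))

  fromℤ-neg : ∀ i → fromℤ (ℤ.- i) ≡ - fromℤ i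
  fromℤ-neg i = toℚᵘ-injective (ℚᵘ.≃-trans (toℚᵘ-fromℤ (ℤ.- i)) (ℚᵘ.≃-sym
    (ℚᵘ.≃-trans (toℚᵘ-homo‿- (fromℤ i)) (ℚᵘ.-‿cong (toℚᵘ-fromℤ i)))))

  fromℤ-hom : IsRingHomomorphism ℤ.+-*-rawRing +-*-rawRing fromℤ
  fromℤ-hom = record
    { isSemiringHomomorphism = record
      { isNearSemiringHomomorphism = record
        { +-isMonoidHomomorphism = record
          { isMagmaHomomorphism = record
            { isRelHomomorphism = record { cong = cong fromℤ }
            ; homo = fromℤ-+ }
          ; ε-homo = refl }
        ; *-homo = fromℤ-* }
      ; 1#-homo = refl }
    ; -‿homo = fromℤ-neg }

  fromℤ-injective : ∀ {i j} → fromℤ i ≡ fromℤ j → i ≡ j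
  fromℤ-injective {i} {j} e =
    cong ↥_ (trans (sym (fromℤ-mkℚ i)) (trans e (fromℤ-mkℚ j)))

  fromℤ-mono : ∀ {i j} → i ℤ.≤ j → fromℤ i ≤ fromℤ j
  fromℤ-mono {i} {j} i≤j = subst₂ _≤_ (sym (fromℤ-mkℚ i)) (sym (fromℤ-mkℚ j))
    (*≤* (subst₂ ℤ._≤_ (sym (ℤ.*-identityʳ i)) (sym (ℤ.*-identityʳ j)) i≤j))

  fromℕ : ℕ → ℚ
  fromℕ n = fromℤ (+ n)

  fromℕ-mono : ∀ {m n} → m ℕ.≤ n → fromℕ m ≤ fromℕ n
  fromℕ-mono m≤n = fromℤ-mono (ℤ.+≤+ m≤n)

  fromℕ-suc : ∀ n → fromℕ (suc n) ≡ 1ℚ + fromℕ n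
  fromℕ-suc n = fromℤ-+ (+ 1) (+ n)

  0≤fromℕ : ∀ n → 0ℚ ≤ fromℕ n
  0≤fromℕ n = fromℕ-mono {0} {n} z≤n

  archimedean : ∀ p → ∃[ n ] p ≤ fromℕ n
  archimedean p@(mkℚ i d-1 _) = ℤ.∣ i ∣ , subst (p ≤_) (sym (fromℤ-mkℚ (+ ℤ.∣ i ∣))) (*≤* (begin
    i ℤ.* + 1                      ≡⟨ ℤ.*-identityʳ i ⟩
    i                              ≤⟨ i≤∣i∣ i ⟩
    + ℤ.∣ i ∣                      ≡⟨ sym (ℤ.*-identityʳ (+ ℤ.∣ i ∣)) ⟩
    + ℤ.∣ i ∣ ℤ.* + 1              ≤⟨ ℤ.*-monoˡ-≤-nonNeg (+ ℤ.∣ i ∣) (ℤ.+≤+ (s≤s z≤n)) ⟩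
    + ℤ.∣ i ∣ ℤ.* + suc d-1        ∎))
    where
    open ℤ.≤-Reasoning
    i≤∣i∣ : ∀ i → i ℤ.≤ + ℤ.∣ i ∣
    i≤∣i∣ (+ n)    = ℤ.≤-refl
    i≤∣i∣ -[1+ n ] = ℤ.-≤+

  ½^ : ℕ → ℚ
  ½^ zero    = 1ℚ
  ½^ (suc n) = ½ * ½^ n

  0<½^ : ∀ n → 0ℚ < ½^ n
  0<½^ zero    = 0<1
  0<½^ (suc n) = 0<½* (0<½^ n)

  ½^≤1 : ∀ n → ½^ n ≤ 1ℚ
  ½^≤1 zero    = ≤-refl
  ½^≤1 (suc n) = ≤-trans
    (≤-by (0≤* (<⇒≤ 0<½) (<⇒≤ (0<½^ n))) (solve 1 (λ h → h :- con ½ :* h := con ½ :* h) refl (½^ n)))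
    (½^≤1 n)

  n*½^n≤1 : ∀ n → fromℕ n * ½^ n ≤ 1ℚ
  n*½^n≤1 zero    = <⇒≤ 0<1
  n*½^n≤1 (suc n) = ≤-by
    (0≤+ (0≤* (<⇒≤ 0<½) (≤⇒0≤ (n*½^n≤1 n))) (0≤* (<⇒≤ 0<½) (≤⇒0≤ (½^≤1 n))))
    (trans (cong (λ m → 1ℚ - m * (½ * ½^ n)) (fromℕ-suc n))
      (solve 2 (λ m h → con 1ℚ :- (con 1ℚ :+ m) :* (con ½ :* h)
        := con ½ :* (con 1ℚ :- m :* h) :+ con ½ :* (con 1ℚ :- h)) refl (fromℕ n) (½^ n)))

  -- With r = 1/ε and N ≥ L r one has ε - L h = ε h (n - L r) + ε (1 - n h) for h = ½^n, and both
  -- terms are nonnegative for n ≥ N.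
  vanishing : ∀ L {ε} → 0ℚ < ε → ∃[ N ] ∀ n → N ℕ.≤ n → L * ½^ n ≤ ε
  vanishing L {ε} 0<ε =
    let r , 0<r , εr≡1 = inverse 0<ε
        N , Lr≤N = archimedean (L * r) in
    N , λ n N≤n → ≤-by
      (0≤+ (0≤* (0≤* (<⇒≤ 0<ε) (<⇒≤ (0<½^ n))) (≤⇒0≤ (≤-trans Lr≤N (fromℕ-mono {N} {n} N≤n))))
           (0≤* (<⇒≤ 0<ε) (≤⇒0≤ (n*½^n≤1 n))))
      (trans
        (solve 3 (λ ε L h → ε :- L :* h := ε :- L :* con 1ℚ :* h) refl ε L (½^ n))
        (trans (cong (λ t → ε - L * t * ½^ n) (sym εr≡1))
          (solve 5 (λ ε L h r m → ε :- L :* (ε :* r) :* h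
            := ε :* h :* (m :- L :* r) :+ ε :* (con 1ℚ :- m :* h)) refl ε L (½^ n) r (fromℕ n))))

-- The rational root theorem for monic integer polynomials.

module RationalRoot where

  open import Data.Integer.Base as ℤ using (ℤ; +_)
  import Data.Integer.Properties as ℤ
  open import Data.Integer.Solver using () renaming (module +-*-Solver to ℤ-Solver)
  open import Data.Nat.Base as ℕ using (ℕ; zero; suc)
  open import Data.Nat.Coprimality as ℕ using (Coprime; coprime-divisor)
  open import Data.Nat.Divisibility as ℕ using (_∣_; divides)
  import Data.Nat.Properties as ℕ
  open import Data.Product.Base using (∃-syntax; _,_)
  open import Data.Rational.Base as ℚ using (ℚ; mkℚ; 0ℚ; 1ℚ)
  import Data.Rational.Properties as ℚ
  open import Data.Rational.Solver using () renaming (module +-*-Solver to ℚ-Solver)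
  open import Data.Vec.Base as Vec using (Vec; []; _∷_)
  open import Relation.Binary.PropositionalEquality
  open Rationals
  open Polynomials ℚ.+-*-commutativeRing using (monic)
  open ≡-Reasoning

  private
    _^ᶻ_ : ℤ → ℕ → ℤ
    u ^ᶻ zero  = + 1
    u ^ᶻ suc n = u ℤ.* u ^ᶻ n

    -- vᵈ f(u/v) = uᵈ + v (…).
    cleared : ∀ {r} u v → fromℤ v ℚ.* r ≡ fromℤ u → ∀ {d} (f : Vec ℤ d) →
              ∃[ k ] fromℤ (v ^ᶻ d) ℚ.* monic (Vec.map fromℤ f) r ≡ fromℤ (u ^ᶻ d ℤ.+ v ℤ.* k)
    cleared u v vr≡u [] = + 0 ,
      trans (ℚ.*-identityʳ 1ℚ) (cong fromℤ (sym (trans (cong (λ t → + 1 ℤ.+ t) (ℤ.*-zeroʳ v)) refl)))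
    cleared {r} u v vr≡u {suc d} (c ∷ f) =
      let k , h = cleared {r} u v vr≡u f
          p = monic (Vec.map fromℤ f) r in
      c ℤ.* v ^ᶻ d ℤ.+ u ℤ.* k , (begin
        fromℤ (v ℤ.* v ^ᶻ d) ℚ.* (fromℤ c ℚ.+ r ℚ.* p)
          ≡⟨ cong (ℚ._* (fromℤ c ℚ.+ r ℚ.* p)) (fromℤ-* v (v ^ᶻ d)) ⟩
        fromℤ v ℚ.* fromℤ (v ^ᶻ d) ℚ.* (fromℤ c ℚ.+ r ℚ.* p)
          ≡⟨ (let open ℚ-Solver in solve 5 (λ v w c r p → v :* w :* (c :+ r :* p)
               := v :* (c :* w) :+ v :* r :* (w :* p)) refl (fromℤ v) (fromℤ (v ^ᶻ d)) (fromℤ c) r p) ⟩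
        fromℤ v ℚ.* (fromℤ c ℚ.* fromℤ (v ^ᶻ d)) ℚ.+ fromℤ v ℚ.* r ℚ.* (fromℤ (v ^ᶻ d) ℚ.* p)
          ≡⟨ cong₂ (λ s t → fromℤ v ℚ.* s ℚ.+ t) (sym (fromℤ-* c (v ^ᶻ d))) (cong₂ ℚ._*_ vr≡u h) ⟩
        fromℤ v ℚ.* fromℤ (c ℤ.* v ^ᶻ d) ℚ.+ fromℤ u ℚ.* fromℤ (u ^ᶻ d ℤ.+ v ℤ.* k)
          ≡⟨ cong₂ ℚ._+_ (sym (fromℤ-* v _)) (sym (fromℤ-* u _)) ⟩
        fromℤ (v ℤ.* (c ℤ.* v ^ᶻ d)) ℚ.+ fromℤ (u ℤ.* (u ^ᶻ d ℤ.+ v ℤ.* k))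
          ≡⟨ sym (fromℤ-+ (v ℤ.* (c ℤ.* v ^ᶻ d)) (u ℤ.* (u ^ᶻ d ℤ.+ v ℤ.* k))) ⟩
        fromℤ (v ℤ.* (c ℤ.* v ^ᶻ d) ℤ.+ u ℤ.* (u ^ᶻ d ℤ.+ v ℤ.* k))
          ≡⟨ cong fromℤ (let open ℤ-Solver in solve 6 (λ u v w x c k →
               v :* (c :* w) :+ u :* (x :+ v :* k) := u :* x :+ v :* (c :* w :+ u :* k))
               refl u v (v ^ᶻ d) (u ^ᶻ d) c k) ⟩
        fromℤ (u ℤ.* u ^ᶻ d ℤ.+ v ℤ.* (c ℤ.* v ^ᶻ d ℤ.+ u ℤ.* k)) ∎)

    ∣^∣ : ∀ u n → ℤ.∣ u ^ᶻ n ∣ ≡ ℤ.∣ u ∣ ℕ.^ n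
    ∣^∣ u zero    = refl
    ∣^∣ u (suc n) = trans (ℤ.abs-* u (u ^ᶻ n)) (cong (ℤ.∣ u ∣ ℕ.*_) (∣^∣ u n))

    coprime-^ : ∀ {u v} → Coprime v u → ∀ n → v ∣ u ℕ.^ n → v ≡ 1
    coprime-^ c zero    h = ℕ.∣1⇒≡1 h
    coprime-^ c (suc n) h = coprime-^ c n (coprime-divisor c h)

  -- By `cleared` the denominator v divides u^d; being coprime to the numerator u, it is 1.
  integralRational : ∀ {d} (f : Vec ℤ d) r → monic (Vec.map fromℤ f) r ≡ 0ℚ → ∃[ z ] r ≡ fromℤ z
  integralRational {d} f r@(mkℚ u d-1 coprime) fr≡0 = u , (begin
    r                       ≡⟨ sym (ℚ.*-identityˡ r) ⟩
    1ℚ ℚ.* r                ≡⟨ cong (λ n → fromℤ (+ n) ℚ.* r) (sym v≡1) ⟩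
    fromℤ (+ v) ℚ.* r       ≡⟨ vr≡u ⟩
    fromℤ u                 ∎)
    where
    v = suc d-1

    vr≡u : fromℤ (+ v) ℚ.* r ≡ fromℤ u
    vr≡u = denominator*p≡numerator r

    v≡1 : v ≡ 1
    v≡1 =
      let k , h = cleared {r} u (+ v) vr≡u f
          u^d+vk≡0 : u ^ᶻ d ℤ.+ + v ℤ.* k ≡ + 0
          u^d+vk≡0 = fromℤ-injective (trans (sym h) (trans
            (cong (fromℤ ((+ v) ^ᶻ d) ℚ.*_) fr≡0) (ℚ.*-zeroʳ (fromℤ ((+ v) ^ᶻ d)))))
      in coprime-^ (ℕ.sym (ℕ.recompute coprime)) d (divides ℤ.∣ k ∣ (begin
        ℤ.∣ u ∣ ℕ.^ d             ≡⟨ sym (∣^∣ u d) ⟩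
        ℤ.∣ u ^ᶻ d ∣              ≡⟨ cong ℤ.∣_∣ (trans (let open ℤ-Solver in solve 2 (λ a b → a := a :+ b :- b) refl (u ^ᶻ d) (+ v ℤ.* k))
                                      (trans (cong (ℤ._- (+ v ℤ.* k)) u^d+vk≡0) (ℤ.+-identityˡ (ℤ.- (+ v ℤ.* k))))) ⟩
        ℤ.∣ ℤ.- (+ v ℤ.* k) ∣     ≡⟨ ℤ.∣-i∣≡∣i∣ (+ v ℤ.* k) ⟩
        ℤ.∣ + v ℤ.* k ∣           ≡⟨ ℤ.abs-* (+ v) k ⟩
        v ℕ.* ℤ.∣ k ∣             ≡⟨ ℕ.*-comm v ℤ.∣ k ∣ ⟩
        ℤ.∣ k ∣ ℕ.* v             ∎))

-- Irreducibility of R and the lower bound for the degree of α.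

module Irreducibility where

  open import Algebra.Bundles using (CommutativeRing; Semiring)
  import Algebra.Morphism.Construct.Composition as Composition
  open import Algebra.Morphism.Structures using (IsRingHomomorphism)
  open import Data.Empty using (⊥-elim)
  open import Data.Integer.Base as ℤ using (ℤ; +_)
  import Data.Integer.Properties as ℤ
  open import Data.List.Base using (List; []; _∷_; length)
  open import Data.List.Relation.Unary.All as All using (All; []; _∷_)
  open import Data.List.Relation.Unary.AllPairs as AllPairs using (AllPairs; []; _∷_)
  open import Data.Nat.Base as ℕ using (ℕ; zero; suc; z≤n; s≤s)
  import Data.Nat.Properties as ℕ
  open import Data.Product.Base using (Σ-syntax; ∃-syntax; _×_; _,_; proj₁; proj₂)
  open import Data.Rational.Base as ℚ using (ℚ; 0ℚ; 1ℚ)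
  import Data.Rational.Properties as ℚ
  open import Data.Sum.Base using (_⊎_; inj₁; inj₂)
  open import Data.Vec.Base as Vec using (Vec; []; _∷_)
  import Data.Vec.Properties as Vec
  open import Function.Base using (_∘_; id)
  open import Relation.Binary.PropositionalEquality as ≡ using (_≡_)
  open import Relation.Nullary.Decidable.Core using (yes; no)
  open import Relation.Nullary.Negation using (¬_; contradiction)
  open Rationals
  open RationalRoot

  -- Records how the roots of F are distributed over two factors.
  data Split {a} {A : Set a} : List A → List A → List A → Set a where
    []    : Split [] [] []
    left  : ∀ {x xs ys zs} → Split xs ys zs → Split (x ∷ xs) (x ∷ ys) zs
    right : ∀ {x xs ys zs} → Split xs ys zs → Split (x ∷ xs) ys (x ∷ zs)

  module _ {a} {A : Set a} where

    Split-All : ∀ {p} {P : A → Set p} {xs ys zs} → Split xs ys zs → All P xs → All P ys × All P zs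
    Split-All []        []       = [] , []
    Split-All (left s)  (p ∷ ps) = let ys , zs = Split-All s ps in p ∷ ys , zs
    Split-All (right s) (p ∷ ps) = let ys , zs = Split-All s ps in ys , p ∷ zs

    Split-AllPairs : ∀ {r} {R : A → A → Set r} {xs ys zs} → Split xs ys zs →
                     AllPairs R xs → AllPairs R ys × AllPairs R zs
    Split-AllPairs []        []       = [] , []
    Split-AllPairs (left s)  (r ∷ rs) =
      let ys , zs = Split-AllPairs s rs in proj₁ (Split-All s r) ∷ ys , zs
    Split-AllPairs (right s) (r ∷ rs) =
      let ys , zs = Split-AllPairs s rs in ys , proj₂ (Split-All s r) ∷ zs

    Split-length : ∀ {xs ys zs : List A} → Split xs ys zs → length ys ℕ.+ length zs ≡ length xs
    Split-length []        = ≡.refl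
    Split-length (left s)  = ≡.cong suc (Split-length s)
    Split-length (right {ys = ys} s) = ≡.trans (ℕ.+-suc (length ys) _) (≡.cong suc (Split-length s))

  module Field
    {c ℓ} (R : CommutativeRing c ℓ)
    (ι : ℚ → CommutativeRing.Carrier R)
    (ι-hom : IsRingHomomorphism ℚ.+-*-rawRing (CommutativeRing.rawRing R) ι)
    (isDomain : Polynomials.IsDomain R)
    where

    open CommutativeRing R hiding (zero)
    open IsRingHomomorphism ι-hom
    open IntegerCoefficients R hiding (⟦_⟧)
    open Polynomials R
    open IsDomain isDomain
    open Roots isDomain
    open import Algebra.Definitions.RawSemiring (Semiring.rawSemiring semiring) using (_^_)
    open import Relation.Binary.Reasoning.Setoid setoid

    ιℤ-hom : IsRingHomomorphism ℤ.+-*-rawRing (CommutativeRing.rawRing R) (ι ∘ fromℤ)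
    ιℤ-hom = Composition.isRingHomomorphism trans fromℤ-hom ι-hom

    open Integrality R (ι ∘ fromℤ) ιℤ-hom public
    module ℤ[x] = WithCoefficients ℤ.+-*-rawRing (ι ∘ fromℤ) ιℤ-hom {P = Carrier} id
    module ℚ[x] = WithCoefficients ℚ.+-*-rawRing ι ι-hom {P = Carrier} id

    private module ℚP = Polynomials ℚ.+-*-commutativeRing

    ι-≉0 : ∀ {p} → ¬ p ≡ 0ℚ → ¬ ι p ≈ 0#
    ι-≉0 {p} p≢0 ιp≈0 = 1≉0 (begin
      1#                                ≈⟨ 1#-homo ⟨
      ι 1ℚ                              ≡⟨ ≡.cong ι (ℚ.*-inverseˡ p) ⟨
      ι (ℚ.1/ p ℚ.* p)                  ≈⟨ *-homo (ℚ.1/ p) p ⟩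
      ι (ℚ.1/ p) * ι p                  ≈⟨ *-congˡ ιp≈0 ⟩
      ι (ℚ.1/ p) * 0#                   ≈⟨ zeroʳ _ ⟩
      0#                                ∎)
      where instance p≠0 = ℚ.≢-nonZero p≢0

    ι-injective : ∀ {p q} → ι p ≈ ι q → p ≡ q
    ι-injective {p} {q} h with p ℚ.≟ q
    ... | yes p≡q = p≡q
    ... | no p≢q  = contradiction
      (trans (+-homo p (ℚ.- q)) (trans (+-cong h (-‿homo q)) (-‿inverseʳ (ι q))))
      (ι-≉0 λ p-q≡0 → p≢q (≡.trans (≡.sym (≡.trans (ℚ.+-assoc p (ℚ.- q) q)
          (≡.trans (≡.cong (p ℚ.+_) (ℚ.+-inverseˡ q)) (ℚ.+-identityʳ p))))
        (≡.trans (≡.cong (ℚ._+ q) p-q≡0) (ℚ.+-identityˡ q))))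

    monic-ι : ∀ {d} (f : Vec ℚ d) p → monic (Vec.map ι f) (ι p) ≈ ι (ℚP.monic f p)
    monic-ι []      p = sym 1#-homo
    monic-ι (a ∷ f) p = trans (+-congˡ (trans (*-congˡ (monic-ι f p)) (sym (*-homo p _)))) (sym (+-homo a _))

    integralRational′ : ∀ {p} → IsIntegral (ι p) → ∃[ z ] p ≡ fromℤ z
    integralRational′ {p} (d , f , h) = integralRational f p (ι-injective (begin
      ι (ℚP.monic (Vec.map fromℤ f) p)              ≈⟨ monic-ι (Vec.map fromℤ f) p ⟨
      monic (Vec.map ι (Vec.map fromℤ f)) (ι p)     ≡⟨ ≡.cong (λ g → monic g (ι p)) (Vec.map-∘ ι fromℤ f) ⟨
      monic (Vec.map (ι ∘ fromℤ) f) (ι p)           ≈⟨ h ⟩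
      0#                                            ≈⟨ 0#-homo ⟨
      ι 0ℚ                                          ∎))

    toRational : ∀ {d F} → ℤ[x].Monic d F → ℚ[x].Monic d F
    toRational (f , h) = Vec.map fromℤ f , λ x →
      trans (reflexive (≡.cong (λ g → monic g x) (≡.sym (Vec.map-∘ ι fromℤ f)))) (h x)

    -- The coefficients are rational, so whether one vanishes is decidable, and the leading nonzero
    -- one can be found and divided out.
    normalise : ∀ {d} (f : Vec ℚ d) → (∀ x → low (Vec.map ι f) x ≈ 0#) ⊎
      (∃[ e ] e ℕ.< d × Σ[ g ∈ Vec ℚ e ] ∃[ l ] ¬ ι l ≈ 0# ×
        (∀ x → low (Vec.map ι f) x ≈ ι l * monic (Vec.map ι g) x))
    normalise [] = inj₁ λ x → refl
    normalise (a ∷ f) with normalise f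
    ... | inj₂ (e , e<d , g , l , l≉0 , h) = inj₂
      (suc e , s≤s e<d , a′ ∷ g , l , l≉0 , λ x → begin
        ι a + x * low (Vec.map ι f) x
          ≈⟨ +-cong (sym la′≈a) (*-congˡ (h x)) ⟩
        ι l * ι a′ + x * (ι l * monic (Vec.map ι g) x)
          ≈⟨ solve 4 (λ l a x g → l :* a :+ x :* (l :* g) := l :* (a :+ x :* g)) refl _ _ _ _ ⟩
        ι l * (ι a′ + x * monic (Vec.map ι g) x) ∎)
      where
      instance
        l≢0 : ℚ.NonZero l
        l≢0 = ℚ.≢-nonZero λ l≡0 → l≉0 (trans (reflexive (≡.cong ι l≡0)) 0#-homo)
      a′ : ℚ
      a′ = ℚ.1/ l ℚ.* a
      la′≈a : ι l * ι a′ ≈ ι a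
      la′≈a = trans (sym (*-homo l a′)) (reflexive (≡.cong ι
        (≡.trans (≡.sym (ℚ.*-assoc l (ℚ.1/ l) a))
          (≡.trans (≡.cong (ℚ._* a) (ℚ.*-inverseʳ l)) (ℚ.*-identityˡ a)))))
    ... | inj₁ h with a ℚ.≟ 0ℚ
    ...   | yes ≡.refl = inj₁ λ x →
      trans (+-cong 0#-homo (trans (*-congˡ (h x)) (zeroʳ x))) (+-identityˡ 0#)
    ...   | no a≢0 = inj₂ (0 , s≤s z≤n , [] , a , ι-≉0 a≢0 , λ x →
      trans (+-congˡ (trans (*-congˡ (h x)) (zeroʳ x))) (trans (+-identityʳ _) (sym (*-identityʳ _))))

    -- Both polynomials are monic of the same least degree. Their difference vanishes at α and has
    -- lower degree, so if it were not zero, its normalised form would contradict minimality.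
    minimalUnique : ∀ {d F α} → ℚ[x].Monic d F → F α ≈ 0# →
      (∀ {e} (g : Vec ℚ e) → monic (Vec.map ι g) α ≈ 0# → d ℕ.≤ e) →
      ∀ {d′} (g : Vec ℚ d′) → monic (Vec.map ι g) α ≈ 0# →
      (∀ {e} (g : Vec ℚ e) → monic (Vec.map ι g) α ≈ 0# → d′ ℕ.≤ e) →
      ∀ {w} → monic (Vec.map ι g) w ≈ 0# → F w ≈ 0#
    minimalUnique {d} {F} {α} u Fα≈0 least g gα≈0 least′ {w} gw≈0 =
      compare g gα≈0 gw≈0 (ℕ.≤-antisym (least g gα≈0) (least′ (proj₁ u) (trans (proj₂ u α) Fα≈0)))
      where
      module _ (g : Vec ℚ d) (gα≈0 : monic (Vec.map ι g) α ≈ 0#) (gw≈0 : monic (Vec.map ι g) w ≈ 0#) where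

        G : Carrier → Carrier
        G = monic (Vec.map ι g)

        compareLow : ℚ[x].Low d (λ x → F x - G x) → F w ≈ 0#
        compareLow (l , l≈) with normalise l
        ... | inj₁ l≈0 = begin
          F w                 ≈⟨ solve 2 (λ f g → f := f :- g :+ g) refl (F w) (G w) ⟩
          F w - G w + G w     ≈⟨ +-cong (trans (sym (l≈ w)) (l≈0 w)) gw≈0 ⟩
          0# + 0#             ≈⟨ +-identityˡ 0# ⟩
          0#                  ∎
        ... | inj₂ (e , e<d , p , r , r≉0 , l≈rp) = ⊥-elim (ℕ.<⇒≱ e<d (least p (domain (begin
          ι r * monic (Vec.map ι p) α     ≈⟨ l≈rp α ⟨
          low (Vec.map ι l) α             ≈⟨ l≈ α ⟩
          F α - G α                       ≈⟨ +-cong Fα≈0 (-‿cong gα≈0) ⟩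
          0# - 0#                         ≈⟨ solve 0 (:0 :- :0 := :0) refl ⟩
          0#                              ∎) r≉0)))

        equalDegrees : F w ≈ 0#
        equalDegrees = compareLow (ℚ[x].Low-≈
          (λ x → solve 3 (λ f g t → f :- t :- (g :- t) := f :- g) refl (F x) (G x) (x ^ d))
          (ℚ[x].Low-- (ℚ[x].Monic⇒Low u) (ℚ[x].Monic⇒Low (g , λ x → refl))))

      compare : ∀ {d′} (g : Vec ℚ d′) → monic (Vec.map ι g) α ≈ 0# → monic (Vec.map ι g) w ≈ 0# →
                d ≡ d′ → F w ≈ 0#
      compare g gα≈0 gw≈0 ≡.refl = equalDegrees g gα≈0 gw≈0

    -- Laurent polynomials in z as U(t) + V(t) z⁻¹, where t = z + z⁻¹.
    private
      Inverse : Carrier → Carrier → Set _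
      Inverse z z′ = z * z′ ≈ 1#

      -- The recursion is multiplication by z⁻¹ together with z⁻² = t z⁻¹ - 1.
      inversePowers : ∀ j → ∃[ U ] ∃[ V ] ℚ[x].Low j U × ℚ[x].Low (suc j) V ×
        (∀ {z z′} → Inverse z z′ → z′ ^ suc j ≈ V (z + z′) * z′ - U (z + z′))
      inversePowers zero = (λ _ → 0#) , (λ _ → ι 1ℚ) , ℚ[x].Low-0 , ℚ[x].Low-const 1ℚ ,
        λ {z} {z′} _ → trans (solve 1 (λ z → z :* :1 := :1 :* z :- :0) refl z′)
          (+-congʳ (*-congʳ (sym 1#-homo)))
      inversePowers (suc j) =
        let U , V , u , v , h = inversePowers j in
        V , (λ t → t * V t - U t) , v ,
        ℚ[x].Low-- (ℚ[x].Low-X v) (ℚ[x].Low-suc (ℚ[x].Low-suc u)) ,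
        λ {z} {z′} zz′≈1 → begin
          z′ * z′ ^ suc j
            ≈⟨ *-congˡ (h zz′≈1) ⟩
          z′ * (V (z + z′) * z′ - U (z + z′))
            ≈⟨ solve 4 (λ z z′ u v → z′ :* (v :* z′ :- u)
                 := ((z :+ z′) :* v :- u) :* z′ :- z :* z′ :* v) refl z z′ (U (z + z′)) (V (z + z′)) ⟩
          ((z + z′) * V (z + z′) - U (z + z′)) * z′ - z * z′ * V (z + z′)
            ≈⟨ +-congˡ (-‿cong (trans (*-congʳ zz′≈1) (*-identityˡ _))) ⟩
          ((z + z′) * V (z + z′) - U (z + z′)) * z′ - V (z + z′) ∎

      lowPart : ∀ {d} (f : Vec ℚ d) → ∃[ U ] ∃[ V ] ℚ[x].Low (ℕ.pred d) U × ℚ[x].Low d V ×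
        (∀ {z z′} → Inverse z z′ → z′ ^ d * low (Vec.map ι f) z ≈ V (z + z′) * z′ - U (z + z′))
      lowPart [] = (λ _ → 0#) , (λ _ → 0#) , ℚ[x].Low-0 , ℚ[x].Low-0 ,
        λ {z} {z′} _ → solve 1 (λ z → :1 :* :0 := :0 :* z :- :0) refl z′
      lowPart {suc d} (a ∷ f) =
        let U , V , u , v , h = lowPart f
            U₁ , V₁ , u₁ , v₁ , h₁ = inversePowers d in
        (λ t → ι a * U₁ t + U t) , (λ t → ι a * V₁ t + V t) ,
        ℚ[x].Low-+ (ℚ[x].Low-scale a u₁) (ℚ[x].Low-weaken ℕ.pred[n]≤n u) ,
        ℚ[x].Low-+ (ℚ[x].Low-scale a v₁) (ℚ[x].Low-suc v) ,
        λ {z} {z′} zz′≈1 → begin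
          z′ ^ suc d * (ι a + z * low (Vec.map ι f) z)
            ≈⟨ solve 5 (λ z z′ w a l → z′ :* w :* (a :+ z :* l)
                 := a :* (z′ :* w) :+ z :* z′ :* (w :* l)) refl z z′ (z′ ^ d) (ι a) (low (Vec.map ι f) z) ⟩
          ι a * z′ ^ suc d + z * z′ * (z′ ^ d * low (Vec.map ι f) z)
            ≈⟨ +-cong (*-congˡ (h₁ zz′≈1)) (trans (*-congʳ zz′≈1) (trans (*-identityˡ _) (h zz′≈1))) ⟩
          ι a * (V₁ (z + z′) * z′ - U₁ (z + z′)) + (V (z + z′) * z′ - U (z + z′))
            ≈⟨ solve 6 (λ a v₁ z u₁ v u → a :* (v₁ :* z :- u₁) :+ (v :* z :- u)
                 := (a :* v₁ :+ v) :* z :- (a :* u₁ :+ u)) refl _ _ _ _ _ _ ⟩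
          (ι a * V₁ (z + z′) + V (z + z′)) * z′ - (ι a * U₁ (z + z′) + U (z + z′)) ∎

      -- Multiplication by z uses z = t - z⁻¹ on U and z z⁻¹ = 1 on V. So the new U is t U up to
      -- lower terms, hence monic, and the new V is the old U.
      highPart : ∀ {d} (f : Vec ℚ d) → ∃[ U ] ∃[ V ] ℚ[x].Monic d U × ℚ[x].Low d V ×
        (∀ {z z′} → Inverse z z′ → monic (Vec.map ι f) z ≈ U (z + z′) - V (z + z′) * z′)
      highPart [] = (λ _ → 1#) , (λ _ → 0#) , ℚ[x].Monic-1 , ℚ[x].Low-0 ,
        λ {z} {z′} _ → solve 1 (λ z → :1 := :1 :- :0 :* z) refl z′
      highPart (a ∷ f) =
        let U , V , u , v , h = highPart f in
        (λ t → t * U t + (ι a - V t)) , U ,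
        ℚ[x].Monic-+ (ℚ[x].Monic-X u) (ℚ[x].Low-- (ℚ[x].Low-const a) (ℚ[x].Low-suc v)) ,
        ℚ[x].weakenMonic u ,
        λ {z} {z′} zz′≈1 → begin
          ι a + z * monic (Vec.map ι f) z
            ≈⟨ +-congˡ (*-congˡ (h zz′≈1)) ⟩
          ι a + z * (U (z + z′) - V (z + z′) * z′)
            ≈⟨ solve 5 (λ z z′ a u v → a :+ z :* (u :- v :* z′)
                 := (z :+ z′) :* u :+ (a :- z :* z′ :* v) :- u :* z′) refl z z′ (ι a) _ _ ⟩
          (z + z′) * U (z + z′) + (ι a - z * z′ * V (z + z′)) - U (z + z′) * z′
            ≈⟨ +-congʳ (+-congˡ (+-congˡ (-‿cong (trans (*-congʳ zz′≈1) (*-identityˡ _))))) ⟩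
          (z + z′) * U (z + z′) + (ι a - V (z + z′)) - U (z + z′) * z′ ∎

      splitMonic : ∀ m {n} (f : Vec ℚ (m ℕ.+ n)) → Σ[ f₀ ∈ Vec ℚ m ] Σ[ f₁ ∈ Vec ℚ n ]
        (∀ x → monic (Vec.map ι f) x ≈ low (Vec.map ι f₀) x + x ^ m * monic (Vec.map ι f₁) x)
      splitMonic zero f = [] , f , λ x → solve 1 (λ f → f := :0 :+ :1 :* f) refl _
      splitMonic (suc m) (a ∷ f) =
        let f₀ , f₁ , h = splitMonic m f in
        a ∷ f₀ , f₁ , λ x → trans (+-congˡ (*-congˡ (h x)))
          (solve 5 (λ a x l u g → a :+ x :* (l :+ u :* g) := a :+ x :* l :+ x :* u :* g)
            refl (ι a) x _ (x ^ m) _)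

      inverse-^ : ∀ {z z′} → Inverse z z′ → ∀ n → z′ ^ n * z ^ n ≈ 1#
      inverse-^ zz′≈1 zero = *-identityʳ 1#
      inverse-^ {z} {z′} zz′≈1 (suc n) = trans
        (solve 4 (λ z z′ u u′ → z′ :* u′ :* (z :* u) := z :* z′ :* (u′ :* u)) refl z z′ (z ^ n) (z′ ^ n))
        (trans (*-cong zz′≈1 (inverse-^ zz′≈1 n)) (*-identityʳ 1#))

    -- Division by z^(k+1) spreads the 2k + 2 coefficients over the exponents -k - 1 to k. The top
    -- term z^k makes U monic of degree k, while V has degree at most k.
    balance : ∀ k (f : Vec ℚ (suc k ℕ.+ k)) → ∃[ U ] ∃[ V ] ℚ[x].Monic k U × ℚ[x].Low (suc k) V ×
      (∀ {z z′} → z * z′ ≈ 1# →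
        z′ ^ suc k * monic (Vec.map ι f) z ≈ U (z + z′) + V (z + z′) * z′)
    balance k f =
      let f₀ , f₁ , e = splitMonic (suc k) f
          U₀ , V₀ , u₀ , v₀ , h₀ = lowPart f₀
          U₁ , V₁ , u₁ , v₁ , h₁ = highPart f₁ in
      (λ t → U₁ t - U₀ t) , (λ t → V₀ t - V₁ t) ,
      ℚ[x].Monic-- u₁ u₀ , ℚ[x].Low-- v₀ (ℚ[x].Low-suc v₁) ,
      λ {z} {z′} zz′≈1 → begin
        z′ ^ suc k * monic (Vec.map ι f) z
          ≈⟨ *-congˡ (e z) ⟩
        z′ ^ suc k * (low (Vec.map ι f₀) z + z ^ suc k * monic (Vec.map ι f₁) z)
          ≈⟨ trans (distribˡ _ _ _) (+-congˡ (sym (*-assoc _ _ _))) ⟩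
        z′ ^ suc k * low (Vec.map ι f₀) z + z′ ^ suc k * z ^ suc k * monic (Vec.map ι f₁) z
          ≈⟨ +-cong (h₀ zz′≈1) (trans (*-congʳ (inverse-^ zz′≈1 (suc k))) (trans (*-identityˡ _) (h₁ zz′≈1))) ⟩
        V₀ (z + z′) * z′ - U₀ (z + z′) + (U₁ (z + z′) - V₁ (z + z′) * z′)
          ≈⟨ solve 5 (λ u₀ u₁ v₀ v₁ z → v₀ :* z :- u₀ :+ (u₁ :- v₁ :* z)
               := u₁ :- u₀ :+ (v₀ :- v₁) :* z) refl _ _ _ _ _ ⟩
        U₁ (z + z′) - U₀ (z + z′) + (V₀ (z + z′) - V₁ (z + z′)) * z′ ∎

    -- F is a monic integer polynomial with F(a) = −1, all of whose roots but β
    -- lie in an interval at a distance of at least 2 from a.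
    module Trace
      {h} {F : Carrier → Carrier} (F-monic : ℤ[x].Monic h F)
      {i} (Interval : Carrier → Set i) (a : ℤ)
      (far : ∀ b bs → All Interval (b ∷ bs) → ∀ r → ∏[x- b ∷ bs ] (ι (fromℤ a)) ≈ ι r → 1ℚ ℚ.< r)
      (F-a : F (ι (fromℤ a)) ≈ - 1#)
      (β : Carrier) (bs : List Carrier) (interval : All Interval bs)
      (distinct : Distinct (β ∷ bs)) (F-roots : All (λ b → F b ≈ 0#) (β ∷ bs))
      (F-length : length (β ∷ bs) ≡ h)
      where

      private
        Root : ∀ {d} → Vec ℚ d → Carrier → Set ℓ
        Root f x = monic (Vec.map ι f) x ≈ 0#

        value : ∀ {d} → Vec ℚ d → ℚ
        value f = ℚP.monic f (fromℤ a)

        integral-root : ∀ {x} → F x ≈ 0# → IsIntegral x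
        integral-root Fx≈0 = let f , e = F-monic in _ , f , trans (e _) Fx≈0

        -- The value of f at a is rational and a product of algebraic integers a - b, hence an
        -- integer. The list must contain as many roots as the degree, so that the product is all of
        -- f(a).
        integral-value : ∀ {d} (f : Vec ℚ d) cs → length cs ≡ d → Distinct cs →
                         All (λ b → F b ≈ 0#) cs → All (Root f) cs →
                         ∏[x- cs ] (ι (fromℤ a)) ≈ ι (value f) × ∃[ z ] value f ≡ fromℤ z
        integral-value f cs len distinct F-roots roots =
          let product = trans (sym (allRoots (Vec.map ι f) cs distinct roots len _)) (monic-ι f (fromℤ a)) in
          product , integralRational′ (integral-≈ product
            (integral-∏ cs (integral-ι a) (All.map integral-root F-roots)))

        units : ∀ {z w} → 1ℚ ℚ.< fromℤ z → ¬ fromℤ w ℚ.* fromℤ z ≡ ℚ.- 1ℚ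
        units {z} {w} 1<z wz≡-1 = ℕ.<-irrefl (≡.sym ∣z∣≡1) (big z 1<z)
          where
          ∣z∣≡1 : ℤ.∣ z ∣ ≡ 1
          ∣z∣≡1 = ℕ.m*n≡1⇒n≡1 ℤ.∣ w ∣ ℤ.∣ z ∣ (≡.trans (≡.sym (ℤ.abs-* w z))
            (≡.cong ℤ.∣_∣ (fromℤ-injective {w ℤ.* z} {ℤ.- + 1} (≡.trans (fromℤ-* w z) wz≡-1))))
          big : ∀ z → 1ℚ ℚ.< fromℤ z → 1 ℕ.< ℤ.∣ z ∣
          big z 1<z with z ℤ.≤? + 1
          ... | yes z≤1 = contradiction (ℚ.<-≤-trans 1<z (fromℤ-mono z≤1)) (ℚ.<-irrefl ≡.refl)
          big (+ n) 1<z    | no n≰1 = ℕ.≰⇒> λ n≤1 → n≰1 (ℤ.+≤+ n≤1)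
          big (ℤ.-[1+ n ]) 1<z | no n≰1 = contradiction ℤ.-≤+ n≰1

        -- F = f g, where the root β belongs to f.
        noFactorization : ∀ {d e} (f : Vec ℚ d) (g : Vec ℚ e) → d ℕ.+ e ≡ h → 0 ℕ.< e →
          ι (value f) * ι (value g) ≈ - 1# →
          ∀ {fs gs} → Split bs fs gs → Root f β → All (Root f) fs → ¬ All (Root g) gs
        noFactorization {d} {e} f g d+e≡h 0<e fg≈-1 {fs} {gs} s fβ≈0 f-fs g-gs =
          positive gs gs-interval ∣gs∣≡e gs-value
          where
          β∉bs = AllPairs.head distinct
          distinct-bs = AllPairs.tail distinct
          F-bs = All.tail F-roots
          F-β = All.head F-roots
          distinct-fs = proj₁ (Split-All s β∉bs) ∷ proj₁ (Split-AllPairs s distinct-bs)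
          distinct-gs = proj₂ (Split-AllPairs s distinct-bs)
          gs-interval = proj₂ (Split-All s interval)

          ∣fs∣≤d : length (β ∷ fs) ℕ.≤ d
          ∣fs∣≤d = length-roots (Vec.map ι f) (β ∷ fs) distinct-fs (fβ≈0 ∷ f-fs)
          ∣gs∣≤e : length gs ℕ.≤ e
          ∣gs∣≤e = length-roots (Vec.map ι g) gs distinct-gs g-gs
          total : length (β ∷ fs) ℕ.+ length gs ≡ d ℕ.+ e
          total = ≡.trans (≡.cong suc (Split-length s)) (≡.trans F-length (≡.sym d+e≡h))

          -- There are d + e roots in total and no factor has more roots than its degree, so both
          -- bounds are attained.
          ∣gs∣≡e : length gs ≡ e
          ∣gs∣≡e = ℕ.≤-antisym ∣gs∣≤e (ℕ.+-cancelˡ-≤ d e (length gs)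
            (ℕ.≤-trans (ℕ.≤-reflexive (≡.sym total)) (ℕ.+-monoˡ-≤ (length gs) ∣fs∣≤d)))
          ∣fs∣≡d : length (β ∷ fs) ≡ d
          ∣fs∣≡d = ℕ.+-cancelʳ-≡ e (length (β ∷ fs)) d
            (≡.trans (≡.cong (length (β ∷ fs) ℕ.+_) (≡.sym ∣gs∣≡e)) total)

          f-value = integral-value f (β ∷ fs) ∣fs∣≡d distinct-fs
            (F-β ∷ proj₁ (Split-All s F-bs)) (fβ≈0 ∷ f-fs)
          gs-value = integral-value g gs ∣gs∣≡e distinct-gs (proj₂ (Split-All s F-bs)) g-gs

          -- As e > 0 the list is not empty, so `far` gives g(a) > 1, while the integers f(a) and
          -- g(a) have product -1.
          positive : ∀ gs → All Interval gs → length gs ≡ e →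
                     ¬ (∏[x- gs ] (ι (fromℤ a)) ≈ ι (value g) × ∃[ z ] value g ≡ fromℤ z)
          positive [] _ 0≡e _ = ℕ.<-irrefl 0≡e 0<e
          positive (b ∷ gs) bs∈ _ (product , z , g≡z) =
            let _ , w , f≡w = f-value in
            units {z} {w} (≡.subst (1ℚ ℚ.<_) g≡z (far b gs bs∈ (value g) product))
              (ι-injective (begin
                ι (fromℤ w ℚ.* fromℤ z)       ≡⟨ ≡.cong₂ (λ p q → ι (p ℚ.* q)) f≡w g≡z ⟨
                ι (value f ℚ.* value g)       ≈⟨ *-homo _ _ ⟩
                ι (value f) * ι (value g)     ≈⟨ fg≈-1 ⟩
                - 1#                          ≈⟨ -‿cong 1#-homo ⟨
                - ι 1ℚ                        ≈⟨ -‿homo 1ℚ ⟨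
                ι (ℚ.- 1ℚ)                    ∎))

        -- Which factor vanishes at a root is known only under double negation. For a finite list
        -- all these choices fit into one double negation, which is enough to derive a
        -- contradiction.
        splitting : ∀ {p q} {P : Carrier → Set p} {Q : Carrier → Set q} cs →
                    All (λ b → ¬ ¬ (P b ⊎ Q b)) cs →
                    ¬ ¬ (∃[ fs ] ∃[ gs ] Split cs fs gs × All P fs × All Q gs)
        splitting []       []       k = k (_ , _ , [] , [] , [])
        splitting (b ∷ cs) (h ∷ hs) k = h λ
          { (inj₁ p) → splitting cs hs λ (fs , gs , s , ps , qs) → k (b ∷ fs , gs , left s , p ∷ ps , qs)
          ; (inj₂ q) → splitting cs hs λ (fs , gs , s , ps , qs) → k (fs , b ∷ gs , right s , ps , q ∷ qs) }

        Split-swap : ∀ {xs ys zs : List Carrier} → Split xs ys zs → Split xs zs ys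
        Split-swap []        = []
        Split-swap (left s)  = right (Split-swap s)
        Split-swap (right s) = left (Split-swap s)

        either : ∀ {x y} → x * y ≈ 0# → ¬ ¬ (x ≈ 0# ⊎ y ≈ 0#)
        either xy≈0 k = k (inj₂ (domain xy≈0 λ x≈0 → k (inj₁ x≈0)))

        reducible : ∀ {d e} (f : Vec ℚ d) (g : Vec ℚ e) → d ℕ.+ e ≡ h → 0 ℕ.< d → 0 ℕ.< e →
                    ¬ (∀ x → F x ≈ monic (Vec.map ι f) x * monic (Vec.map ι g) x)
        reducible {d} {e} f g d+e≡h 0<d 0<e F≈fg =
          splitting (β ∷ bs) (All.map (λ Fb≈0 → either (trans (sym (F≈fg _)) Fb≈0)) F-roots) λ
            { (_ , _ , left s , fβ ∷ f-fs , g-gs) →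
                noFactorization f g d+e≡h 0<e fg≈-1 s fβ f-fs g-gs
            ; (_ , _ , right s , f-fs , gβ ∷ g-gs) →
                noFactorization g f (≡.trans (ℕ.+-comm e d) d+e≡h) 0<d
                  (trans (*-comm _ _) fg≈-1) (Split-swap s) gβ g-gs f-fs }
          where
          fg≈-1 : ι (value f) * ι (value g) ≈ - 1#
          fg≈-1 = trans (*-cong (sym (monic-ι f _)) (sym (monic-ι g _))) (trans (sym (F≈fg _)) F-a)

        Irreducible : ℕ → Set _
        Irreducible n = ∀ {d} (f : Vec ℚ d) {b} → F b ≈ 0# → d ℕ.< n → d ℕ.< h → ¬ Root f b

        cancel-ι : ∀ {l x} → ¬ ι l ≈ 0# → ι l * x ≈ 0# → x ≈ 0#
        cancel-ι l≉0 lx≈0 = domain lx≈0 l≉0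

        -- Euclidean descent: dividing F by f leaves either no remainder, a factorization excluded
        -- by `reducible`, or a nonzero remainder of smaller degree that still vanishes at b. The
        -- bound n carries the recursion.
        irreducible-below : ∀ n → Irreducible n
        irreducible-below (suc n) [] _ _ _ 1≈0 = 1≉0 1≈0
        irreducible-below (suc n) {suc d} f {b} Fb≈0 (s≤s d<n) d<h fb≈0 with
          ℚ[x].division (ℕ.<⇒≤ d<h) (toRational F-monic) (f , λ x → refl)
        ... | Q , S , (g , g≈Q) , (r , r≈S) , F≈ with normalise r
        ...   | inj₁ r≈0 = reducible f g (ℕ.m+[n∸m]≡n (ℕ.<⇒≤ d<h)) (s≤s z≤n) (ℕ.m<n⇒0<n∸m d<h) λ x → begin
          F x                                                   ≈⟨ F≈ x ⟩
          monic (Vec.map ι f) x * Q x + S x                     ≈⟨ +-cong (*-congˡ (sym (g≈Q x))) (trans (sym (r≈S x)) (r≈0 x)) ⟩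
          monic (Vec.map ι f) x * monic (Vec.map ι g) x + 0#    ≈⟨ +-identityʳ _ ⟩
          monic (Vec.map ι f) x * monic (Vec.map ι g) x         ∎
        ...   | inj₂ (e , e<d , r′ , l , l≉0 , r≈lr′) =
          irreducible-below n r′ Fb≈0 (ℕ.<-≤-trans e<d d<n) (ℕ.<-trans e<d d<h)
            (cancel-ι l≉0 (begin
              ι l * monic (Vec.map ι r′) b                 ≈⟨ r≈lr′ b ⟨
              low (Vec.map ι r) b                          ≈⟨ r≈S b ⟩
              S b                                          ≈⟨ +-identityˡ _ ⟨
              0# + S b                                     ≈⟨ +-congʳ (trans (*-congʳ fb≈0) (zeroˡ _)) ⟨
              monic (Vec.map ι f) b * Q b + S b            ≈⟨ F≈ b ⟨
              F b                                          ≈⟨ Fb≈0 ⟩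
              0#                                           ∎))

      irreducible : ∀ {d} (f : Vec ℚ d) {b} → F b ≈ 0# → d ℕ.< h → ¬ Root f b
      irreducible f Fb≈0 d<h = irreducible-below _ f Fb≈0 ℕ.≤-refl d<h

      -- G is zero or divisible by F: otherwise G itself or its remainder modulo F would be a
      -- nonzero polynomial of degree below h with the root b of F, against `irreducible`.
      sharedRoots : ∀ {d G} → ℚ[x].Low d G → ∀ {b b′} → F b ≈ 0# → F b′ ≈ 0# → G b ≈ 0# → G b′ ≈ 0#
      sharedRoots {d} {G} (g , g≈G) {b} {b′} Fb≈0 Fb′≈0 Gb≈0 with normalise g
      ... | inj₁ g≈0 = trans (sym (g≈G b′)) (g≈0 b′)
      ... | inj₂ (e , _ , f , l , l≉0 , g≈lf) with h ℕ.≤? e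
      ...   | no h≰e = ⊥-elim (irreducible f Fb≈0 (ℕ.≰⇒> h≰e)
        (cancel-ι l≉0 (trans (sym (g≈lf b)) (trans (g≈G b) Gb≈0))))
      ...   | yes h≤e with ℚ[x].division h≤e (f , λ x → refl) (toRational F-monic)
      ...     | Q , S , _ , (r , r≈S) , f≈ with normalise r
      ...       | inj₁ r≈0 = begin
        G b′                                  ≈⟨ g≈G b′ ⟨
        low (Vec.map ι g) b′                  ≈⟨ g≈lf b′ ⟩
        ι l * monic (Vec.map ι f) b′          ≈⟨ *-congˡ (f≈ b′) ⟩
        ι l * (F b′ * Q b′ + S b′)            ≈⟨ *-congˡ (+-cong (*-congʳ Fb′≈0) (trans (sym (r≈S b′)) (r≈0 b′))) ⟩
        ι l * (0# * Q b′ + 0#)                ≈⟨ solve 2 (λ l q → l :* (:0 :* q :+ :0) := :0) refl (ι l) (Q b′) ⟩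
        0#                                    ∎
      ...       | inj₂ (e′ , e′<h , r′ , l′ , l′≉0 , r≈l′r′) = ⊥-elim (irreducible r′ Fb≈0 e′<h
        (cancel-ι l′≉0 (begin
          ι l′ * monic (Vec.map ι r′) b       ≈⟨ r≈l′r′ b ⟨
          low (Vec.map ι r) b                 ≈⟨ r≈S b ⟩
          S b                                 ≈⟨ solve 2 (λ s q → s := :0 :* q :+ s) refl (S b) (Q b) ⟩
          0# * Q b + S b                      ≈⟨ +-congʳ (*-congʳ Fb≈0) ⟨
          F b * Q b + S b                     ≈⟨ f≈ b ⟨
          monic (Vec.map ι f) b               ≈⟨ cancel-ι l≉0 (trans (sym (g≈lf b)) (trans (g≈G b) Gb≈0)) ⟩
          0#                                  ∎)))

      -- If U(t) + V(t) z⁻¹ vanishes at α then so does its norm U² + U V t + V² at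
      -- every root of F; at the root b this forces U(b) = 0.
      degree-bound : ∀ {k} → h ≡ suc k → ∀ {α α′ b} → α * α′ ≈ 1# → F (α + α′) ≈ 0# → F b ≈ 0# →
        (∀ {d e U V} → ℚ[x].Monic d U → ℚ[x].Low e V →
          U b * U b + U b * V b * b + V b * V b ≈ 0# → U b ≈ 0#) →
        ∀ {e} (g : Vec ℚ e) → monic (Vec.map ι g) α ≈ 0# → h ℕ.+ h ℕ.≤ e
      degree-bound {k} h≡1+k {α} {α′} {b} αα′≈1 Fβ≈0 Fb≈0 definite {e} g gα≈0 with h ℕ.+ h ℕ.≤? e
      ... | yes h+h≤e = h+h≤e
      ... | no h+h≰e  = ⊥-elim (irreducible (proj₁ u) Fb≈0 (ℕ.≤-reflexive (≡.sym h≡1+k))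
        (trans (proj₂ u b) (definite u v norm-b≈0)))
        where
        e≤ : e ℕ.≤ suc k ℕ.+ k
        e≤ = ℕ.≤-pred (≡.subst (suc e ℕ.≤_)
          (≡.trans (≡.cong (λ n → n ℕ.+ n) h≡1+k) (ℕ.+-suc (suc k) k)) (ℕ.≰⇒> h+h≰e))

        -- `balance` asks for the exact degree 2k + 1; a power of x raises the degree of g to it and
        -- keeps the root α.
        padded : ℚ[x].Monic (suc k ℕ.+ k) (λ x → x ^ (suc k ℕ.+ k ℕ.∸ e) * monic (Vec.map ι g) x)
        padded = ≡.subst (λ n → ℚ[x].Monic n (λ x → x ^ (suc k ℕ.+ k ℕ.∸ e) * monic (Vec.map ι g) x)) (ℕ.m∸n+n≡m e≤)
          (ℚ[x].Monic-* (ℚ[x].Monic-X^ (suc k ℕ.+ k ℕ.∸ e)) (g , λ x → refl))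

        balanced = balance k (proj₁ padded)
        U = proj₁ balanced
        V = proj₁ (proj₂ balanced)
        u = proj₁ (proj₂ (proj₂ balanced))
        v = proj₁ (proj₂ (proj₂ (proj₂ balanced)))

        β′ : Carrier
        β′ = α + α′

        vanishes : U β′ + V β′ * α′ ≈ 0#
        vanishes = begin
          U β′ + V β′ * α′
            ≈⟨ proj₂ (proj₂ (proj₂ (proj₂ balanced))) αα′≈1 ⟨
          α′ ^ suc k * monic (Vec.map ι (proj₁ padded)) α
            ≈⟨ *-congˡ (trans (proj₂ padded α) (trans (*-congˡ gα≈0) (zeroʳ _))) ⟩
          α′ ^ suc k * 0#
            ≈⟨ zeroʳ _ ⟩
          0# ∎

        u-low : ℚ[x].Low (suc k) U
        u-low = ℚ[x].weakenMonic u

        v-low : ℚ[x].Low (suc k) V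
        v-low = v

        n : ℕ
        n = suc k ℕ.+ suc k

        norm : ℚ[x].Low (suc n) (λ t → U t * U t + t * (U t * V t) + V t * V t)
        norm = ℚ[x].Low-+ (ℚ[x].Low-+ (ℚ[x].Low-suc (ℚ[x].Low-* u-low u-low))
            (ℚ[x].Low-X (ℚ[x].Low-* u-low v-low)))
          (ℚ[x].Low-suc (ℚ[x].Low-* v-low v-low))

        norm-β≈0 : U β′ * U β′ + β′ * (U β′ * V β′) + V β′ * V β′ ≈ 0#
        norm-β≈0 = begin
          U β′ * U β′ + β′ * (U β′ * V β′) + V β′ * V β′
            ≈⟨ +-congˡ (trans (sym (*-identityˡ _)) (*-congʳ (sym αα′≈1))) ⟩
          U β′ * U β′ + (α + α′) * (U β′ * V β′) + α * α′ * (V β′ * V β′)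
            ≈⟨ solve 4 (λ u v a a′ → u :* u :+ (a :+ a′) :* (u :* v) :+ a :* a′ :* (v :* v)
                 := (u :+ v :* a′) :* (u :+ v :* a)) refl (U β′) (V β′) α α′ ⟩
          (U β′ + V β′ * α′) * (U β′ + V β′ * α)
            ≈⟨ trans (*-congʳ vanishes) (zeroˡ _) ⟩
          0# ∎

        norm-b≈0 : U b * U b + U b * V b * b + V b * V b ≈ 0#
        norm-b≈0 = trans (+-congʳ (+-congˡ (*-comm _ _))) (sharedRoots norm Fβ≈0 Fb≈0 norm-β≈0)

-- Transport along homomorphisms, degrees, and units from the equation f(z) = 0.

module SalemPolynomials where

  open import Algebra.Bundles using (CommutativeRing; RawRing; Semiring)
  open import Algebra.Morphism.Structures using (IsRingHomomorphism)
  open import Data.Nat.Base as ℕ using (ℕ; zero; suc; z≤n; s≤s)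
  import Data.Nat.Properties as ℕ
  open import Data.Product.Base using (Σ-syntax; _,_)
  open import Data.Vec.Base as Vec using (Vec; _∷_)
  open import Function.Base using (id)
  open import Relation.Binary.PropositionalEquality as ≡ using (_≡_)
  open import Relation.Nullary.Negation using (¬_)

  module Homomorphism
    {c ℓ c′ ℓ′} (R : CommutativeRing c ℓ) (R′ : CommutativeRing c′ ℓ′)
    {φ : CommutativeRing.Carrier R → CommutativeRing.Carrier R′}
    (φ-hom : IsRingHomomorphism (CommutativeRing.rawRing R) (CommutativeRing.rawRing R′) φ)
    where

    private
      module R = Chebyshev R
      module R′ = Chebyshev R′
      module +R = CommutativeRing R

    open CommutativeRing R′
    open IsRingHomomorphism φ-hom
    open import Algebra.Definitions.RawSemiring (Semiring.rawSemiring (CommutativeRing.semiring R))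
      using () renaming (_^_ to _^R_)
    open import Algebra.Definitions.RawSemiring (Semiring.rawSemiring semiring) using (_^_)

    φ-- : ∀ x y → φ (x +R.- y) ≈ φ x - φ y
    φ-- x y = trans (+-homo x (+R.- y)) (+-congˡ (-‿homo y))

    φ-2 : φ (+R.1# +R.+ +R.1#) ≈ 1# + 1#
    φ-2 = trans (+-homo _ _) (+-cong 1#-homo 1#-homo)

    φ-C : ∀ x n → φ (R.C x n) ≈ R′.C (φ x) n
    φ-C x zero          = φ-2
    φ-C x (suc zero)    = refl
    φ-C x (suc (suc n)) = trans (φ-- _ _)
      (+-cong (trans (*-homo x _) (*-congˡ (φ-C x (suc n)))) (-‿cong (φ-C x n)))

    φ-trace : ∀ k a x → φ (R.trace k a x) ≈ R′.trace k (φ a) (φ x)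
    φ-trace k a x = trans (φ-- _ _) (+-cong
      (trans (*-homo _ _) (*-cong (φ-- x a)
        (trans (φ-- _ _) (+-cong (trans (φ-- _ x) (+-congʳ
          (trans (+-homo _ _) (+-cong (φ-C x (suc k)) (φ-C x k))))) (-‿cong φ-2)))))
      (-‿cong 1#-homo))

    φ-^ : ∀ x n → φ (x ^R n) ≈ φ x ^ n
    φ-^ x zero    = 1#-homo
    φ-^ x (suc n) = trans (*-homo x _) (*-congˡ (φ-^ x n))

    φ-salem : ∀ k a x → φ (R.salem k a x) ≈ R′.salem k (φ a) (φ x)
    φ-salem k a x = trans (φ-- _ _) (+-cong
      (trans (*-homo _ _) (*-cong (trans (*-homo _ _) (*-cong (trans (*-homo _ _) (*-cong
        (trans (+-homo _ _) (+-cong (trans (φ-- _ _) (+-cong (*-homo x x) (-‿cong (*-homo a x)))) 1#-homo))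
        (trans (+-homo _ _) (+-congˡ 1#-homo))))
        (minus-1 k))) (minus-1 (suc k))))
      (-‿cong (φ-^ x (suc (suc k)))))
      where
      minus-1 : ∀ n → φ (x ^R n +R.- +R.1#) ≈ φ x ^ n - 1#
      minus-1 n = trans (φ-- _ _) (+-cong (φ-^ x n) (-‿cong 1#-homo))

  module Monicity
    {c ℓ k ℓ′} (R : CommutativeRing c ℓ)
    (K : RawRing k ℓ′) (ι : RawRing.Carrier K → CommutativeRing.Carrier R)
    (ι-hom : IsRingHomomorphism K (CommutativeRing.rawRing R) ι)
    where

    open CommutativeRing R hiding (zero)
    open IntegerCoefficients R hiding (⟦_⟧)
    open Chebyshev R
    open Polynomials R
    open WithCoefficients K ι ι-hom {P = Carrier} id
    open IsRingHomomorphism ι-hom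
    open import Algebra.Definitions.RawSemiring (Semiring.rawSemiring semiring) using (_^_)
    open import Relation.Binary.Reasoning.Setoid setoid

    private
      module K = RawRing K

      Low-1 : ∀ {d} → Low (suc d) (λ _ → 1#)
      Low-1 = Low-≈ (λ _ → 1#-homo) (Low-const K.1#)

      Monic-id : Monic 1 id
      Monic-id = Monic-≈ *-identityʳ (Monic-X Monic-1)

      Low-id : ∀ {d} → Low (suc (suc d)) id
      Low-id = Low-weaken (s≤s (s≤s z≤n)) (weakenMonic Monic-id)

    C-monic : ∀ n → Monic (suc n) (λ x → C x (suc n))
    C-monic zero          = Monic-id
    C-monic (suc zero)    = Monic-- (Monic-X Monic-id) (Low-+ Low-1 Low-1)
    C-monic (suc (suc n)) = Monic-- (Monic-X (C-monic (suc n))) (Low-suc (weakenMonic (C-monic n)))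

    D-monic : ∀ k → Monic (suc (suc k)) (D (suc k))
    D-monic k = Monic-- (Monic-- (Monic-+ (C-monic (suc k)) (weakenMonic (C-monic k))) Low-id)
      (Low-+ Low-1 Low-1)

    trace-monic : ∀ k a → Monic (suc (suc (suc k))) (trace (suc k) (ι a))
    trace-monic k a = Monic-- (Monic-* (Monic-- Monic-id (Low-const a)) (D-monic k)) Low-1

    salem-monic : ∀ k a → Monic (suc (suc (suc k)) ℕ.+ suc (suc (suc k))) (salem (suc k) (ι a))
    salem-monic k a = Monic--
      (≡.subst (λ n → Monic n λ z →
          (z * z - ι a * z + 1#) * (z + 1#) * (z ^ suc k - 1#) * (z ^ suc (suc k) - 1#)) degree
        (Monic-* (Monic-* (Monic-* square (Monic-+ Monic-id Low-1))
          (Monic-- (Monic-X^ (suc k)) Low-1)) (Monic-- (Monic-X^ (suc (suc k))) Low-1)))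
      (Low-weaken
        (s≤s (s≤s (s≤s (ℕ.≤-trans (ℕ.n≤1+n (suc k)) (ℕ.≤-trans (ℕ.n≤1+n _) (ℕ.m≤n+m _ k))))))
        (weakenMonic (Monic-X^ (suc (suc (suc k))))))
      where
      square : Monic 2 (λ z → z * z - ι a * z + 1#)
      square = Monic-+ (Monic-- (Monic-X Monic-id) (Low-scale a Low-id)) Low-1

      degree : 2 ℕ.+ 1 ℕ.+ suc k ℕ.+ suc (suc k) ≡ suc (suc (suc k)) ℕ.+ suc (suc (suc k))
      degree = ≡.cong (λ n → suc (suc (suc n))) (≡.sym (ℕ.+-suc k (suc (suc k))))

    -- The constant coefficient of salem is 1, so its roots are units.
    salem-at-0 : ∀ k a → salem (suc k) a 0# ≈ 1#
    salem-at-0 k a = solve 3 (λ a u v → (:0 :* :0 :- a :* :0 :+ :1) :* (:0 :+ :1) :* (:0 :* u :- :1)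
        :* (:0 :* (:0 :* u) :- :1) :- :0 :* v := :1) refl a (0# ^ k) (0# ^ suc (suc k))

    -- F(w) = b + w g(w) with b = F(0) = 1, so at a root w the inverse is -g(w).
    rootInverse : ∀ {d F} → Monic (suc d) F → F 0# ≈ 1# →
      Σ[ g ∈ Vec K.Carrier d ] ∀ w → F w ≈ 0# → w * - monic (Vec.map ι g) w ≈ 1#
    rootInverse {F = F} (b ∷ g , h) F0≈1 = g , λ w Fw≈0 → begin
      w * - m w                        ≈⟨ solve 3 (λ b w m → w :* :- m := b :- (b :+ w :* m)) refl (ι b) w (m w) ⟩
      ι b - (ι b + w * m w)            ≈⟨ +-cong b≈1 (-‿cong (trans (h w) Fw≈0)) ⟩
      1# - 0#                          ≈⟨ solve 0 (:1 :- :0 := :1) refl ⟩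
      1#                               ∎
      where
      m : Carrier → Carrier
      m = monic (Vec.map ι g)
      b≈1 : ι b ≈ 1#
      b≈1 = begin
        ι b                     ≈⟨ solve 2 (λ b m → b := b :+ :0 :* m) refl (ι b) (m 0#) ⟩
        ι b + 0# * m 0#         ≈⟨ h 0# ⟩
        F 0#                    ≈⟨ F0≈1 ⟩
        1#                      ∎

  module Roots {c ℓ} (R : CommutativeRing c ℓ) where

    open CommutativeRing R hiding (zero)
    open IntegerCoefficients R
    open Chebyshev R
    open import Algebra.Definitions.RawSemiring (Semiring.rawSemiring semiring) using (_^_)
    open import Algebra.Properties.Semiring.Exp semiring using (^-assocʳ)
    open import Relation.Binary.Reasoning.Setoid setoid

    salem⇒trace : ∀ k a {z z′} → z * z′ ≈ 1# → salem k a z ≈ 0# → trace k a (z + z′) ≈ 0#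
    salem⇒trace k a {z} {z′} zz′≈1 fz≈0 = begin
      trace k a (z + z′)
        ≈⟨ trans (sym (*-identityˡ _)) (*-congʳ (sym (^-inverse (trans (*-comm z′ z) zz′≈1) h))) ⟩
      z′ ^ h * z ^ h * trace k a (z + z′)
        ≈⟨ *-assoc _ _ _ ⟩
      z′ ^ h * (z ^ h * trace k a (z + z′))
        ≈⟨ *-congˡ (trans (sym (salem-trace k a zz′≈1)) fz≈0) ⟩
      z′ ^ h * 0#
        ≈⟨ zeroʳ _ ⟩
      0# ∎
      where h = suc (suc k)

    trace⇒salem : ∀ k a {z z′} → z * z′ ≈ 1# → trace k a (z + z′) ≈ 0# → salem k a z ≈ 0#
    trace⇒salem k a zz′≈1 Fz≈0 = trans (salem-trace k a zz′≈1) (trans (*-congˡ Fz≈0) (zeroʳ _))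

    trace-at-a : ∀ k a → trace k a a ≈ - 1#
    trace-at-a k a = solve 2 (λ a d → (a :- a) :* d :- :1 := :- :1) refl a (D k a)

    -- A common root of the polynomials with parameters a and b would be a root of D.
    trace-injective : ∀ k {a b t} → trace k a t ≈ 0# → trace k b t ≈ 0# →
                      (∀ {x y} → x * y ≈ 0# → ¬ x ≈ 0# → y ≈ 0#) → ¬ a - b ≈ 0# → 1# ≈ 0#
    trace-injective k {a} {b} {t} h h′ domain a≉b = begin
      1#                              ≈⟨ solve 2 (λ p d → :1 := p :* d :- (p :* d :- :1)) refl (t - a) d ⟩
      (t - a) * d - trace k a t       ≈⟨ +-cong (*-congˡ d≈0) (-‿cong h) ⟩
      (t - a) * 0# - 0#               ≈⟨ solve 1 (λ p → p :* :0 :- :0 := :0) refl (t - a) ⟩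
      0#                              ∎
      where
      d = D k t
      d≈0 : d ≈ 0#
      d≈0 = domain (begin
        (a - b) * d                   ≈⟨ solve 4 (λ a b t d → (a :- b) :* d
                                           := ((t :- b) :* d :- :1) :- ((t :- a) :* d :- :1)) refl a b t d ⟩
        trace k b t - trace k a t     ≈⟨ +-cong h′ (-‿cong h) ⟩
        0# - 0#                       ≈⟨ solve 0 (:0 :- :0 := :0) refl ⟩
        0#                            ∎) a≉b

    geometric : Carrier → ℕ → Carrier
    geometric x zero    = 0#
    geometric x (suc n) = x * geometric x n + 1#

    geometric-sum : ∀ x n → x ^ n - 1# ≈ (x - 1#) * geometric x n
    geometric-sum x zero    = solve 1 (λ x → :1 :- :1 := (x :- :1) :* :0) refl x
    geometric-sum x (suc n) = begin
      x * x ^ n - 1#                     ≈⟨ solve 2 (λ x u → x :* u :- :1 := x :* (u :- :1) :+ (x :- :1)) refl x (x ^ n) ⟩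
      x * (x ^ n - 1#) + (x - 1#)        ≈⟨ +-congʳ (*-congˡ (geometric-sum x n)) ⟩
      x * ((x - 1#) * geometric x n) + (x - 1#)
        ≈⟨ solve 2 (λ x g → x :* ((x :- :1) :* g) :+ (x :- :1) := (x :- :1) :* (x :* g :+ :1)) refl x _ ⟩
      (x - 1#) * (x * geometric x n + 1#) ∎

    -- Read off f(z) = 0 in the form p (z^(k+1) - 1) = z^(k+2), where p is the product of the other
    -- three factors: for m q = k + 1 the sum `geometric` splits z^m - 1 off z^(k+1) - 1, and the
    -- power of z′ normalises the right side to 1.
    unitInverse : ℕ → Carrier → (z z′ : Carrier) → ℕ → ℕ → Carrier
    unitInverse k a z z′ m q = geometric (z ^ m) q *
      ((z * z - a * z + 1#) * (z + 1#) * (z ^ k - 1#)) * z′ ^ suc (suc k)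

    unit : ∀ k a {z z′} → z * z′ ≈ 1# → salem k a z ≈ 0# → ∀ m q → m ℕ.* q ≡ suc k →
           (z ^ m - 1#) * unitInverse k a z z′ m q ≈ 1#
    unit k a {z} {z′} zz′≈1 fz≈0 m q mq≡ = begin
      (z ^ m - 1#) * (geometric (z ^ m) q * p * z′ ^ suc (suc k))
        ≈⟨ solve 4 (λ x g p w → (x :- :1) :* (g :* p :* w) := p :* ((x :- :1) :* g) :* w) refl (z ^ m) _ p _ ⟩
      p * ((z ^ m - 1#) * geometric (z ^ m) q) * z′ ^ suc (suc k)
        ≈⟨ *-congʳ (*-congˡ (trans (sym (geometric-sum (z ^ m) q))
             (+-congʳ (trans (^-assocʳ z m q) (reflexive (≡.cong (z ^_) mq≡)))))) ⟩
      p * (z ^ suc k - 1#) * z′ ^ suc (suc k)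
        ≈⟨ *-congʳ (solve 2 (λ f w → f := f :- w :+ w) refl _ (z ^ suc (suc k))) ⟩
      (salem k a z + z ^ suc (suc k)) * z′ ^ suc (suc k)
        ≈⟨ *-congʳ (trans (+-congʳ fz≈0) (+-identityˡ _)) ⟩
      z ^ suc (suc k) * z′ ^ suc (suc k)
        ≈⟨ ^-inverse zz′≈1 (suc (suc k)) ⟩
      1# ∎
      where p = (z * z - a * z + 1#) * (z + 1#) * (z ^ k - 1#)

-- Conjugates of α, over an abstract domain containing ℚ.

module Conjugates
  {c ℓ} (R : CommutativeRing c ℓ)
  (ι : ℚ → CommutativeRing.Carrier R)
  (ι-hom : IsRingHomomorphism ℚ.+-*-rawRing (CommutativeRing.rawRing R) ι)
  (isDomain : Polynomials.IsDomain R)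
  where

  open import Algebra.Bundles using (CommutativeRing; Semiring)
  open import Algebra.Morphism.Structures using (IsRingHomomorphism)
  open import Data.Empty using (⊥-elim)
  open import Data.Integer.Base as ℤ using (ℤ)
  import Data.Integer.Properties as ℤ
  open import Data.List.Base using (List; []; _∷_; length)
  open import Data.List.Relation.Unary.All as All using (All; []; _∷_)
  open import Data.List.Relation.Unary.AllPairs using ([]; _∷_)
  open import Data.List.Relation.Unary.Any using (Any; here; there)
  open import Data.Nat.Base as ℕ using (ℕ; zero; suc)
  import Data.Nat.Properties as ℕ
  open import Data.Product.Base using (Σ-syntax; ∃-syntax; _×_; _,_; proj₁; proj₂)
  open import Data.Rational.Base as ℚ using (ℚ; 1ℚ)
  import Data.Rational.Properties as ℚ
  open import Data.Vec.Base as Vec using (Vec)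
  import Data.Vec.Properties as Vec
  open import Function.Base using (_∘_)
  open import Relation.Binary.PropositionalEquality as ≡ using (_≡_)
  open import Relation.Nullary.Decidable.Core using (yes; no)
  open import Relation.Nullary.Negation using (¬_)
  open Rationals

  open CommutativeRing R hiding (zero)
  open IntegerCoefficients R hiding (⟦_⟧)
  open Polynomials R
  open IsDomain isDomain
  open Polynomials.Roots R isDomain
  open Chebyshev R
  open Irreducibility.Field R ι ι-hom isDomain
  open SalemPolynomials.Monicity R ℤ.+-*-rawRing (ι ∘ fromℤ) ιℤ-hom
  open SalemPolynomials.Roots R
  open import Algebra.Definitions.RawSemiring (Semiring.rawSemiring semiring) using (_^_)
  open import Relation.Binary.Reasoning.Setoid setoid

  -- Holds for b = w + w⁻¹ with w on the unit circle, w ≠ ±1, as u and v are then real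
  -- and the form is |u + v w|².
  Definite : Carrier → Set ℓ
  Definite b = ∀ {d e} (p : Vec ℚ d) (q : Vec ℚ e) →
    let u = monic (Vec.map ι p) b
        v = low (Vec.map ι q) b in
    u * u + u * v * b + v * v ≈ 0# → u ≈ 0#

  module Salem
    (k : ℕ) (a : ℤ) {i} (Interval : Carrier → Set i)
    (far : ∀ b bs → All Interval (b ∷ bs) → ∀ r → ∏[x- b ∷ bs ] (ι (fromℤ a)) ≈ ι r → 1ℚ ℚ.< r)
    (α : Carrier) (α-root : salem (suc k) (ι (fromℤ a)) α ≈ 0#)
    (outside : ∀ α′ b → Interval b → α * α′ ≈ 1# → ¬ α + α′ ≈ b)
    (bs : List Carrier) (interval : All Interval bs) (distinct : Distinct bs)
    (roots : All (λ b → trace (suc k) (ι (fromℤ a)) b ≈ 0#) bs)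
    (count : length bs ≡ suc (suc k))
    where

    private
      F f : Carrier → Carrier
      F = trace (suc k) (ι (fromℤ a))
      f = salem (suc k) (ι (fromℤ a))

      fα≈0 : f α ≈ 0#
      fα≈0 = α-root

    degree : ℕ
    degree = suc (suc (suc k)) ℕ.+ suc (suc (suc k))

    private
      f-monic : ℤ[x].Monic degree f
      f-monic = salem-monic k a

      inverse-coefficients : Σ[ g ∈ Vec ℤ (suc (suc k) ℕ.+ suc (suc (suc k))) ]
        ∀ w → f w ≈ 0# → w * - monic (Vec.map (ι ∘ fromℤ) g) w ≈ 1#
      inverse-coefficients = rootInverse f-monic (salem-at-0 k (ι (fromℤ a)))

    -- An integer polynomial in w: one formula inverts all roots of f, and the inverse of α inherits
    -- integrality from α.
    inv : Carrier → Carrier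
    inv w = - monic (Vec.map (ι ∘ fromℤ) (proj₁ inverse-coefficients)) w

    inv-inverse : ∀ {w} → f w ≈ 0# → w * inv w ≈ 1#
    inv-inverse fw≈0 = proj₂ inverse-coefficients _ fw≈0

    integral : ∀ {w} → f w ≈ 0# → IsIntegral w
    integral {w} fw≈0 = degree , proj₁ f-monic , trans (proj₂ f-monic w) fw≈0

    private
      α′ : Carrier
      α′ = inv α

      αα′≈1 : α * α′ ≈ 1#
      αα′≈1 = inv-inverse fα≈0

      Fβ≈0 : F (α + α′) ≈ 0#
      Fβ≈0 = salem⇒trace (suc k) _ αα′≈1 fα≈0

      distinct′ : Distinct (α + α′ ∷ bs)
      distinct′ = All.map (λ b∈ → outside α′ _ b∈ αα′≈1) interval ∷ distinct

      module T = Trace (trace-monic k a) Interval a far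
        (trace-at-a (suc k) _) (α + α′) bs interval distinct′ (Fβ≈0 ∷ roots) (≡.cong suc count)

    minimal : Σ[ g ∈ Vec ℚ degree ] ∀ w → monic (Vec.map ι g) w ≈ f w
    minimal = toRational f-monic

    -- R has degree k + 3 and that many roots in the list, so it is the product of the linear
    -- factors; if w + w⁻¹ avoided every b, cancelling them one by one would leave 1 ≈ 0.
    traceValue : ∀ {w} → f w ≈ 0# → ¬ ¬ Any (λ b → w + inv w ≈ b) (α + α′ ∷ bs)
    traceValue {w} fw≈0 none = 1≉0 (∏≈0 (α + α′ ∷ bs) (w + inv w)
      (trans (sym (trans (sym (proj₂ F-rational (w + inv w)))
          (allRoots (Vec.map ι (proj₁ F-rational)) (α + α′ ∷ bs)
            distinct′
            (All.map (λ {b} Fb≈0 → trans (proj₂ F-rational b) Fb≈0) (Fβ≈0 ∷ roots))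
            (≡.cong suc count) (w + inv w))))
        (salem⇒trace (suc k) _ (inv-inverse fw≈0) fw≈0))
      (distinguish (α + α′ ∷ bs) none))
      where
      F-rational = toRational (trace-monic k a)
      distinguish : ∀ cs → ¬ Any (λ b → w + inv w ≈ b) cs → All (λ b → ¬ w + inv w ≈ b) cs
      distinguish []       none = []
      distinguish (b ∷ cs) none = (λ e → none (here e)) ∷ distinguish cs (λ e → none (there e))

    -- Both w and α satisfy the quadratic equation with trace α + α′ and norm 1, so (w - α)(w - α′)
    -- = 0.
    realRoots : ∀ {w} → f w ≈ 0# → w + inv w ≈ α + α′ → ¬ w ≈ α → w ≈ α′
    realRoots {w} fw≈0 e w≉α = begin
      w                  ≈⟨ solve 2 (λ w a → w := w :- a :+ a) refl w α′ ⟩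
      w - α′ + α′        ≈⟨ +-congʳ (domain product≈0 λ w-α≈0 → w≉α (begin
        w                ≈⟨ solve 2 (λ w a → w := w :- a :+ a) refl w α ⟩
        w - α + α        ≈⟨ +-congʳ w-α≈0 ⟩
        0# + α           ≈⟨ +-identityˡ α ⟩
        α                ∎)) ⟩
      0# + α′            ≈⟨ +-identityˡ α′ ⟩
      α′                 ∎
      where
      product≈0 : (w - α) * (w - α′) ≈ 0#
      product≈0 = begin
        (w - α) * (w - α′)
          ≈⟨ solve 3 (λ w a b → (w :- a) :* (w :- b) := w :* w :- w :* (a :+ b) :+ a :* b) refl w α α′ ⟩
        w * w - w * (α + α′) + α * α′
          ≈⟨ +-cong (+-congˡ (-‿cong (*-congˡ (sym e)))) αα′≈1 ⟩
        w * w - w * (w + inv w) + 1#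
          ≈⟨ +-congˡ (sym (inv-inverse fw≈0)) ⟩
        w * w - w * (w + inv w) + w * inv w
          ≈⟨ solve 2 (λ w v → w :* w :- w :* (w :+ v) :+ w :* v := :0) refl w (inv w) ⟩
        0# ∎

    module _
      {b} (Fb≈0 : F b ≈ 0#)
      (definite : Definite b)
      where

      degree-minimal : ∀ {e} (g : Vec ℚ e) → monic (Vec.map ι g) α ≈ 0# → degree ℕ.≤ e
      degree-minimal = T.degree-bound ≡.refl αα′≈1 Fβ≈0 Fb≈0
        λ (p , p≈U) (q , q≈V) N≈0 → trans (sym (p≈U b)) (definite p q (trans
          (+-cong (+-cong (*-cong (p≈U b) (p≈U b)) (*-congʳ (*-cong (p≈U b) (q≈V b)))) (*-cong (q≈V b) (q≈V b)))
          N≈0))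

      -- By `degree-minimal` f is itself a minimal polynomial of α, so the roots of any other one
      -- are roots of f.
      conjugate⇒root : ∀ {d} (g : Vec ℚ d) → monic (Vec.map ι g) α ≈ 0# →
        (∀ {e} (g : Vec ℚ e) → monic (Vec.map ι g) α ≈ 0# → d ℕ.≤ e) →
        ∀ {w} → monic (Vec.map ι g) w ≈ 0# → f w ≈ 0#
      conjugate⇒root = minimalUnique minimal fα≈0 degree-minimal

    -- Shows later that different parameters belong to different Salem numbers.
    parameter-unique : ∀ r → salem (suc k) (ι r) α ≈ 0# → r ≡ fromℤ a
    parameter-unique r h with r ℚ.≟ fromℤ a
    ... | yes r≡a = r≡a
    ... | no r≢a  = ⊥-elim (1≉0 (trace-injective (suc k)
      (salem⇒trace (suc k) (ι r) αα′≈1 h) Fβ≈0 domain λ r-a≈0 → r≢a (ι-injective (begin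
        ι r                               ≈⟨ solve 2 (λ r a → r := r :- a :+ a) refl (ι r) (ι (fromℤ a)) ⟩
        ι r - ι (fromℤ a) + ι (fromℤ a)   ≈⟨ trans (+-congʳ r-a≈0) (+-identityˡ _) ⟩
        ι (fromℤ a)                       ∎))))

    integral-inv : IsIntegral α′
    integral-inv = integral-neg (integral-monic (proj₁ inverse-coefficients) (integral fα≈0))

    private
      integral-geometric : ∀ {x} → IsIntegral x → ∀ n → IsIntegral (geometric x n)
      integral-geometric u zero    = integral-≈ (IsRingHomomorphism.0#-homo ιℤ-hom) (integral-ι (ℤ.+ 0))
      integral-geometric u (suc n) = integral-+ (integral-* u (integral-geometric u n)) integral-1

    power-minus-1 : ∀ m q → m ℕ.* q ≡ suc (suc k) →
      IsIntegral (α ^ m - 1#) × ∃[ w ] (α ^ m - 1#) * w ≈ 1# × IsIntegral w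
    power-minus-1 m q mq≡ =
      integral-- (integral-^ u m) integral-1 ,
      unitInverse (suc k) _ α α′ m q , unit (suc k) _ αα′≈1 fα≈0 m q mq≡ ,
      integral-*
        (integral-* (integral-geometric (integral-^ u m) q)
          (integral-* (integral-*
            (integral-+ (integral-- (integral-* u u) (integral-* (integral-ι a) u)) integral-1)
            (integral-+ u integral-1))
            (integral-- (integral-^ u (suc k)) integral-1)))
        (integral-^ integral-inv (suc (suc (suc k))))
      where
      u = integral fα≈0

-- Transfer from ℝ to ℂ, and algebra of the unit circle.

module Embedding where

  open import Algebra.Bundles using (CommutativeRing)
  open import Algebra.Morphism.Structures using (IsRingHomomorphism)
  open import Data.List.Base using ([]; _∷_)
  open import Data.Vec.Base as Vec using (Vec; []; _∷_)

  module Embedding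
    {c ℓ c′ ℓ′} (R : CommutativeRing c ℓ) (R′ : CommutativeRing c′ ℓ′)
    {φ : CommutativeRing.Carrier R → CommutativeRing.Carrier R′}
    (φ-hom : IsRingHomomorphism (CommutativeRing.rawRing R) (CommutativeRing.rawRing R′) φ)
    where

    private
      module R = CommutativeRing R
      module P = Polynomials R

    open CommutativeRing R′
    open Polynomials R′
    open IntegerCoefficients R′ hiding (⟦_⟧)
    open IsRingHomomorphism φ-hom
    open import Relation.Binary.Reasoning.Setoid setoid

    φ-minus : ∀ x y → φ (x R.- y) ≈ φ x - φ y
    φ-minus x y = trans (+-homo x (R.- y)) (+-congˡ (-‿homo y))

    module _ {k} {K : Set k} (ι : K → R.Carrier) where

      φ-monic : ∀ {d} (f : Vec K d) x →
                φ (P.monic (Vec.map ι f) x) ≈ monic (Vec.map (λ a → φ (ι a)) f) (φ x)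
      φ-monic []      x = 1#-homo
      φ-monic (a ∷ f) x = trans (+-homo _ _) (+-congˡ (trans (*-homo _ _) (*-congˡ (φ-monic f x))))

      φ-low : ∀ {d} (f : Vec K d) x →
              φ (P.low (Vec.map ι f) x) ≈ low (Vec.map (λ a → φ (ι a)) f) (φ x)
      φ-low []      x = 0#-homo
      φ-low (a ∷ f) x = trans (+-homo _ _) (+-congˡ (trans (*-homo _ _) (*-congˡ (φ-low f x))))

    φ-factor : ∀ a x y {p} → p ≈ φ y → (φ a - φ x) * p ≈ φ ((a R.- x) R.* y)
    φ-factor a x y p≈ = sym (trans (*-homo _ _) (*-cong (φ-minus a x) (sym p≈)))

    φ-reciprocal : ∀ {α x α′} → φ α + α′ ≈ φ x → φ α * α′ ≈ 1# → φ (α R.* (x R.- α)) ≈ 1#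
    φ-reciprocal {α} {x} {α′} sum product = begin
      φ (α R.* (x R.- α))      ≈⟨ trans (*-homo _ _) (*-congˡ (φ-minus x α)) ⟩
      φ α * (φ x - φ α)        ≈⟨ *-congˡ (+-congʳ (sym sum)) ⟩
      φ α * (φ α + α′ - φ α)   ≈⟨ solve 2 (λ a b → a :* (a :+ b :- a) := a :* b) refl (φ α) α′ ⟩
      φ α * α′                 ≈⟨ product ⟩
      1#                       ∎

    φ-norm : ∀ {u v b p q x} → u ≈ φ p → v ≈ φ q → b ≈ φ x →
             u * u + u * v * b + v * v ≈ φ (p R.* p R.+ p R.* q R.* x R.+ q R.* q)
    φ-norm u≈ v≈ b≈ = sym (trans (+-homo _ _) (+-cong
      (trans (+-homo _ _) (+-cong (trans (*-homo _ _) (*-cong (sym u≈) (sym u≈)))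
        (trans (*-homo _ _) (*-cong (trans (*-homo _ _) (*-cong (sym u≈) (sym v≈))) (sym b≈)))))
      (trans (*-homo _ _) (*-cong (sym v≈) (sym v≈)))))

  -- z = p + iq satisfies z (x − z) = 1 for a real x.
  module Circle {c ℓ} (R : CommutativeRing c ℓ) where

    open CommutativeRing R
    open IntegerCoefficients R
    open import Relation.Binary.Reasoning.Setoid setoid

    4# : Carrier
    4# = 1# + 1# + 1# + 1#

    reciprocal : ∀ {w w′ b} → w * w′ ≈ 1# → w + w′ ≈ b → w * (b - w) ≈ 1#
    reciprocal {w} {w′} {b} product sum = begin
      w * (b - w)            ≈⟨ *-congˡ (+-congʳ (sym sum)) ⟩
      w * (w + w′ - w)       ≈⟨ solve 2 (λ a b → a :* (a :+ b :- a) := a :* b) refl w w′ ⟩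
      w * w′                 ≈⟨ product ⟩
      1#                     ∎

    module _ {p q x}
      (real      : p * (x - p) - q * (0# - q) ≈ 1#)
      (imaginary : p * (0# - q) + q * (x - p) ≈ 0#)
      where

      q[x-2p]≈0 : q * (x - p - p) ≈ 0#
      q[x-2p]≈0 = trans
        (solve 3 (λ p q x → q :* (x :- p :- p) := p :* (:0 :- q) :+ q :* (x :- p)) refl p q x) imaginary

      norm-1 : p * p + q * q - 1# ≈ - (p * (x - p - p))
      norm-1 = trans (+-congˡ (-‿cong (sym real)))
        (solve 3 (λ p q x → p :* p :+ q :* q :- (p :* (x :- p) :- q :* (:0 :- q))
          := :- (p :* (x :- p :- p))) refl p q x)

      onCircle : x - p - p ≈ 0# → p * p + q * q - 1# ≈ 0#
      onCircle h = trans norm-1 (trans (-‿cong (*-congˡ h))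
        (solve 1 (λ p → :- (p :* :0) := :0) refl p))

      -- For real z = p both N - 1 = -p (x - 2p), with N = |z|², and p (x - p) = 1 hold. The form is
      -- chosen for x² ≤ 4: both summands are then nonnegative, which forces N = 1.
      onLine : q ≈ 0# →
        (p * p + q * q - 1#) * (p * p + q * q - 1#) + p * p * (4# - x * x) ≈ 0#
      onLine q≈0 = begin
        (p * p + q * q - 1#) * (p * p + q * q - 1#) + p * p * (4# - x * x)
          ≈⟨ +-congʳ (*-cong norm-1 norm-1) ⟩
        - (p * (x - p - p)) * - (p * (x - p - p)) + p * p * (4# - x * x)
          ≈⟨ solve 2 (λ p x → :- (p :* (x :- p :- p)) :* :- (p :* (x :- p :- p)) :+ p :* p :* (:4 :- x :* x)
               := :4 :* (p :* p) :* (:1 :- p :* (x :- p))) refl p x ⟩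
        4# * (p * p) * (1# - p * (x - p))
          ≈⟨ *-congˡ (+-congʳ (sym real)) ⟩
        4# * (p * p) * (p * (x - p) - q * (0# - q) - p * (x - p))
          ≈⟨ *-congˡ (+-congʳ (+-congˡ (-‿cong (*-congʳ q≈0)))) ⟩
        4# * (p * p) * (p * (x - p) - 0# * (0# - q) - p * (x - p))
          ≈⟨ solve 4 (λ f p q x → f :* (p :* p) :* (p :* (x :- p) :- :0 :* (:0 :- q) :- p :* (x :- p)) := :0)
               refl 4# p q x ⟩
        0# ∎

    module _ {h s x} (h+h≈x : h + h ≈ x) (h²+s²≈1 : h * h + s * s ≈ 1#) where

      -- Completes the form to |p + q w|² for the point w = h + is.
      definite : ∀ {p q} → p * p + p * q * x + q * q ≈ 0# →
                 (p + q * h) * (p + q * h) + q * s * (q * s) ≈ 0#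
      definite {p} {q} N≈0 = begin
        (p + q * h) * (p + q * h) + q * s * (q * s)
          ≈⟨ solve 4 (λ p q h s → (p :+ q :* h) :* (p :+ q :* h) :+ q :* s :* (q :* s)
               := p :* p :+ p :* q :* (h :+ h) :+ q :* q :* (h :* h :+ s :* s)) refl p q h s ⟩
        p * p + p * q * (h + h) + q * q * (h * h + s * s)
          ≈⟨ +-cong (+-congˡ (*-congˡ h+h≈x)) (trans (*-congˡ h²+s²≈1) (*-identityʳ _)) ⟩
        p * p + p * q * x + q * q
          ≈⟨ N≈0 ⟩
        0# ∎

      product-real : h * h - s * - s ≈ 1#
      product-real = trans (solve 2 (λ h s → h :* h :- s :* :- s := h :* h :+ s :* s) refl h s) h²+s²≈1

      product-imaginary : h * - s + s * h ≈ 0#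
      product-imaginary = solve 2 (λ h s → h :* :- s :+ s :* h := :0) refl h s

      real⇒±1 : s ≈ 0# → (h - 1#) * (h + 1#) ≈ 0#
      real⇒±1 s≈0 = begin
        (h - 1#) * (h + 1#)      ≈⟨ solve 1 (λ h → (h :- :1) :* (h :+ :1) := h :* h :+ :0 :* :0 :- :1) refl h ⟩
        h * h + 0# * 0# - 1#     ≈⟨ +-congʳ (+-congˡ (*-cong (sym s≈0) (sym s≈0))) ⟩
        h * h + s * s - 1#       ≈⟨ +-congʳ h²+s²≈1 ⟩
        1# - 1#                  ≈⟨ -‿inverseʳ 1# ⟩
        0#                       ∎

      h≈1⇒x≈2 : h - 1# ≈ 0# → x ≈ 1# + 1#
      h≈1⇒x≈2 e = begin
        x                                   ≈⟨ h+h≈x ⟨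
        h + h                               ≈⟨ solve 1 (λ h → h :+ h := (h :- :1) :+ (h :- :1) :+ :2) refl h ⟩
        (h - 1#) + (h - 1#) + (1# + 1#)     ≈⟨ +-congʳ (+-cong e e) ⟩
        0# + 0# + (1# + 1#)                 ≈⟨ solve 0 (:0 :+ :0 :+ :2 := :2) refl ⟩
        1# + 1#                             ∎

      h≈-1⇒x≈-2 : h + 1# ≈ 0# → x ≈ - (1# + 1#)
      h≈-1⇒x≈-2 e = begin
        x                                   ≈⟨ h+h≈x ⟨
        h + h                               ≈⟨ solve 1 (λ h → h :+ h := (h :+ :1) :+ (h :+ :1) :- :2) refl h ⟩
        (h + 1#) + (h + 1#) - (1# + 1#)     ≈⟨ +-congʳ (+-cong e e) ⟩
        0# + 0# - (1# + 1#)                 ≈⟨ solve 0 (:0 :+ :0 :- :2 := :- :2) refl ⟩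
        - (1# + 1#)                         ∎

-- Real and imaginary parts of the ring laws of ℂ, over an abstract commutative ring.

module ComplexLaws {c ℓ} (R : CommutativeRing c ℓ) where

  open CommutativeRing R hiding (*-assoc; *-comm; distribˡ; distribʳ)
  open IntegerCoefficients R

  *-assoc-re : ∀ a b c d e f →
    (a * c - (b * d)) * e - ((a * d + b * c) * f)
      ≈ a * (c * e - (d * f)) - (b * (c * f + d * e))
  *-assoc-re = solve 6 (λ a b c d e f →
      (a :* c :+ :- (b :* d)) :* e :+ :- ((a :* d :+ b :* c) :* f)
        := a :* (c :* e :+ :- (d :* f)) :+ :- (b :* (c :* f :+ d :* e))) refl

  *-assoc-im : ∀ a b c d e f →
    (a * c - (b * d)) * f + (a * d + b * c) * e
      ≈ a * (c * f + d * e) + b * (c * e - (d * f))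
  *-assoc-im = solve 6 (λ a b c d e f →
      (a :* c :+ :- (b :* d)) :* f :+ (a :* d :+ b :* c) :* e
        := a :* (c :* f :+ d :* e) :+ b :* (c :* e :+ :- (d :* f))) refl

  *-identityˡ-re : ∀ a b → 1# * a - (0# * b) ≈ a
  *-identityˡ-re = solve 2 (λ a b → :1 :* a :+ :- (:0 :* b) := a) refl

  *-identityˡ-im : ∀ a b → 1# * b + 0# * a ≈ b
  *-identityˡ-im = solve 2 (λ a b → :1 :* b :+ :0 :* a := b) refl

  *-identityʳ-re : ∀ a b → a * 1# - (b * 0#) ≈ a
  *-identityʳ-re = solve 2 (λ a b → a :* :1 :+ :- (b :* :0) := a) refl

  *-identityʳ-im : ∀ a b → a * 0# + b * 1# ≈ b
  *-identityʳ-im = solve 2 (λ a b → a :* :0 :+ b :* :1 := b) refl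

  distribˡ-re : ∀ a b c d e f → a * (c + e) - (b * (d + f)) ≈ (a * c - (b * d)) + (a * e - (b * f))
  distribˡ-re = solve 6 (λ a b c d e f →
      a :* (c :+ e) :+ :- (b :* (d :+ f))
        := (a :* c :+ :- (b :* d)) :+ (a :* e :+ :- (b :* f))) refl

  distribˡ-im : ∀ a b c d e f → a * (d + f) + b * (c + e) ≈ (a * d + b * c) + (a * f + b * e)
  distribˡ-im = solve 6 (λ a b c d e f →
      a :* (d :+ f) :+ b :* (c :+ e)
        := (a :* d :+ b :* c) :+ (a :* f :+ b :* e)) refl

  distribʳ-re : ∀ a b c d e f → (c + e) * a - ((d + f) * b) ≈ (c * a - (d * b)) + (e * a - (f * b))
  distribʳ-re = solve 6 (λ a b c d e f →
      (c :+ e) :* a :+ :- ((d :+ f) :* b)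
        := (c :* a :+ :- (d :* b)) :+ (e :* a :+ :- (f :* b))) refl

  distribʳ-im : ∀ a b c d e f → (c + e) * b + (d + f) * a ≈ (c * b + d * a) + (e * b + f * a)
  distribʳ-im = solve 6 (λ a b c d e f →
      (c :+ e) :* b :+ (d :+ f) :* a
        := (c :* b :+ d :* a) :+ (e :* b :+ f :* a)) refl

  *-comm-re : ∀ a b c d → a * c - (b * d) ≈ c * a - (d * b)
  *-comm-re = solve 4 (λ a b c d → a :* c :+ :- (b :* d) := c :* a :+ :- (d :* b)) refl

  *-comm-im : ∀ a b c d → a * d + b * c ≈ c * b + d * a
  *-comm-im = solve 4 (λ a b c d → a :* d :+ b :* c := c :* b :+ d :* a) refl

  normSq-* : ∀ a b c d →
    (a * c - (b * d)) * (a * c - (b * d)) + (a * d + b * c) * (a * d + b * c)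
      ≈ (a * a + b * b) * (c * c + d * d)
  normSq-* = solve 4 (λ a b c d →
      (a :* c :+ :- (b :* d)) :* (a :* c :+ :- (b :* d)) :+ (a :* d :+ b :* c) :* (a :* d :+ b :* c)
        := (a :* a :+ b :* b) :* (c :* c :+ d :* d)) refl

  embed-*-re : ∀ x y → x * y ≈ x * y - (0# * 0#)
  embed-*-re = solve 2 (λ x y → x :* y := x :* y :+ :- (:0 :* :0)) refl

  embed-*-im : ∀ x y → 0# ≈ x * 0# + 0# * y
  embed-*-im = solve 2 (λ x y → :0 := x :* :0 :+ :0 :* y) refl

-- Cauchy reals: ring structure, stability of equality and order, strict positivity.

module Reals where

  open import Algebra.Bundles using (CommutativeRing)
  open import Data.Nat.Base as ℕ using (ℕ; zero; suc; _⊔_)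
  import Data.Nat.Properties as ℕ
  open import Data.Product.Base using (∃-syntax; _×_; _,_)
  open import Data.Rational.Base as ℚ using (ℚ; 0ℚ; 1ℚ; ½; ∣_∣)
  import Data.Rational.Properties as ℚ
  open import Data.Rational.Solver using (module +-*-Solver)
  open import Data.Sum.Base using (_⊎_; inj₁; inj₂)
  open import Level using (0ℓ)
  open import Relation.Binary.PropositionalEquality as ≡ using (_≡_; refl; cong; subst; subst₂)
  open import Relation.Nullary.Decidable.Core using (yes; no)
  open import Relation.Nullary.Negation using (¬_; contradiction)
  open import Relation.Unary using (Pred)
  open import Defs hiding (_+_; _*_; -_; _^_)
  open Rationals
  open +-*-Solver

  always : ∀ {P : Pred ℕ 0ℓ} → (∀ n → P n) → Eventually P
  always h = 0 , λ n _ → h n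

  both : ∀ {P Q R : Pred ℕ 0ℓ} → (∀ {n} → P n → Q n → R n) → Eventually P → Eventually Q → Eventually R
  both f (M , p) (N , q) = M ⊔ N , λ n h →
    f (p n (ℕ.m⊔n≤o⇒m≤o M N h)) (q n (ℕ.m⊔n≤o⇒n≤o M N h))

  weaken : ∀ {P Q : Pred ℕ 0ℓ} → (∀ {n} → P n → Q n) → Eventually P → Eventually Q
  weaken f (N , p) = N , λ n h → f (p n h)

  witness : ∀ {P : Pred ℕ 0ℓ} → Eventually P → ∃[ n ] P n
  witness (N , p) = N , p N ℕ.≤-refl

  allBelow : ∀ {P : ℕ → Pred ℕ 0ℓ} k → (∀ i → i ℕ.≤ k → Eventually (P i)) →
             Eventually (λ n → ∀ i → i ℕ.≤ k → P i n)
  allBelow zero h = weaken (λ { p _ ℕ.z≤n → p }) (h 0 ℕ.z≤n)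
  allBelow {P} (suc k) h = both combine (h (suc k) ℕ.≤-refl) (allBelow {P} k λ i i≤k → h i (ℕ.m≤n⇒m≤1+n i≤k))
    where
    combine : ∀ {n} → P (suc k) n → (∀ i → i ℕ.≤ k → P i n) → ∀ i → i ℕ.≤ suc k → P i n
    combine p ps i i≤1+k with ℕ.m≤n⇒m<n∨m≡n i≤1+k
    ... | inj₁ i<1+k = ps i (ℕ.≤-pred i<1+k)
    ... | inj₂ refl  = p

  pointwise : ∀ {x y} → (∀ n → seq x n ≡ seq y n) → x ≃ y
  pointwise {x} {y} h ε 0<ε = always λ n →
    subst (ℚ._≤ ε) (≡.sym (cong ∣_∣ (≡.trans (cong (ℚ._- seq y n) (h n)) (ℚ.+-inverseʳ (seq y n)))))
      (ℚ.<⇒≤ 0<ε)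

  ≃-refl : ∀ {x} → x ≃ x
  ≃-refl {x} = pointwise {x} {x} λ _ → refl

  ≃-sym : ∀ {x y} → x ≃ y → y ≃ x
  ≃-sym {x} {y} h ε 0<ε = weaken (λ {n} → subst (ℚ._≤ ε) (∣p-q∣≡∣q-p∣ (seq x n) (seq y n))) (h ε 0<ε)

  private
    halves : ∀ {p q ε} → p ℚ.≤ ½ ℚ.* ε → q ℚ.≤ ½ ℚ.* ε → p ℚ.+ q ℚ.≤ ε
    halves {ε = ε} p≤ q≤ = ℚ.≤-trans (ℚ.+-mono-≤ p≤ q≤) (ℚ.≤-reflexive (½+½ ε))

  ≃-trans : ∀ {x y z} → x ≃ y → y ≃ z → x ≃ z
  ≃-trans {x} {y} {z} h k ε 0<ε = both
    (λ {n} p q → ℚ.≤-trans (∣∣-triangle (seq x n) (seq y n) (seq z n)) (halves p q))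
    (h _ (0<½* 0<ε)) (k _ (0<½* 0<ε))

  +ʳ-cong : ∀ {x x′ y y′} → x ≃ x′ → y ≃ y′ → x +ʳ y ≃ x′ +ʳ y′
  +ʳ-cong {x} {x′} {y} {y′} h k ε 0<ε = both
    (λ {n} p q → ℚ.≤-trans
      (subst (λ t → ∣ t ∣ ℚ.≤ ∣ seq x n ℚ.- seq x′ n ∣ ℚ.+ ∣ seq y n ℚ.- seq y′ n ∣)
        (solve 4 (λ a a′ b b′ → a :- a′ :+ (b :- b′) := a :+ b :- (a′ :+ b′)) refl
          (seq x n) (seq x′ n) (seq y n) (seq y′ n))
        (ℚ.∣p+q∣≤∣p∣+∣q∣ (seq x n ℚ.- seq x′ n) (seq y n ℚ.- seq y′ n)))
      (halves p q))
    (h _ (0<½* 0<ε)) (k _ (0<½* 0<ε))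

  -ʳ-cong : ∀ {x y} → x ≃ y → -ʳ x ≃ -ʳ y
  -ʳ-cong {x} {y} h ε 0<ε = weaken
    (λ {n} → subst (ℚ._≤ ε) (≡.trans (∣p-q∣≡∣q-p∣ (seq x n) (seq y n)) (cong ∣_∣
      (solve 2 (λ a b → b :- a := :- a :- :- b) refl (seq x n) (seq y n)))))
    (h ε 0<ε)

  bounded : ∀ x → ∃[ B ] 0ℚ ℚ.< B × Eventually λ n → ∣ seq x n ∣ ℚ.≤ B
  bounded x with cauchy x 1ℚ 0<1
  ... | N , h = 1ℚ ℚ.+ ∣ seq x N ∣ , 0<+≤ 0<1 (ℚ.0≤∣p∣ (seq x N)) , N , λ n N≤n →
    ℚ.≤-trans
      (subst (λ t → ∣ t ∣ ℚ.≤ ∣ seq x n ℚ.- seq x N ∣ ℚ.+ ∣ seq x N ∣)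
        (solve 2 (λ p q → p :- q :+ q := p) refl (seq x n) (seq x N))
        (ℚ.∣p+q∣≤∣p∣+∣q∣ (seq x n ℚ.- seq x N) (seq x N)))
      (ℚ.+-monoˡ-≤ ∣ seq x N ∣ (h n N N≤n ℕ.≤-refl))

  private
    quotient : ∀ {B ε} → 0ℚ ℚ.< B → 0ℚ ℚ.< ε → ∃[ δ ] 0ℚ ℚ.< δ × B ℚ.* δ ≡ ε
    quotient {B} {ε} 0<B 0<ε =
      let r , 0<r , Br≡1 = inverse 0<B in
      r ℚ.* ε , 0<* 0<r 0<ε ,
      ≡.trans (≡.sym (ℚ.*-assoc B r ε)) (≡.trans (cong (ℚ._* ε) Br≡1) (ℚ.*-identityˡ ε))

    product-bound : ∀ p q {B δ} → 0ℚ ℚ.≤ δ → ∣ p ∣ ℚ.≤ B → ∣ q ∣ ℚ.≤ δ → ∣ p ℚ.* q ∣ ℚ.≤ B ℚ.* δ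
    product-bound p q 0≤δ p≤B q≤δ = ℚ.≤-trans (ℚ.≤-reflexive (ℚ.∣p*q∣≡∣p∣*∣q∣ p q))
      (*-mono (ℚ.0≤∣p∣ p) 0≤δ p≤B q≤δ)

  *ʳ-congˡ : ∀ x {y y′} → y ≃ y′ → x *ʳ y ≃ x *ʳ y′
  *ʳ-congˡ x {y} {y′} h ε 0<ε =
    let B , 0<B , x≤B = bounded x
        δ , 0<δ , Bδ≡ε = quotient 0<B 0<ε in
    both (λ {n} p q → subst₂ ℚ._≤_
        (cong ∣_∣ (solve 3 (λ x y y′ → x :* (y :- y′) := x :* y :- x :* y′) refl
          (seq x n) (seq y n) (seq y′ n)))
        Bδ≡ε (product-bound (seq x n) (seq y n ℚ.- seq y′ n) (ℚ.<⇒≤ 0<δ) p q))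
      x≤B (h δ 0<δ)

  *ʳ-comm : ∀ x y → x *ʳ y ≃ y *ʳ x
  *ʳ-comm x y = pointwise {x *ʳ y} {y *ʳ x} λ n → ℚ.*-comm (seq x n) (seq y n)

  *ʳ-cong : ∀ {x x′ y y′} → x ≃ x′ → y ≃ y′ → x *ʳ y ≃ x′ *ʳ y′
  *ʳ-cong {x} {x′} {y} {y′} h k = ≃-trans {x *ʳ y} {x *ʳ y′} {x′ *ʳ y′} (*ʳ-congˡ x {y} {y′} k)
    (≃-trans {x *ʳ y′} {y′ *ʳ x} {x′ *ʳ y′} (*ʳ-comm x y′)
      (≃-trans {y′ *ʳ x} {y′ *ʳ x′} {x′ *ʳ y′} (*ʳ-congˡ y′ {x} {x′} h) (*ʳ-comm y′ x′)))

  ℝ-commutativeRing : CommutativeRing 0ℓ 0ℓ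
  ℝ-commutativeRing = record
    { Carrier = ℝ ; _≈_ = _≃_ ; _+_ = _+ʳ_ ; _*_ = _*ʳ_ ; -_ = -ʳ_ ; 0# = 0ℝ ; 1# = 1ℝ
    ; isCommutativeRing = record
      { isRing = record
        { +-isAbelianGroup = record
          { isGroup = record
            { isMonoid = record
              { isSemigroup = record
                { isMagma = record
                  { isEquivalence = record
                    { refl  = λ {x} → ≃-refl {x}
                    ; sym   = λ {x} {y} → ≃-sym {x} {y}
                    ; trans = λ {x} {y} {z} → ≃-trans {x} {y} {z} }
                  ; ∙-cong = λ {x} {x′} {y} {y′} → +ʳ-cong {x} {x′} {y} {y′} }
                ; assoc = λ x y z → pointwise {(x +ʳ y) +ʳ z} {x +ʳ (y +ʳ z)}
                    λ n → ℚ.+-assoc (seq x n) (seq y n) (seq z n) }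
              ; identity = (λ x → pointwise {0ℝ +ʳ x} {x} λ n → ℚ.+-identityˡ (seq x n))
                         , (λ x → pointwise {x +ʳ 0ℝ} {x} λ n → ℚ.+-identityʳ (seq x n)) }
            ; inverse = (λ x → pointwise {(-ʳ x) +ʳ x} {0ℝ} λ n → ℚ.+-inverseˡ (seq x n))
                      , (λ x → pointwise {x +ʳ -ʳ x} {0ℝ} λ n → ℚ.+-inverseʳ (seq x n))
            ; ⁻¹-cong = λ {x} {y} → -ʳ-cong {x} {y} }
          ; comm = λ x y → pointwise {x +ʳ y} {y +ʳ x} λ n → ℚ.+-comm (seq x n) (seq y n) }
        ; *-cong = λ {x} {x′} {y} {y′} → *ʳ-cong {x} {x′} {y} {y′}
        ; *-assoc = λ x y z → pointwise {(x *ʳ y) *ʳ z} {x *ʳ (y *ʳ z)}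
            λ n → ℚ.*-assoc (seq x n) (seq y n) (seq z n)
        ; *-identity = (λ x → pointwise {1ℝ *ʳ x} {x} λ n → ℚ.*-identityˡ (seq x n))
                     , (λ x → pointwise {x *ʳ 1ℝ} {x} λ n → ℚ.*-identityʳ (seq x n))
        ; distrib = (λ x y z → pointwise {x *ʳ (y +ʳ z)} {x *ʳ y +ʳ x *ʳ z}
                      λ n → ℚ.*-distribˡ-+ (seq x n) (seq y n) (seq z n))
                  , (λ x y z → pointwise {(y +ʳ z) *ʳ x} {y *ʳ x +ʳ z *ʳ x}
                      λ n → ℚ.*-distribʳ-+ (seq x n) (seq y n) (seq z n)) }
      ; *-comm = *ʳ-comm } }

  ℚ⇒ℝ-injective : ∀ {p q} → ℚ⇒ℝ p ≃ ℚ⇒ℝ q → p ≡ q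
  ℚ⇒ℝ-injective {p} {q} h with ∣ p ℚ.- q ∣ ℚ.≤? 0ℚ
  ... | yes ∣p-q∣≤0 = ≡.trans (solve 2 (λ p q → p := p :- q :+ q) refl p q)
    (≡.trans (cong (ℚ._+ q) (ℚ.∣p∣≡0⇒p≡0 (p ℚ.- q) (ℚ.≤-antisym ∣p-q∣≤0 (ℚ.0≤∣p∣ (p ℚ.- q)))))
      (ℚ.+-identityˡ q))
  ... | no ∣p-q∣≰0 =
    let 0<d = ℚ.≰⇒> ∣p-q∣≰0
        _ , d≤½d = witness (h _ (0<½* 0<d)) in
    contradiction
      (ℚ.≤-<-trans d≤½d (<-by (0<½* 0<d)
        (solve 1 (λ d → d :- con ½ :* d := con ½ :* d) refl ∣ p ℚ.- q ∣)))
      (ℚ.<-irrefl refl)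

  ≤-pointwise : ∀ {x y} → (∀ n → seq x n ℚ.≤ seq y n) → x ≤ y
  ≤-pointwise {x} {y} h ε 0<ε = always λ n → ℚ.≤-trans (h n)
    (≤-by (ℚ.<⇒≤ 0<ε) (solve 2 (λ y ε → y :+ ε :- y := ε) refl (seq y n) ε))

  ≃⇒≤ : ∀ {x y} → x ≃ y → x ≤ y
  ≃⇒≤ {x} {y} h ε 0<ε = weaken
    (λ {n} p → ≤-by (≤⇒0≤ (ℚ.≤-trans (p≤∣p∣ (seq x n ℚ.- seq y n)) p))
      (solve 3 (λ x y ε → y :+ ε :- x := ε :- (x :- y)) refl (seq x n) (seq y n) ε))
    (h ε 0<ε)

  ≤ʳ-trans : ∀ {x y z} → x ≤ y → y ≤ z → x ≤ z
  ≤ʳ-trans {x} {y} {z} h k ε 0<ε = both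
    (λ {n} p q → ≤-by (0≤+ (≤⇒0≤ p) (≤⇒0≤ q))
      (solve 4 (λ x y z ε → z :+ ε :- x := y :+ con ½ :* ε :- x :+ (z :+ con ½ :* ε :- y)) refl
        (seq x n) (seq y n) (seq z n) ε))
    (h _ (0<½* 0<ε)) (k _ (0<½* 0<ε))

  ≤ʳ-antisym : ∀ {x y} → x ≤ y → y ≤ x → x ≃ y
  ≤ʳ-antisym {x} {y} h k ε 0<ε = both
    (λ {n} p q → ∣∣≤
      (≤-by (≤⇒0≤ p) (solve 3 (λ x y ε → ε :- (x :- y) := y :+ ε :- x) refl (seq x n) (seq y n) ε))
      (≤-by (≤⇒0≤ q) (solve 3 (λ x y ε → ε :- :- (x :- y) := x :+ ε :- y) refl (seq x n) (seq y n) ε)))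
    (h ε 0<ε) (k ε 0<ε)

  -- Cotransitivity of the order, at the points 0 and ε.
  compare : ∀ x {ε} → 0ℚ ℚ.< ε →
            (Eventually λ n → seq x n ℚ.≤ ε) ⊎ (Eventually λ n → ½ ℚ.* ε ℚ.≤ seq x n)
  compare x {ε} 0<ε with cauchy x (½ ℚ.* (½ ℚ.* ε)) (0<½* (0<½* 0<ε))
  -- The threshold ¾ ε lies midway between ½ ε and ε, and the accuracy ¼ ε of the term at N covers
  -- the distance to either.
  ... | N , h with ℚ.≤-total (seq x N) ((½ ℚ.+ ½ ℚ.* ½) ℚ.* ε)
  ...   | inj₁ x≤ = inj₁ (N , λ n N≤n → ≤-by
          (0≤+ (≤⇒0≤ x≤) (≤⇒0≤ (ℚ.≤-trans (p≤∣p∣ _) (h n N N≤n ℕ.≤-refl))))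
          (solve 3 (λ x y ε → ε :- x := (con ½ :+ con ½ :* con ½) :* ε :- y
            :+ (con ½ :* (con ½ :* ε) :- (x :- y))) refl (seq x n) (seq x N) ε))
  ...   | inj₂ ≤x = inj₂ (N , λ n N≤n → ≤-by
          (0≤+ (≤⇒0≤ ≤x) (≤⇒0≤ (ℚ.≤-trans (-p≤∣p∣ _) (h n N N≤n ℕ.≤-refl))))
          (solve 3 (λ x y ε → x :- con ½ :* ε := y :- (con ½ :+ con ½ :* con ½) :* ε
            :+ (con ½ :* (con ½ :* ε) :- :- (x :- y))) refl (seq x n) (seq x N) ε))

  private
    ½≰0 : ∀ {ε} → 0ℚ ℚ.< ε → ¬ ½ ℚ.* ε ℚ.≤ ½ ℚ.* (½ ℚ.* ε)
    ½≰0 {ε} 0<ε h = ℚ.<-irrefl refl (ℚ.≤-<-trans h (<-by (0<½* (0<½* 0<ε))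
      (solve 1 (λ ε → con ½ :* ε :- con ½ :* (con ½ :* ε) := con ½ :* (con ½ :* ε)) refl ε)))

  -- `compare` decides between x - y ≤ ε and x - y ≥ ½ ε, and the second alternative refutes x ≤ y.
  -- Classical case distinctions are therefore allowed in proofs of `≤` and `≃`.
  ≤-stable : ∀ {x y} → ¬ ¬ x ≤ y → x ≤ y
  ≤-stable {x} {y} h ε 0<ε with compare (x +ʳ -ʳ y) 0<ε
  ... | inj₁ x-y≤ε = weaken (λ {n} p → ≤-by (≤⇒0≤ p)
          (solve 3 (λ x y ε → y :+ ε :- x := ε :- (x :- y)) refl (seq x n) (seq y n) ε)) x-y≤ε
  ... | inj₂ ½ε≤x-y = contradiction
    (λ x≤y → let n , p , q = witness (both _,_ (x≤y _ (0<½* (0<½* 0<ε))) ½ε≤x-y) in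
      ½≰0 0<ε (ℚ.≤-trans q (≤-by (≤⇒0≤ p)
        (solve 3 (λ x y ε → ε :- (x :- y) := y :+ ε :- x) refl (seq x n) (seq y n) (½ ℚ.* (½ ℚ.* ε)))))) h

  ≃-stable : ∀ {x y} → ¬ ¬ x ≃ y → x ≃ y
  ≃-stable {x} {y} h = ≤ʳ-antisym {x} {y}
    (≤-stable {x} {y} λ k → h λ e → k (≃⇒≤ {x} {y} e))
    (≤-stable {y} {x} λ k → h λ e → k (≃⇒≤ {y} {x} (≃-sym {x} {y} e)))

  0<ʳ_ : ℝ → Set
  0<ʳ x = ∃[ ε ] 0ℚ ℚ.< ε × Eventually λ n → ε ℚ.≤ seq x n

  0<ʳ⇒0< : ∀ {x} → 0<ʳ x → Eventually λ n → 0ℚ ℚ.< seq x n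
  0<ʳ⇒0< (ε , 0<ε , h) = weaken (ℚ.<-≤-trans 0<ε) h

  0<ʳ-resp : ∀ {x y} → x ≃ y → 0<ʳ x → 0<ʳ y
  0<ʳ-resp {x} {y} x≃y (ε , 0<ε , h) = ½ ℚ.* ε , 0<½* 0<ε , both
    (λ {n} p q → ≤-by (0≤+ (≤⇒0≤ p) (≤⇒0≤ (ℚ.≤-trans (p≤∣p∣ _) q)))
      (solve 3 (λ x y ε → y :- con ½ :* ε := x :- ε :+ (con ½ :* ε :- (x :- y))) refl
        (seq x n) (seq y n) ε))
    h (x≃y _ (0<½* 0<ε))

  0<ʳ-* : ∀ {x y} → 0<ʳ x → 0<ʳ y → 0<ʳ (x *ʳ y)
  0<ʳ-* (ε , 0<ε , h) (δ , 0<δ , k) = ε ℚ.* δ , 0<* 0<ε 0<δ , both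
    (λ p q → *-mono (ℚ.<⇒≤ 0<ε) (ℚ.<⇒≤ (ℚ.<-≤-trans 0<δ q)) p q) h k

  -- From x y ≥ ε, x ≥ 0 and y ≤ B follows x ≥ ε/B; this δ is the required positive lower bound.
  0<ʳ-factor : ∀ x y → (Eventually λ n → 0ℚ ℚ.≤ seq x n) → 0<ʳ (x *ʳ y) → 0<ʳ x
  0<ʳ-factor x y 0≤x (ε , 0<ε , h) =
    let B , 0<B , y≤B = bounded y
        δ , 0<δ , Bδ≡ε = quotient 0<B 0<ε in
    δ , 0<δ , both
      (λ {n} 0≤x (p , q) → ≤-by {p = δ} {seq x n}
        (0≤-cancel {B} {seq x n ℚ.- δ} 0<B (subst (0ℚ ℚ.≤_)
          (solve 3 (λ B x δ → B :* x :- B :* δ := B :* (x :- δ)) refl B (seq x n) δ)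
          (≤⇒0≤ {B ℚ.* δ} {B ℚ.* seq x n}
            (ℚ.≤-trans (ℚ.≤-trans (ℚ.≤-reflexive Bδ≡ε) q)
              (≤-by {p = seq x n ℚ.* seq y n} {B ℚ.* seq x n}
                (0≤* {seq x n} {B ℚ.- seq y n} 0≤x (≤⇒0≤ (ℚ.≤-trans (p≤∣p∣ (seq y n)) p)))
                (solve 3 (λ x y B → B :* x :- x :* y := x :* (B :- y)) refl (seq x n) (seq y n) B))))))
        refl)
      0≤x (both _,_ y≤B h)

  0<ʳ-+ : ∀ {x y} → 0<ʳ x → 0<ʳ y → 0<ʳ (x +ʳ y)
  0<ʳ-+ (ε , 0<ε , h) (δ , 0<δ , l) = ε ℚ.+ δ , 0<+≤ 0<ε (ℚ.<⇒≤ 0<δ) , both (λ p q → ℚ.+-mono-≤ p q) h l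

  0<ʳ-cancel : ∀ {x y} → 0<ʳ (x *ʳ y) → 0<ʳ y → 0<ʳ x
  0<ʳ-cancel {x} {y} 0<xy@(ε , 0<ε , h) (δ , 0<δ , l) = 0<ʳ-factor x y
    (both (λ {n} p q → ℚ.<⇒≤ (0<-cancel {seq y n} {seq x n} (ℚ.<-≤-trans 0<δ q)
        (ℚ.<-≤-trans 0<ε (ℚ.≤-trans p (ℚ.≤-reflexive (ℚ.*-comm (seq x n) (seq y n)))))))
      h l) 0<xy

  0<ʳ⇒≄0 : ∀ {x} → 0<ʳ x → ¬ x ≃ 0ℝ
  0<ʳ⇒≄0 {x} (ε , 0<ε , h) x≃0 =
    let n , ε≤x , x≤½ε = witness (both _,_ h (x≃0 (½ ℚ.* ε) (0<½* 0<ε))) in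
    ℚ.<-irrefl refl (ℚ.<-≤-trans
      (<-by {½ ℚ.* ε} {ε} (0<½* 0<ε) (solve 1 (λ e → e :- con ½ :* e := con ½ :* e) refl ε))
      (ℚ.≤-trans ε≤x (ℚ.≤-trans (≤-by ℚ.≤-refl (solve 1 (λ x → x :- con 0ℚ :- x := con 0ℚ) refl (seq x n)))
        (ℚ.≤-trans (p≤∣p∣ (seq x n ℚ.- 0ℚ)) x≤½ε))))

-- Zero divisors, intermediate values and square roots in ℝ.

module RealRoots where

  open import Data.Nat.Base as ℕ using (ℕ; zero; suc)
  import Data.Nat.Properties as ℕ
  open import Data.Product.Base using (∃-syntax; _×_; _,_; proj₁; proj₂)
  open import Data.Rational.Base as ℚ using (ℚ; 0ℚ; 1ℚ; ½; ∣_∣)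
  import Data.Rational.Properties as ℚ
  open import Data.Rational.Solver using (module +-*-Solver)
  open import Data.Sum.Base using (inj₁; inj₂)
  open import Level using (0ℓ)
  open import Relation.Binary.PropositionalEquality as ≡ using (_≡_; refl; cong; subst; subst₂)
  open import Relation.Nullary.Decidable.Core using (yes; no)
  open import Relation.Nullary.Negation using (¬_; contradiction)
  open import Relation.Unary using (Pred; Decidable)
  open import Defs hiding (_+_; _*_; -_; _^_)
  open Rationals
  open Reals
  open +-*-Solver

  private
    ≮ : ∀ {p q} → p ℚ.< q → ¬ q ℚ.≤ p
    ≮ p<q q≤p = ℚ.<-irrefl refl (ℚ.<-≤-trans p<q q≤p)

    sq-cancel : ∀ {p ε} → 0ℚ ℚ.< ε → p ℚ.* p ℚ.≤ ε ℚ.* ε → p ℚ.≤ ε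
    sq-cancel {p} {ε} 0<ε h with p ℚ.≤? ε
    ... | yes p≤ε = p≤ε
    ... | no p≰ε  = contradiction h (≮ (<-by
      (0<* (<⇒0< ε<p) (0<+≤ 0<ε (ℚ.<⇒≤ (ℚ.<-trans 0<ε ε<p))))
      (solve 2 (λ p ε → p :* p :- ε :* ε := (p :- ε) :* (ε :+ p)) refl p ε)))
      where ε<p = ℚ.≰⇒> p≰ε

  -- If y ≥ ½ ε eventually, then |x y| ≤ ½ ε η gives |x| ≤ η for every η, so x ≃ 0. Hence `compare`
  -- leaves y ≤ ε for every ε, and the same argument applies to -y.
  domain : ∀ {x y} → x *ʳ y ≃ 0ℝ → ¬ x ≃ 0ℝ → y ≃ 0ℝ
  domain {x} {y} xy≃0 x≄0 = ≤ʳ-antisym {y} {0ℝ} (nonPositive y xy≃0)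
    λ ε 0<ε → weaken
      (λ {n} p → ≤-by (≤⇒0≤ p)
        (solve 2 (λ y ε → y :+ ε :- con 0ℚ := con 0ℚ :+ ε :- :- y) refl (seq y n) ε))
      (nonPositive (-ʳ y) (λ ε 0<ε → weaken
        (λ {n} → subst (ℚ._≤ ε) (≡.trans (≡.sym (ℚ.∣-p∣≡∣p∣ _)) (cong ∣_∣
          (solve 2 (λ x y → :- (x :* y :- con 0ℚ) := x :* :- y :- con 0ℚ) refl (seq x n) (seq y n)))))
        (xy≃0 ε 0<ε)) ε 0<ε)
    where
    nonPositive : ∀ y → x *ʳ y ≃ 0ℝ → y ≤ 0ℝ
    nonPositive y h ε 0<ε with compare y 0<ε
    ... | inj₁ y≤ε = weaken (λ p → ℚ.≤-trans p (ℚ.≤-reflexive (≡.sym (ℚ.+-identityˡ ε)))) y≤ε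
    ... | inj₂ ½ε≤y = contradiction (λ η 0<η → both
        (λ {n} p q → subst (λ t → ∣ t ∣ ℚ.≤ η) (solve 1 (λ x → x := x :- con 0ℚ) refl (seq x n))
          (0≤-difference (0≤-cancel {½ ℚ.* ε} {η ℚ.- ∣ seq x n ∣} (0<½* 0<ε)
            (subst (0ℚ ℚ.≤_)
              (solve 3 (λ d η x → d :* η :- d :* x := d :* (η :- x)) refl (½ ℚ.* ε) η ∣ seq x n ∣)
              (≤⇒0≤ (ℚ.≤-trans
                (subst₂ ℚ._≤_ (ℚ.*-comm ∣ seq x n ∣ (½ ℚ.* ε)) (≡.trans
                   (≡.sym (ℚ.∣p*q∣≡∣p∣*∣q∣ (seq x n) (seq y n)))
                   (cong ∣_∣ (solve 1 (λ t → t := t :- con 0ℚ) refl (seq x n ℚ.* seq y n))))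
                  (*-mono (ℚ.0≤∣p∣ (seq x n)) (ℚ.0≤∣p∣ (seq y n)) ℚ.≤-refl
                    (ℚ.≤-trans q (p≤∣p∣ (seq y n)))))
                p))))))
        (h _ (0<* (0<½* 0<ε) 0<η)) ½ε≤y) x≄0
      where
      0≤-difference : ∀ {p q} → 0ℚ ℚ.≤ q ℚ.- p → p ℚ.≤ q
      0≤-difference h = ≤-by h refl

  squareZero : ∀ {x z} → (∀ n → 0ℚ ℚ.≤ seq z n) → x *ʳ x +ʳ z ≃ 0ℝ → x ≃ 0ℝ
  squareZero {x} {z} 0≤z h ε 0<ε = weaken
    (λ {n} p →
      let x² = ℚ.≤-trans
            (≤-by {seq x n ℚ.* seq x n} (0≤z n)
              (solve 2 (λ x z → x :* x :+ z :- con 0ℚ :- x :* x := z) refl (seq x n) (seq z n)))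
            (ℚ.≤-trans (p≤∣p∣ _) p)
      in ∣∣≤
        (subst (ℚ._≤ ε) (solve 1 (λ x → x := x :- con 0ℚ) refl (seq x n)) (sq-cancel 0<ε x²))
        (sq-cancel 0<ε (subst (ℚ._≤ ε ℚ.* ε)
          (solve 1 (λ x → x :* x := :- (x :- con 0ℚ) :* :- (x :- con 0ℚ)) refl (seq x n)) x²)))
    (h _ (0<* 0<ε 0<ε))

  sumOfSquares : ∀ {x y} → x *ʳ x +ʳ y *ʳ y ≃ 0ℝ → x ≃ 0ℝ
  sumOfSquares {x} {y} = squareZero {x} {y *ʳ y} λ n → 0≤p² (seq y n)

  -- Tests are made at rational points only, where B is decidable. Every interval has B false at its
  -- left end and true at its right end; B need not be monotone.
  module Bisection
    {B : Pred ℚ 0ℓ} (B? : Decidable B) {u v} (u≤v : u ℚ.≤ v) (¬Bu : ¬ B u) (Bv : B v)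
    where

    record Interval : Set where
      field
        lo hi : ℚ
        lo≤hi : lo ℚ.≤ hi
        ¬Blo  : ¬ B lo
        Bhi   : B hi

    open Interval public

    private
      midpoint : ℚ → ℚ → ℚ
      midpoint p q = ½ ℚ.* (p ℚ.+ q)

      lo≤mid : ∀ {p q} → p ℚ.≤ q → p ℚ.≤ midpoint p q
      lo≤mid {p} {q} p≤q = ≤-by (0≤* (ℚ.<⇒≤ 0<½) (≤⇒0≤ p≤q))
        (solve 2 (λ p q → con ½ :* (p :+ q) :- p := con ½ :* (q :- p)) refl p q)

      mid≤hi : ∀ {p q} → p ℚ.≤ q → midpoint p q ℚ.≤ q
      mid≤hi {p} {q} p≤q = ≤-by (0≤* (ℚ.<⇒≤ 0<½) (≤⇒0≤ p≤q))
        (solve 2 (λ p q → q :- con ½ :* (p :+ q) := con ½ :* (q :- p)) refl p q)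

      next : Interval → Interval
      next I with B? (midpoint (lo I) (hi I))
      ... | yes Bmid = record I { hi = _ ; lo≤hi = lo≤mid (lo≤hi I) ; Bhi = Bmid }
      ... | no ¬Bmid = record I { lo = _ ; lo≤hi = mid≤hi (lo≤hi I) ; ¬Blo = ¬Bmid }

      next-gap : ∀ I → hi (next I) ℚ.- lo (next I) ≡ ½ ℚ.* (hi I ℚ.- lo I)
      next-gap I with B? (midpoint (lo I) (hi I))
      ... | yes _ = solve 2 (λ p q → con ½ :* (p :+ q) :- p := con ½ :* (q :- p)) refl (lo I) (hi I)
      ... | no _  = solve 2 (λ p q → q :- con ½ :* (p :+ q) := con ½ :* (q :- p)) refl (lo I) (hi I)

      next-lo : ∀ I → lo I ℚ.≤ lo (next I)
      next-lo I with B? (midpoint (lo I) (hi I))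
      ... | yes _ = ℚ.≤-refl
      ... | no _  = lo≤mid (lo≤hi I)

      next-hi : ∀ I → hi (next I) ℚ.≤ hi I
      next-hi I with B? (midpoint (lo I) (hi I))
      ... | yes _ = mid≤hi (lo≤hi I)
      ... | no _  = ℚ.≤-refl

    interval : ℕ → Interval
    interval zero    = record { lo = u ; hi = v ; lo≤hi = u≤v ; ¬Blo = ¬Bu ; Bhi = Bv }
    interval (suc n) = next (interval n)

    gap : ∀ n → hi (interval n) ℚ.- lo (interval n) ≡ (v ℚ.- u) ℚ.* ½^ n
    gap zero    = ≡.sym (ℚ.*-identityʳ (v ℚ.- u))
    gap (suc n) = ≡.trans (next-gap (interval n)) (≡.trans (cong (½ ℚ.*_) (gap n))
      (solve 2 (λ d h → con ½ :* (d :* h) := d :* (con ½ :* h)) refl (v ℚ.- u) (½^ n)))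

    lo-mono : ∀ {m n} → m ℕ.≤ n → lo (interval m) ℚ.≤ lo (interval n)
    lo-mono {m} {n} m≤n with ℕ.m≤n⇒m<n∨m≡n m≤n
    ... | inj₂ refl = ℚ.≤-refl
    lo-mono {m} {suc n} m≤n | inj₁ m<1+n = ℚ.≤-trans (lo-mono (ℕ.≤-pred m<1+n)) (next-lo (interval n))

    hi-mono : ∀ {m n} → m ℕ.≤ n → hi (interval n) ℚ.≤ hi (interval m)
    hi-mono {m} {n} m≤n with ℕ.m≤n⇒m<n∨m≡n m≤n
    ... | inj₂ refl = ℚ.≤-refl
    hi-mono {m} {suc n} m≤n | inj₁ m<1+n = ℚ.≤-trans (next-hi (interval n)) (hi-mono (ℕ.≤-pred m<1+n))

    private
      within : ∀ {a b p q ε} → b ℚ.- a ℚ.≤ ε → a ℚ.≤ p → p ℚ.≤ b → a ℚ.≤ q → q ℚ.≤ b → ∣ p ℚ.- q ∣ ℚ.≤ ε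
      within {a} {b} {p} {q} {ε} b-a≤ε a≤p p≤b a≤q q≤b = ∣∣≤
        (≤-by (0≤+ (≤⇒0≤ b-a≤ε) (0≤+ (≤⇒0≤ p≤b) (≤⇒0≤ a≤q)))
          (solve 5 (λ a b p q ε → ε :- (p :- q) := ε :- (b :- a) :+ (b :- p :+ (q :- a))) refl a b p q ε))
        (≤-by (0≤+ (≤⇒0≤ b-a≤ε) (0≤+ (≤⇒0≤ q≤b) (≤⇒0≤ a≤p)))
          (solve 5 (λ a b p q ε → ε :- :- (p :- q) := ε :- (b :- a) :+ (b :- q :+ (p :- a))) refl a b p q ε))

      small : ∀ {ε} → 0ℚ ℚ.< ε →
              ∃[ N ] hi (interval N) ℚ.- lo (interval N) ℚ.≤ ε
      small 0<ε = let N , h = vanishing (v ℚ.- u) 0<ε in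
        N , ℚ.≤-trans (ℚ.≤-reflexive (gap N)) (h N ℕ.≤-refl)

      lo≤hi′ : ∀ {m n} → m ℕ.≤ n → lo (interval n) ℚ.≤ hi (interval m)
      lo≤hi′ {n = n} m≤n = ℚ.≤-trans (lo≤hi (interval n)) (hi-mono m≤n)

      lo≤hi″ : ∀ {m n} → m ℕ.≤ n → lo (interval m) ℚ.≤ hi (interval n)
      lo≤hi″ {n = n} m≤n = ℚ.≤-trans (lo-mono m≤n) (lo≤hi (interval n))

    lower upper : ℝ
    lower = mkℝ (λ n → lo (interval n)) λ ε 0<ε →
      let N , g = small 0<ε in
      N , λ m n N≤m N≤n → within g (lo-mono N≤m) (lo≤hi′ N≤m) (lo-mono N≤n) (lo≤hi′ N≤n)
    upper = mkℝ (λ n → hi (interval n)) λ ε 0<ε →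
      let N , g = small 0<ε in
      N , λ m n N≤m N≤n → within g (lo≤hi″ N≤m) (hi-mono N≤m) (lo≤hi″ N≤n) (hi-mono N≤n)

    lower≃upper : lower ≃ upper
    lower≃upper ε 0<ε =
      let N , g = small 0<ε in
      N , λ n N≤n → within g (lo-mono N≤n) (lo≤hi′ N≤n) (lo≤hi″ N≤n) (hi-mono N≤n)

  record Extension (φ : ℚ → ℚ) (F : ℝ → ℝ) : Set where
    field
      extends   : ∀ x n → seq (F x) n ≡ φ (seq x n)
      congruent : ∀ {x y} → x ≃ y → F x ≃ F y

  open Extension

  -- φ ≤ 0 along `lower`, φ > 0 along `upper`, and the two reals agree. The root is presented as
  -- `upper` because its terms are rational points with φ > 0, which are used as samples later.
  intermediateValue : ∀ {φ F} → Extension φ F → ∀ {u v} → u ℚ.≤ v → φ u ℚ.≤ 0ℚ → 0ℚ ℚ.< φ v →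
                      ∃[ x ] F x ≃ 0ℝ × (∀ n → u ℚ.≤ seq x n × seq x n ℚ.≤ v × 0ℚ ℚ.< φ (seq x n))
  intermediateValue {φ} {F} E {u} {v} u≤v φu≤0 0<φv =
    upper ,
    ≤ʳ-antisym {F upper} {0ℝ}
      (≤ʳ-trans {F upper} {F lower} {0ℝ}
        (≃⇒≤ {F upper} {F lower} (congruent E (≃-sym {lower} {upper} lower≃upper)))
        (≤-pointwise {F lower} {0ℝ} λ n →
          subst (ℚ._≤ 0ℚ) (≡.sym (extends E lower n)) (ℚ.≮⇒≥ (¬Blo (interval n)))))
      (≤-pointwise {0ℝ} {F upper} λ n →
        subst (0ℚ ℚ.≤_) (≡.sym (extends E upper n)) (ℚ.<⇒≤ (Bhi (interval n)))) ,
    λ n → ℚ.≤-trans (lo-mono {0} {n} ℕ.z≤n) (lo≤hi (interval n)) , hi-mono {0} {n} ℕ.z≤n , Bhi (interval n)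
    where
    open Bisection {λ x → 0ℚ ℚ.< φ x} (λ x → 0ℚ ℚ.<? φ x) u≤v (λ 0<φu → ≮ 0<φu φu≤0) 0<φv

  2ℚ 4ℚ : ℚ
  2ℚ = 1ℚ ℚ.+ 1ℚ
  4ℚ = 2ℚ ℚ.+ 2ℚ

  0<2 : 0ℚ ℚ.< 2ℚ
  0<2 = ℚ.positive⁻¹ 2ℚ

  private
    1<4 : 1ℚ ℚ.< 2ℚ ℚ.* 2ℚ
    1<4 = <-by (ℚ.positive⁻¹ (1ℚ ℚ.+ 2ℚ)) refl

    module Root (v : ℚ) (0≤v : 0ℚ ℚ.≤ v) (v≤1 : v ℚ.≤ 1ℚ) where
      open Bisection {λ x → v ℚ.< x ℚ.* x} (λ x → v ℚ.<? x ℚ.* x) {0ℚ} {2ℚ} (ℚ.<⇒≤ 0<2)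
        (λ v<0 → ≮ v<0 0≤v) (ℚ.≤-<-trans v≤1 1<4) public

      approximate : ∀ n → ∃[ r ] 0ℚ ℚ.≤ r × r ℚ.* r ℚ.≤ v × v ℚ.- r ℚ.* r ℚ.≤ (4ℚ ℚ.+ 4ℚ) ℚ.* ½^ n
      approximate n =
        let r = lo (interval n)
            s = hi (interval n)
            0≤r = lo-mono {0} {n} ℕ.z≤n
            s≤2 = hi-mono {0} {n} ℕ.z≤n
            r≤s = lo≤hi (interval n)
            s-r≡ : s ℚ.- r ≡ 2ℚ ℚ.* ½^ n
            s-r≡ = gap n
        in r , 0≤r , ℚ.≮⇒≥ (¬Blo (interval n)) ,
          -- v < s² and s² - r² = (s - r)(s + r), where s - r = 2 · ½^n and s + r ≤ 4; this gives
          -- the constant 8.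
          ≤-by (0≤+ (<⇒≤′ (Bhi (interval n)))
              (0≤* (≤⇒0≤ r≤s) (0≤+ (≤⇒0≤ s≤2) (≤⇒0≤ (ℚ.≤-trans r≤s s≤2)))))
            (≡.trans (cong (ℚ._- (v ℚ.- r ℚ.* r))
                (≡.trans
                  (solve 1 (λ h → con (4ℚ ℚ.+ 4ℚ) :* h := con 4ℚ :* (con 2ℚ :* h)) refl (½^ n))
                  (cong (4ℚ ℚ.*_) (≡.sym s-r≡))))
              (solve 3 (λ r s v → con 4ℚ :* (s :- r) :- (v :- r :* r)
                := s :* s :- v :+ (s :- r) :* (con 2ℚ :- s :+ (con 2ℚ :- r))) refl r s v))
        where
        <⇒≤′ : ∀ {p q} → p ℚ.< q → 0ℚ ℚ.≤ q ℚ.- p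
        <⇒≤′ p<q = ≤⇒0≤ (ℚ.<⇒≤ p<q)


    abstract
      rationalRoot : ∀ v → 0ℚ ℚ.≤ v → v ℚ.≤ 1ℚ → ∀ n →
        ∃[ r ] 0ℚ ℚ.≤ r × r ℚ.* r ℚ.≤ v × v ℚ.- r ℚ.* r ℚ.≤ (4ℚ ℚ.+ 4ℚ) ℚ.* ½^ n
      rationalRoot = Root.approximate

    -- (a − b)² ≤ a² − b² when 0 ≤ b ≤ a.
    roots-close : ∀ {a b x y ε} → 0ℚ ℚ.< ε → 0ℚ ℚ.≤ b → a ℚ.* a ℚ.≤ x →
                  y ℚ.- b ℚ.* b ℚ.≤ ½ ℚ.* (ε ℚ.* ε) → ∣ x ℚ.- y ∣ ℚ.≤ ½ ℚ.* (ε ℚ.* ε) →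
                  a ℚ.- b ℚ.≤ ε
    roots-close {a} {b} {x} {y} {ε} 0<ε 0≤b a²≤x y-b²≤ x-y≤ with a ℚ.- b ℚ.≤? ε
    ... | yes p = p
    ... | no ¬p = contradiction
      (≤-by {a ℚ.* a ℚ.- b ℚ.* b} {ε ℚ.* ε}
        (0≤+ (0≤+ (≤⇒0≤ a²≤x) (≤⇒0≤ y-b²≤)) (≤⇒0≤ (ℚ.≤-trans (p≤∣p∣ (x ℚ.- y)) x-y≤)))
        (solve 5 (λ a b x y e → e :- (a :- b) :=
            x :- a :+ (con ½ :* e :- (y :- b)) :+ (con ½ :* e :- (x :- y))) refl
          (a ℚ.* a) (b ℚ.* b) x y (ε ℚ.* ε)))
      (≮ (<-by {q = a ℚ.* a ℚ.- b ℚ.* b}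
        (0<+≤ (0<* (<⇒0< ε<d) (0<+≤ 0<ε (ℚ.<⇒≤ (ℚ.<-trans 0<ε ε<d))))
              (0≤* (0≤+ 0≤b 0≤b) (ℚ.<⇒≤ (ℚ.<-trans 0<ε ε<d))))
        (solve 3 (λ a b ε → a :* a :- b :* b :- ε :* ε :=
            (a :- b :- ε) :* (ε :+ (a :- b)) :+ (b :+ b) :* (a :- b)) refl a b ε)))
      where ε<d = ℚ.≰⇒> ¬p

  module _ (x : ℝ) (bounds : ∀ n → 0ℚ ℚ.≤ seq x n × seq x n ℚ.≤ 1ℚ) where

    private
      root : ∀ n → ∃[ r ] 0ℚ ℚ.≤ r × r ℚ.* r ℚ.≤ seq x n × seq x n ℚ.- r ℚ.* r ℚ.≤ (4ℚ ℚ.+ 4ℚ) ℚ.* ½^ n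
      root n = rationalRoot (seq x n) (proj₁ (bounds n)) (proj₂ (bounds n)) n

      root-cauchy : CauchySequence λ n → proj₁ (root n)
      root-cauchy ε 0<ε =
        let 0<d = 0<½* (0<* 0<ε 0<ε)
            M , hx = cauchy x (½ ℚ.* (ε ℚ.* ε)) 0<d
            N , hr = vanishing (4ℚ ℚ.+ 4ℚ) {½ ℚ.* (ε ℚ.* ε)} 0<d
        in M ℕ.⊔ N , λ m n R≤m R≤n →
          let a , 0≤a , a²≤x , x-a²≤ = root m
              b , 0≤b , b²≤y , y-b²≤ = root n
              M≤m = ℕ.m⊔n≤o⇒m≤o M N R≤m
              M≤n = ℕ.m⊔n≤o⇒m≤o M N R≤n
          in ∣∣≤ {a ℚ.- b} {ε}
            (roots-close {a} {b} {seq x m} {seq x n} 0<ε 0≤b a²≤x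
              (ℚ.≤-trans y-b²≤ (hr n (ℕ.m⊔n≤o⇒n≤o M N R≤n))) (hx m n M≤m M≤n))
            (subst (ℚ._≤ ε) (solve 2 (λ a b → b :- a := :- (a :- b)) refl a b)
              (roots-close {b} {a} {seq x n} {seq x m} 0<ε 0≤a b²≤y
                (ℚ.≤-trans x-a²≤ (hr m (ℕ.m⊔n≤o⇒n≤o M N R≤m))) (hx n m M≤n M≤m)))

    -- Term n is an approximate root of term n of x, with an error 8 · ½^n in the square, so no root
    -- of the real x is extracted directly.
    squareRoot : ∃[ y ] y *ʳ y ≃ x
    squareRoot = mkℝ (λ n → proj₁ (root n)) root-cauchy , λ ε 0<ε →
      let N , h = vanishing (4ℚ ℚ.+ 4ℚ) {ε} 0<ε in
      N , λ n N≤n →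
        let r , 0≤r , r²≤x , x-r²≤ = root n in
        ∣∣≤ {r ℚ.* r ℚ.- seq x n} {ε}
          (ℚ.≤-trans {j = 0ℚ} (≤-by {r ℚ.* r ℚ.- seq x n} {0ℚ} (≤⇒0≤ r²≤x)
            (solve 2 (λ s x → con 0ℚ :- (s :- x) := x :- s) refl (r ℚ.* r) (seq x n))) (ℚ.<⇒≤ 0<ε))
          (subst (ℚ._≤ ε) (solve 2 (λ s x → x :- s := :- (s :- x)) refl (r ℚ.* r) (seq x n))
            (ℚ.≤-trans x-r²≤ (h n N≤n)))

-- Rational points at which D alternates in sign.

module Samples where

  open import Data.Nat.Base as ℕ using (ℕ; zero; suc; z≤n; s≤s)
  import Data.Nat.Properties as ℕ
  open import Data.Product.Base using (∃-syntax; _×_; _,_; proj₁; proj₂)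
  open import Data.Rational.Base as ℚ using (ℚ; 0ℚ; 1ℚ; ½; ∣_∣)
  import Data.Rational.Properties as ℚ
  open import Data.Rational.Solver using (module +-*-Solver)
  open import Data.Sum.Base using (inj₁; inj₂)
  open import Level using (0ℓ)
  open import Relation.Binary.PropositionalEquality as ≡ using (_≡_; refl; cong; cong₂; subst)
  open import Relation.Nullary.Negation using (¬_)
  open import Defs hiding (_+_; _*_; -_; _^_)
  open Rationals
  open Reals
  open RealRoots
  open +-*-Solver

  module ℚC = Chebyshev ℚ.+-*-commutativeRing
  module ℝC = Chebyshev ℝ-commutativeRing

  seq-S : ∀ x n m → seq (ℝC.S x n) m ≡ ℚC.S (seq x m) n
  seq-S x zero          m = refl
  seq-S x (suc zero)    m = refl
  seq-S x (suc (suc n)) m = cong₂ (λ s t → seq x m ℚ.* s ℚ.- t) (seq-S x (suc n) m) (seq-S x n m)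

  seq-C : ∀ x n m → seq (ℝC.C x n) m ≡ ℚC.C (seq x m) n
  seq-C x zero          m = refl
  seq-C x (suc zero)    m = refl
  seq-C x (suc (suc n)) m = cong₂ (λ s t → seq x m ℚ.* s ℚ.- t) (seq-C x (suc n) m) (seq-C x n m)

  seq-D : ∀ k x m → seq (ℝC.D k x) m ≡ ℚC.D k (seq x m)
  seq-D k x m = cong₂ (λ s t → s ℚ.+ t ℚ.- seq x m ℚ.- 2ℚ) (seq-C x (suc k) m) (seq-C x k m)

  seq-sign : ∀ i m → seq (ℝC.sign i) m ≡ ℚC.sign i
  seq-sign zero    m = refl
  seq-sign (suc i) m = cong ℚ.-_ (seq-sign i m)

  PositiveS : ℕ → ℚ → Set
  PositiveS n x = ∀ j → j ℕ.< n → 0ℚ ℚ.< ℚC.S x (suc j)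

  private
    -- As long as S x is positive, the ratios S x (j + 1) / S x j increase with x.
    monotone : ∀ {x y n} → x ℚ.≤ y → PositiveS n x → ∀ j → j ℕ.< n →
               0ℚ ℚ.≤ ℚC.S y (suc j) ℚ.* ℚC.S x j ℚ.- ℚC.S y j ℚ.* ℚC.S x (suc j) ×
               ℚC.S x (suc j) ℚ.≤ ℚC.S y (suc j)
    monotone {x} {y} x≤y pos zero _ = ℚ.≤-refl , ℚ.≤-refl
    monotone {x} {y} x≤y pos (suc j) j<n =
      let j<n′ = ℕ.<-trans ℕ.≤-refl j<n
          w , x≤y′ = monotone x≤y pos j j<n′
          a = ℚC.S x (suc j)
          a′ = ℚC.S x (suc (suc j))
          b = ℚC.S y (suc j)
          b′ = ℚC.S y (suc (suc j))
          0<a = pos j j<n′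
          0<b = ℚ.<-≤-trans 0<a x≤y′
          w′ = subst (0ℚ ℚ.≤_) (≡.sym (ℚC.christoffel x y j))
                 (0≤+ w (0≤* (≤⇒0≤ x≤y) (0≤* (ℚ.<⇒≤ 0<b) (ℚ.<⇒≤ 0<a))))
      -- The sum of the determinant w′ and (b - a) a′ is a (b′ - a′), and a > 0 is cancelled.
      in w′ , ≤-by {a′} {b′}
        (0≤-cancel {a} {b′ ℚ.- a′} 0<a
          (subst (0ℚ ℚ.≤_)
            (solve 4 (λ a a′ b b′ → b′ :* a :- b :* a′ :+ (b :- a) :* a′ := a :* (b′ :- a′)) refl a a′ b b′)
            (0≤+ w′ (0≤* (≤⇒0≤ x≤y′) (ℚ.<⇒≤ (pos (suc j) j<n))))))
        refl

  S-mono : ∀ {x y n} → x ℚ.≤ y → PositiveS n x → ∀ j → j ℕ.< n → ℚC.S x (suc j) ℚ.≤ ℚC.S y (suc j)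
  S-mono x≤y pos j j<n = proj₂ (monotone x≤y pos j j<n)

  S-at-2 : ∀ n → ℚC.S 2ℚ n ≡ fromℕ n
  S-at-2 zero          = refl
  S-at-2 (suc zero)    = refl
  S-at-2 (suc (suc n)) = ≡.trans (cong₂ (λ s t → 2ℚ ℚ.* s ℚ.- t) (S-at-2 (suc n)) (S-at-2 n))
    (≡.trans (cong (λ s → 2ℚ ℚ.* s ℚ.- fromℕ n) (fromℕ-suc n))
      (≡.trans (solve 1 (λ m → con 2ℚ :* (con 1ℚ :+ m) :- m := con 1ℚ :+ (con 1ℚ :+ m)) refl (fromℕ n))
        (≡.trans (cong (1ℚ ℚ.+_) (≡.sym (fromℕ-suc n))) (≡.sym (fromℕ-suc (suc n))))))

  0<S-at-2 : ∀ n → 0ℚ ℚ.< ℚC.S 2ℚ (suc n)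
  0<S-at-2 n = subst (0ℚ ℚ.<_) (≡.sym (≡.trans (S-at-2 (suc n)) (fromℕ-suc n)))
    (0<+≤ 0<1 (0≤fromℕ n))

  S-extension : ∀ n → Extension (λ x → ℚC.S x n) (λ x → ℝC.S x n)
  S-extension n = record
    { extends   = λ x m → seq-S x n m
    ; congruent = λ {x} {y} x≃y → ℝC.S-cong {x} {y} x≃y n }

  rootOfS : ∀ n {x} → x ℚ.≤ 2ℚ → ℚC.S x (suc n) ℚ.< 0ℚ →
            ∃[ r ] ℝC.S r (suc n) ≃ 0ℝ ×
            (∀ m → x ℚ.≤ seq r m × seq r m ℚ.≤ 2ℚ × 0ℚ ℚ.< ℚC.S (seq r m) (suc n))
  rootOfS n x≤2 S<0 = intermediateValue (S-extension (suc n)) x≤2 (ℚ.<⇒≤ S<0) (0<S-at-2 n)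

  -- Just above the largest root of S_(n+2), S_(n+3) is negative.
  signChange : ∀ n → ∃[ x ] x ℚ.≤ 2ℚ × PositiveS (suc n) x × ℚC.S x (suc (suc n)) ℚ.< 0ℚ
  signChange zero =
    ℚ.- 1ℚ , -1≤2 , (λ { zero _ → 0<1 ; (suc _) (s≤s ()) }) , ℚ.negative⁻¹ (ℚ.- 1ℚ)
    where
    -1≤2 : ℚ.- 1ℚ ℚ.≤ 2ℚ
    -1≤2 = ≤-by {r = 2ℚ ℚ.+ 1ℚ} (0≤+ (ℚ.<⇒≤ 0<2) 0≤1) refl
  signChange (suc n) =
    let x , x≤2 , pos , S<0 = signChange n
        r , root , bounds = rootOfS (suc n) x≤2 S<0
        -- Accuracy ½ is enough: if the next value y s - p were nonnegative, `cassini` would give 1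
        -- = s² - p (y s - p) ≤ s² ≤ ¼.
        m , ∣S∣≤½ = witness (root ½ 0<½)
        y = seq r m
        x≤y , y≤2 , 0<S = bounds m
        p = ℚC.S y (suc n)
        s = ℚC.S y (suc (suc n))
        s≤½ : s ℚ.≤ ½
        s≤½ = ℚ.≤-trans (p≤∣p∣ s) (subst (λ t → ∣ t ∣ ℚ.≤ ½)
          (≡.trans (cong (ℚ._- 0ℚ) (seq-S r (suc (suc n)) m)) (solve 1 (λ s → s :- con 0ℚ := s) refl s))
          ∣S∣≤½)
        0<p = ℚ.<-≤-trans (pos n ℕ.≤-refl) (S-mono x≤y pos n ℕ.≤-refl)
    in y , y≤2 , positive {x} {y} x≤y pos 0<S , ℚ.≰⇒> λ 0≤S →
      negative {y} {p} {s} (ℚC.cassini y (suc n)) 0<S s≤½ (ℚ.<⇒≤ 0<p) 0≤S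
    where
    positive : ∀ {x y} → x ℚ.≤ y → PositiveS (suc n) x → 0ℚ ℚ.< ℚC.S y (suc (suc n)) →
               PositiveS (suc (suc n)) y
    positive x≤y pos 0<S j (s≤s j≤) with ℕ.m≤n⇒m<n∨m≡n j≤
    ... | inj₁ j<  = ℚ.<-≤-trans (pos j j<) (S-mono x≤y pos j j<)
    ... | inj₂ refl = 0<S

    negative : ∀ {y p s} → s ℚ.* s ℚ.- y ℚ.* s ℚ.* p ℚ.+ p ℚ.* p ≡ 1ℚ → 0ℚ ℚ.< s → s ℚ.≤ ½ →
               0ℚ ℚ.≤ p → ¬ 0ℚ ℚ.≤ y ℚ.* s ℚ.- p
    negative {y} {p} {s} cassini 0<s s≤½ 0≤p h = ℚ.<-irrefl refl (ℚ.<-≤-trans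
      (<-by {1ℚ ℚ.- ½ ℚ.* ½} {1ℚ} {½ ℚ.* ½} (0<* 0<½ 0<½) refl)
      (≤-by {1ℚ} {1ℚ ℚ.- ½ ℚ.* ½}
        (0≤+ (0≤* 0≤p h) (0≤+ (0≤* (≤⇒0≤ s≤½) (0≤+ (ℚ.<⇒≤ 0<s) (ℚ.<⇒≤ 0<½))) (ℚ.<⇒≤ 0<½)))
        (≡.trans (cong (λ t → 1ℚ ℚ.- ½ ℚ.* ½ ℚ.- t) (≡.sym cassini))
          (≡.trans
            (solve 3 (λ y p s → con 1ℚ :- con ½ :* con ½ :- (s :* s :- y :* s :* p :+ p :* p)
              := p :* (y :* s :- p) :+ ((con ½ :- s) :* (s :+ con ½) :+ con ½))
              refl y p s) refl))))

  ℝ-positiveCone : Positivity.PositiveCone ℝ-commutativeRing 0ℓ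
  ℝ-positiveCone = record
    { Pos        = 0<ʳ_
    ; Pos-resp   = λ {x} {y} → 0<ʳ-resp {x} {y}
    ; Pos-1      = 1ℚ , 0<1 , always λ _ → ℚ.≤-refl
    ; Pos-+      = λ {x} {y} → 0<ʳ-+ {x} {y}
    ; Pos-*      = λ {x} {y} → 0<ʳ-* {x} {y}
    ; Pos-cancel = λ {x} {y} → 0<ʳ-cancel {x} {y}
    ; domain     = λ {x} {y} h 0<x → domain {x} {y} h (0<ʳ⇒≄0 {x} 0<x)
    }

  private
    module AtAngle
      (k : ℕ) (1≤k : 1 ℕ.≤ k) (c : ℝ)
      (S≃0 : ℝC.S c (suc (k ℕ.+ k)) ≃ 0ℝ) (0<S : ∀ j → j ℕ.< k ℕ.+ k → 0<ʳ ℝC.S c (suc j))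
      where

      module P = Positivity.Signs ℝ-commutativeRing ℝ-positiveCone
      module A = P.AtAngle 1≤k c S≃0 0<S

      -- The strict inequalities for the real c, stated for term m of its sequence. Each holds
      -- eventually, so finitely many of them hold at one rational term.
      Good : ℕ → ℕ → Set
      Good zero    m = 0ℚ ℚ.< (1ℚ ℚ.+ 1ℚ ℚ.+ 1ℚ ℚ.+ 1ℚ) ℚ.- seq c m ℚ.* seq c m
      Good (suc i) m = 0ℚ ℚ.< ℚC.C (seq c m) (suc i) ×
        0ℚ ℚ.< ℚC.sign (suc i) ℚ.* ℚC.D k (ℚC.C (seq c m) (suc i ℕ.+ suc i))

      seq-sign*D : ∀ i m → seq (ℝC.sign i *ʳ ℝC.D k (ℝC.C c (i ℕ.+ i))) m ≡
                   ℚC.sign i ℚ.* ℚC.D k (ℚC.C (seq c m) (i ℕ.+ i))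
      seq-sign*D i m = cong₂ ℚ._*_ (seq-sign i m)
        (≡.trans (seq-D k (ℝC.C c (i ℕ.+ i)) m) (cong (ℚC.D k) (seq-C c (i ℕ.+ i) m)))

      eventuallyGood : ∀ i → i ℕ.≤ k → Eventually (Good i)
      eventuallyGood zero    _   = 0<ʳ⇒0< {ℝC.4# +ʳ -ʳ (c *ʳ c)} A.Pos-4-x²
      eventuallyGood (suc i) i<k = both
        (λ {m} p q → subst (0ℚ ℚ.<_) (seq-C c (suc i) m) p , subst (0ℚ ℚ.<_) (seq-sign*D (suc i) m) q)
        (0<ʳ⇒0< {ℝC.C c (suc i)} (A.Pos-C i<k))
        (0<ʳ⇒0< {ℝC.sign (suc i) *ʳ ℝC.D k (ℝC.C c (suc i ℕ.+ suc i))} (A.Pos-sign*D i<k))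

      good : ∃[ m ] (∀ i → i ℕ.≤ k → Good i m)
      good = witness (allBelow {Good} k eventuallyGood)

  -- A rational approximation of 2 cos (π / (2k + 1)).
  cosine : ∀ k → 1 ℕ.≤ k →
    ∃[ x ] 0ℚ ℚ.< (1ℚ ℚ.+ 1ℚ ℚ.+ 1ℚ ℚ.+ 1ℚ) ℚ.- x ℚ.* x × PositiveS (k ℕ.+ k) x ×
      (∀ i → i ℕ.< k → 0ℚ ℚ.< ℚC.C x (suc i)) ×
      (∀ i → i ℕ.< k → 0ℚ ℚ.< ℚC.sign (suc i) ℚ.* ℚC.D k (ℚC.C x (suc i ℕ.+ suc i)))
  cosine k 1≤k =
    let x , x≤2 , pos , S<0 = subst (λ n → ∃[ x ] x ℚ.≤ 2ℚ × PositiveS n x × ℚC.S x (suc n) ℚ.< 0ℚ)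
          (ℕ.suc-pred (k ℕ.+ k) {{ℕ.>-nonZero (ℕ.≤-trans 1≤k (ℕ.m≤m+n k k))}})
          (signChange (ℕ.pred (k ℕ.+ k)))
        c , S≃0 , bounds = rootOfS (k ℕ.+ k) x≤2 S<0
        -- All terms of c lie above x, so the positive rationals `ℚC.S x (suc j)` are uniform lower
        -- bounds, as positivity in ℝ demands.
        above = λ m j j<2k → S-mono {x} {seq c m} (proj₁ (bounds m)) pos j j<2k
        m , good = AtAngle.good k 1≤k c S≃0 λ j j<2k →
          ℚC.S x (suc j) , pos j j<2k , always λ m →
            subst (ℚC.S x (suc j) ℚ.≤_) (≡.sym (seq-S c (suc j) m)) (above m j j<2k)
    in seq c m , good 0 z≤n , (λ j j<2k → ℚ.<-≤-trans (pos j j<2k) (above m j j<2k)) ,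
       (λ i i<k → proj₁ (good (suc i) i<k)) , (λ i i<k → proj₂ (good (suc i) i<k))

-- The k + 1 small roots of R.

module TraceRoots where

  open import Algebra.Bundles using (CommutativeRing)
  open import Data.Fin.Base as Fin using (Fin; toℕ)
  import Data.Fin.Properties as Fin
  open import Data.Nat.Base as ℕ using (ℕ; zero; suc; z≤n; s≤s)
  import Data.Nat.Properties as ℕ
  open import Data.Product.Base using (∃-syntax; _×_; _,_; proj₁; proj₂)
  open import Data.Rational.Base as ℚ using (ℚ; 0ℚ; 1ℚ)
  import Data.Rational.Properties as ℚ
  open import Data.Rational.Solver using (module +-*-Solver)
  open import Data.Sum.Base using (inj₁; inj₂)
  open import Relation.Binary.Definitions using (tri<; tri≈; tri>)
  open import Relation.Binary.PropositionalEquality as ≡ using (_≡_; _≢_; refl; cong; cong₂; subst; subst₂)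
  open import Relation.Nullary.Decidable.Core using (yes; no)
  open import Relation.Nullary.Negation using (¬_; contradiction)
  open import Defs hiding (_+_; _*_; -_; _^_)
  open Rationals
  open Reals
  open RealRoots
  open Samples
  open +-*-Solver

  -1≤sign : ∀ i → ℚ.- 1ℚ ℚ.≤ ℚC.sign i × ℚC.sign i ℚ.≤ 1ℚ
  -1≤sign zero    = ≤-by {r = 2ℚ} (ℚ.<⇒≤ 0<2) refl , ℚ.≤-refl
  -1≤sign (suc i) = let l , u = -1≤sign i in ℚ.neg-antimono-≤ u , ℚ.neg-antimono-≤ l

  seq-trace : ∀ k a x n → seq (ℝC.trace k (ℚ⇒ℝ a) x) n ≡ ℚC.trace k a (seq x n)
  seq-trace k a x n = cong (λ d → (seq x n ℚ.- a) ℚ.* d ℚ.- 1ℚ) (seq-D k x n)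

  private
    -- σ R(t) = -(a - t) σ D(t) - σ, so (a - t) σ D(t) > 1 ≥ -σ suffices.
    negative : ∀ {σ a t d} → ℚ.- 1ℚ ℚ.≤ σ → 1ℚ ℚ.< (a ℚ.- t) ℚ.* (σ ℚ.* d) →
               σ ℚ.* ((t ℚ.- a) ℚ.* d ℚ.- 1ℚ) ℚ.< 0ℚ
    negative {σ} {a} {t} {d} -1≤σ h = <-by
      (0<+≤ (<⇒0< h) (≤⇒0≤ -1≤σ))
      (solve 4 (λ σ a t d → con 0ℚ :- σ :* ((t :- a) :* d :- con 1ℚ)
        := (a :- t) :* (σ :* d) :- con 1ℚ :+ (σ :- :- con 1ℚ)) refl σ a t d)

    negative₀ : ∀ {σ a t d} → σ ≡ 1ℚ → d ≡ 0ℚ → σ ℚ.* ((t ℚ.- a) ℚ.* d ℚ.- 1ℚ) ℚ.< 0ℚ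
    negative₀ {a = a} {t} refl refl = <-by 0<1
      (solve 2 (λ a t → con 0ℚ :- con 1ℚ :* ((t :- a) :* con 0ℚ :- con 1ℚ) := con 1ℚ) refl a t)

    large : ∀ t {δ} → 0ℚ ℚ.< δ → Eventually λ a → 1ℚ ℚ.< (fromℕ a ℚ.- t) ℚ.* δ
    large t {δ} 0<δ =
      let r , 0<r , δr≡1 = inverse 0<δ
          N , h = archimedean (t ℚ.+ r ℚ.+ 1ℚ) in
      N , λ a N≤a → <-by {r = (fromℕ a ℚ.- (t ℚ.+ r ℚ.+ 1ℚ)) ℚ.* δ ℚ.+ δ}
        (0≤+< (0≤* (≤⇒0≤ (ℚ.≤-trans h (fromℕ-mono {N} {a} N≤a))) (ℚ.<⇒≤ 0<δ)) 0<δ)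
        (≡.trans (cong (λ e → (fromℕ a ℚ.- t) ℚ.* δ ℚ.- e) (≡.sym δr≡1))
          (solve 4 (λ a t δ r → (a :- t) :* δ :- δ :* r
            := (a :- (t :+ r :+ con 1ℚ)) :* δ :+ δ) refl (fromℕ a) t δ r))

  record SamplePoints (k : ℕ) : Set where
    field
      τ          : ℕ → ℚ
      first      : τ 0 ≡ 2ℚ
      last       : τ (suc k) ≡ ℚ.- 2ℚ
      decreasing : ∀ i → i ℕ.≤ k → τ (suc i) ℚ.< τ i
      threshold  : ℕ
      alternates : ∀ a → threshold ℕ.≤ a → ∀ i → i ℕ.≤ suc k →
                   ℚC.sign i ℚ.* ℚC.trace k (fromℕ a) (τ i) ℚ.< 0ℚ

  module SamplesFrom
    (k : ℕ) (1≤k : 1 ℕ.≤ k) (sign-last : ℚC.sign (suc k) ≡ 1ℚ) (x : ℚ)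
    (0<4-x²   : 0ℚ ℚ.< (1ℚ ℚ.+ 1ℚ ℚ.+ 1ℚ ℚ.+ 1ℚ) ℚ.- x ℚ.* x)
    (0<S      : PositiveS (k ℕ.+ k) x)
    (0<C      : ∀ i → i ℕ.< k → 0ℚ ℚ.< ℚC.C x (suc i))
    (0<sign*D : ∀ i → i ℕ.< k → 0ℚ ℚ.< ℚC.sign (suc i) ℚ.* ℚC.D k (ℚC.C x (suc i ℕ.+ suc i)))
    where


    data Position : ℕ → Set where
      first  : Position 0
      inside : ∀ {i} → i ℕ.< k → Position (suc i)
      last   : Position (suc k)

    position : ∀ i → i ℕ.≤ suc k → Position i
    position zero    _        = first
    position (suc i) (s≤s i≤k) with ℕ.m≤n⇒m<n∨m≡n i≤k
    ... | inj₁ i<k  = inside i<k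
    ... | inj₂ refl = last

    -- The points 2 cos 2iθ with θ close to π/(2k + 1). For i = k + 1 the formula would, up to
    -- approximation, only repeat the point for i = k, so the end -2 of the interval takes its
    -- place.
    τ : ℕ → ℚ
    τ i with i ℕ.≤? k
    ... | yes _ = ℚC.C x (i ℕ.+ i)
    ... | no _  = ℚ.- 2ℚ

    τ-inside : ∀ {i} → i ℕ.≤ k → τ i ≡ ℚC.C x (i ℕ.+ i)
    τ-inside {i} i≤k with i ℕ.≤? k
    ... | yes _  = refl
    ... | no i≰k = contradiction i≤k i≰k

    τ-last : τ (suc k) ≡ ℚ.- 2ℚ
    τ-last with suc k ℕ.≤? k
    ... | yes k<k = contradiction k<k ℕ.1+n≰n
    ... | no _    = refl

    decreasing : ∀ i → i ℕ.≤ k → τ (suc i) ℚ.< τ i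
    decreasing i i≤k with ℕ.m≤n⇒m<n∨m≡n i≤k
    ... | inj₁ i<k = subst₂ ℚ._<_
      (≡.sym (≡.trans (τ-inside i<k) (cong (λ n → ℚC.C x (suc n)) (ℕ.+-suc i i))))
      (≡.sym (τ-inside i≤k))
      (<-by (0<* 0<4-x² (0<S (i ℕ.+ i) (ℕ.+-mono-< i<k i<k))) (ℚC.C-C x (i ℕ.+ i)))
    -- C(2k) + 2 = C(k)², and C(k) > 0.
    ... | inj₂ refl = subst₂ ℚ._<_ (≡.sym τ-last) (≡.sym (τ-inside i≤k))
      (<-by (0<* 0<C-last 0<C-last) (ℚC.C-double x k))
      where
      0<C-last : 0ℚ ℚ.< ℚC.C x k
      0<C-last = subst (λ n → 0ℚ ℚ.< ℚC.C x n) (ℕ.suc-pred k {{ℕ.>-nonZero 1≤k}})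
        (0<C (ℕ.pred k) (ℕ.≤-reflexive (ℕ.suc-pred k {{ℕ.>-nonZero 1≤k}})))

    δ : ℕ → ℚ
    δ i = ℚC.sign i ℚ.* ℚC.D k (τ i)

    -- A common threshold for a over all sample points. The premise 0 < δ keeps the ends ±2 in the
    -- list, where D and hence δ vanish.
    big : Eventually λ a → ∀ i → i ℕ.≤ suc k → 0ℚ ℚ.< δ i → 1ℚ ℚ.< (fromℕ a ℚ.- τ i) ℚ.* δ i
    big = allBelow {λ i a → 0ℚ ℚ.< δ i → 1ℚ ℚ.< (fromℕ a ℚ.- τ i) ℚ.* δ i} (suc k) λ i _ → enough i
      where
      enough : ∀ i → Eventually λ a → 0ℚ ℚ.< δ i → 1ℚ ℚ.< (fromℕ a ℚ.- τ i) ℚ.* δ i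
      enough i with 0ℚ ℚ.<? δ i
      ... | yes 0<δ = let N , h = large (τ i) 0<δ in N , λ a N≤a _ → h a N≤a
      ... | no 0≮δ  = always λ _ 0<δ → contradiction 0<δ 0≮δ

    alternates : ∀ a → (∀ i → i ℕ.≤ suc k → 0ℚ ℚ.< δ i → 1ℚ ℚ.< (fromℕ a ℚ.- τ i) ℚ.* δ i) →
                 ∀ {i} → Position i → ℚC.sign i ℚ.* ℚC.trace k (fromℕ a) (τ i) ℚ.< 0ℚ
    alternates a h first = negative₀ {a = fromℕ a} {τ 0} refl (ℚC.D-at-2 k)
    alternates a h (inside {i} i<k) = negative {ℚC.sign (suc i)} {fromℕ a} {τ (suc i)} {ℚC.D k (τ (suc i))}
      (proj₁ (-1≤sign (suc i)))
      (h (suc i) (ℕ.m≤n⇒m≤1+n i<k)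
        (subst (λ t → 0ℚ ℚ.< ℚC.sign (suc i) ℚ.* ℚC.D k t) (≡.sym (τ-inside i<k)) (0<sign*D i i<k)))
    -- D vanishes at -2, so R is -1 there, which is the alternating sign only if k + 1 is even. This
    -- is why k is odd: for even k the last root of R would lie below -2.
    alternates a h last = negative₀ {a = fromℕ a} {τ (suc k)}
      sign-last
      (≡.trans (cong (ℚC.D k) τ-last) (ℚC.D-at--2 k))

    samplePoints : SamplePoints k
    samplePoints = record
      { τ = τ
      ; first = refl
      ; last = τ-last
      ; decreasing = decreasing
      ; threshold = proj₁ big
      ; alternates = λ a A≤a i i≤1+k → alternates a (proj₂ big a A≤a) (position i i≤1+k)
      }

  abstract
    samplePoints : ∀ m → SamplePoints (suc (m ℕ.+ m))
    samplePoints m =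
      let x , 0<4-x² , 0<S , 0<C , 0<sign*D = cosine (suc (m ℕ.+ m)) (s≤s z≤n) in
      SamplesFrom.samplePoints (suc (m ℕ.+ m)) (s≤s z≤n) (sign-last m) x 0<4-x² 0<S 0<C 0<sign*D
      where
      sign-last : ∀ m → ℚC.sign (suc (suc (m ℕ.+ m))) ≡ 1ℚ
      sign-last m = ≡.trans (solve 1 (λ s → :- :- s := s) refl (ℚC.sign (m ℕ.+ m))) (ℚC.sign-double m)

  module _
    {k} (P : SamplePoints k) (a : ℚ)
    (negative : ∀ i → i ℕ.≤ suc k → ℚC.sign i ℚ.* ℚC.trace k a (SamplePoints.τ P i) ℚ.< 0ℚ)
    where

    open SamplePoints P

    private
      R : ℝ → ℝ
      R = ℝC.trace k (ℚ⇒ℝ a)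

      extension : ∀ i → Extension (λ x → ℚC.sign i ℚ.* ℚC.trace k a x)
                                  (λ x → ℝC.sign i *ʳ R x)
      extension i = record
        { extends   = λ x n → cong₂ ℚ._*_ (seq-sign i n) (seq-trace k a x n)
        ; congruent = λ {x} {y} x≃y → *ʳ-congˡ (ℝC.sign i) {R x} {R y}
                        (ℝC.trace-cong k (ℚ⇒ℝ a) {x} {y} x≃y)
        }

      module ℝR = CommutativeRing ℝ-commutativeRing

      unsign : ∀ i y → ℝC.sign i *ʳ y ≃ 0ℝ → y ≃ 0ℝ
      unsign i y h = begin
        y                               ≈⟨ ℝR.*-identityˡ y ⟨
        1ℝ *ʳ y                         ≈⟨ *ʳ-cong {ℝC.sign i *ʳ ℝC.sign i} {1ℝ} {y} {y} (ℝC.sign² i) (≃-refl {y}) ⟨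
        ℝC.sign i *ʳ ℝC.sign i *ʳ y     ≈⟨ ℝR.*-assoc (ℝC.sign i) (ℝC.sign i) y ⟩
        ℝC.sign i *ʳ (ℝC.sign i *ʳ y)   ≈⟨ *ʳ-congˡ (ℝC.sign i) {ℝC.sign i *ʳ y} {0ℝ} h ⟩
        ℝC.sign i *ʳ 0ℝ                 ≈⟨ ℝR.zeroʳ (ℝC.sign i) ⟩
        0ℝ                              ∎
        where open import Relation.Binary.Reasoning.Setoid ℝR.setoid

    abstract
      traceRoot : ∀ i → i ℕ.≤ k → ∃[ b ] R b ≃ 0ℝ × (∀ n → τ (suc i) ℚ.≤ seq b n × seq b n ℚ.≤ τ i)
      traceRoot i i≤k =
        -- With the sign of index i + 1 the function is negative at the left end τ(i+1) and, as the
        -- signs alternate, positive at the right end τ(i).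
        let b , root , bounds = intermediateValue (extension (suc i)) (ℚ.<⇒≤ (decreasing i i≤k))
              (ℚ.<⇒≤ (negative (suc i) (s≤s i≤k)))
              (<-by (<⇒0< (negative i (ℕ.m≤n⇒m≤1+n i≤k)))
                (solve 2 (λ s t → :- s :* t :- con 0ℚ := con 0ℚ :- s :* t) refl
                  (ℚC.sign i) (ℚC.trace k a (τ i))))
        in b , unsign (suc i) (R b) root , λ n → proj₁ (bounds n) , proj₁ (proj₂ (bounds n))

    R-at-τ : ∀ i → i ℕ.≤ suc k → ¬ R (ℚ⇒ℝ (τ i)) ≃ 0ℝ
    R-at-τ i i≤1+k h = ℚ.<-irrefl refl (subst (ℚ._< 0ℚ)
      (≡.trans (cong (ℚC.sign i ℚ.*_) (ℚ⇒ℝ-injective {ℚC.trace k a (τ i)} {0ℚ}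
          (≃-trans {ℚ⇒ℝ (ℚC.trace k a (τ i))} {R (ℚ⇒ℝ (τ i))} {0ℝ}
            (pointwise {ℚ⇒ℝ (ℚC.trace k a (τ i))} {R (ℚ⇒ℝ (τ i))}
              λ n → ≡.sym (seq-trace k a (ℚ⇒ℝ (τ i)) n)) h)))
        (ℚ.*-zeroʳ (ℚC.sign i)))
      (negative i i≤1+k))

    τ-antitone : ∀ i j → i ℕ.≤ j → j ℕ.≤ suc k → τ j ℚ.≤ τ i
    τ-antitone i j i≤j j≤1+k with ℕ.m≤n⇒m<n∨m≡n i≤j
    ... | inj₂ refl = ℚ.≤-refl
    τ-antitone i (suc j) i≤j (s≤s j≤k) | inj₁ (s≤s i≤j′) =
      ℚ.≤-trans (ℚ.<⇒≤ (decreasing j j≤k)) (τ-antitone i j i≤j′ (ℕ.m≤n⇒m≤1+n j≤k))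

    private
      bound : ∀ (i : Fin (suc k)) → toℕ i ℕ.≤ k
      bound i = ℕ.≤-pred (Fin.toℕ<n i)

    roots : Fin (suc k) → ℝ
    roots i = proj₁ (traceRoot (toℕ i) (bound i))

    roots-root : ∀ i → R (roots i) ≃ 0ℝ
    roots-root i = proj₁ (proj₂ (traceRoot (toℕ i) (bound i)))

    roots-bounds : ∀ i n → ℚ.- 2ℚ ℚ.≤ seq (roots i) n × seq (roots i) n ℚ.≤ 2ℚ
    roots-bounds i n =
      let i≤k = bound i
          l , u = proj₂ (proj₂ (traceRoot (toℕ i) i≤k)) n in
      ℚ.≤-trans (ℚ.≤-trans (ℚ.≤-reflexive (≡.sym last))
        (τ-antitone (suc (toℕ i)) (suc k) (s≤s i≤k) ℕ.≤-refl)) l ,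
      ℚ.≤-trans u (ℚ.≤-trans (τ-antitone 0 (toℕ i) z≤n (ℕ.m≤n⇒m≤1+n i≤k)) (ℚ.≤-reflexive first))

    private
      -- Different intervals meet at most in a sample point, so equal roots would equal τ(i+1),
      -- where R does not vanish.
      separated : ∀ i j → i ℕ.< j → (i≤k : i ℕ.≤ k) (j≤k : j ℕ.≤ k) →
                  ¬ proj₁ (traceRoot i i≤k) ≃ proj₁ (traceRoot j j≤k)
      separated i j i<j i≤k j≤k h =
        let b , root , bounds = traceRoot i i≤k
            b′ , _ , bounds′ = traceRoot j j≤k
            t = ℚ⇒ℝ (τ (suc i))
        in R-at-τ (suc i) (s≤s i≤k)
          (≃-trans {R t} {R b} {0ℝ}
            (ℝC.trace-cong k (ℚ⇒ℝ a) {t} {b} (≤ʳ-antisym {t} {b}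
              (≤-pointwise {t} {b} λ n → proj₁ (bounds n))
              (≤ʳ-trans {b} {b′} {t} (≃⇒≤ {b} {b′} h)
                (≤-pointwise {b′} {t} λ n → ℚ.≤-trans (proj₂ (bounds′ n))
                  (τ-antitone (suc i) j i<j (ℕ.m≤n⇒m≤1+n j≤k))))))
            root)

    roots-distinct : ∀ i j → i ≢ j → ¬ roots i ≃ roots j
    roots-distinct i j i≢j h with ℕ.<-cmp (toℕ i) (toℕ j)
    ... | tri< i<j _ _ = separated (toℕ i) (toℕ j) i<j (bound i) (bound j) h
    ... | tri≈ _ i≡j _ = i≢j (Fin.toℕ-injective i≡j)
    ... | tri> _ _ j<i = separated (toℕ j) (toℕ i) j<i (bound j) (bound i) (≃-sym {roots i} {roots j} h)

-- The large root of f, between a - 1 and a + 1.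

module SalemRoot where

  open import Algebra.Bundles using (CommutativeRing; Semiring)
  open import Data.Nat.Base as ℕ using (ℕ; zero; suc)
  open import Data.Product.Base using (∃-syntax; _×_; _,_; proj₁)
  open import Data.Rational.Base as ℚ using (ℚ; 0ℚ; 1ℚ)
  import Data.Rational.Properties as ℚ
  open import Data.Rational.Solver using (module +-*-Solver)
  open import Relation.Binary.PropositionalEquality as ≡ using (_≡_; refl; cong; cong₂)
  open import Defs hiding (_+_; _*_; -_; _^_)
  open Rationals
  open Reals
  open RealRoots
  open Samples
  import Algebra.Definitions.RawSemiring as RawSemiring
  open +-*-Solver

  private
    open RawSemiring (Semiring.rawSemiring (CommutativeRing.semiring ℚ.+-*-commutativeRing))
      using () renaming (_^_ to _^ℚ_)
    open RawSemiring (Semiring.rawSemiring (CommutativeRing.semiring ℝ-commutativeRing))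
      using () renaming (_^_ to _^ℝ_)

    seq-^ : ∀ x n m → seq (x ^ℝ n) m ≡ seq x m ^ℚ n
    seq-^ x zero    m = refl
    seq-^ x (suc n) m = cong (seq x m ℚ.*_) (seq-^ x n m)

    -- salem k a z in terms of u = zᵏ.
    polynomial : ∀ a z u → ℚ
    polynomial a z u = (z ℚ.* z ℚ.- a ℚ.* z ℚ.+ 1ℚ) ℚ.* (z ℚ.+ 1ℚ) ℚ.* (u ℚ.- 1ℚ) ℚ.* (z ℚ.* u ℚ.- 1ℚ)
      ℚ.- z ℚ.* (z ℚ.* u)

    module _ {a u z : ℚ} (2≤z : 2ℚ ℚ.≤ z) (2≤u : 2ℚ ℚ.≤ u) where

      0≤z-2 = ≤⇒0≤ 2≤z
      0≤u-2 = ≤⇒0≤ 2≤u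
      0<z = ℚ.<-≤-trans 0<2 2≤z
      0<u = ℚ.<-≤-trans 0<2 2≤u

      -- At z = a - 1 the quadratic factor is 1 - z < 0 and the other factors are positive.
      negative : a ≡ z ℚ.+ 1ℚ → polynomial a z u ℚ.< 0ℚ
      negative refl = <-by
        (0≤+< (0≤* (0≤* (0≤* (0≤+ 0≤z-2 0≤1) (0≤+ (ℚ.<⇒≤ 0<z) 0≤1)) (0≤+ 0≤u-2 0≤1))
                (0≤+ (0≤+ (0≤* 0≤z-2 (ℚ.<⇒≤ 0<u)) (ℚ.<⇒≤ 0<u)) (0≤+ 0≤u-2 0≤1)))
              (0<* 0<z (0<* 0<z 0<u)))
        (solve 2 (λ z u → con 0ℚ :- ((z :* z :- (z :+ con 1ℚ) :* z :+ con 1ℚ) :* (z :+ con 1ℚ)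
              :* (u :- con 1ℚ) :* (z :* u :- con 1ℚ) :- z :* (z :* u))
            := (z :- con 2ℚ :+ con 1ℚ) :* (z :+ con 1ℚ) :* (u :- con 2ℚ :+ con 1ℚ)
                :* ((z :- con 2ℚ) :* u :+ u :+ (u :- con 2ℚ :+ con 1ℚ)) :+ z :* (z :* u))
          refl z u)

      -- At z = a + 1 the quadratic factor is z + 1. With p = (z + 1)(u - 1) > 1 and r = (z + 1)(z u
      -- - 1) ≥ z² u the value p r - z² u is (p - 1) r + (r - z² u).
      positive : a ≡ z ℚ.- 1ℚ → 0ℚ ℚ.< polynomial a z u
      positive refl = <-by
        (0<+≤ (0<* 0<p-1 0<r) 0≤r-z²u)
        (solve 2 (λ z u → (z :* z :- (z :- con 1ℚ) :* z :+ con 1ℚ) :* (z :+ con 1ℚ)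
              :* (u :- con 1ℚ) :* (z :* u :- con 1ℚ) :- z :* (z :* u) :- con 0ℚ
            := (z :* (u :- con 2ℚ :+ con 1ℚ) :+ (u :- con 2ℚ))
                 :* (z :* (z :* u) :+ (z :* (u :- con 2ℚ) :+ (z :- con 2ℚ :+ con 1ℚ)))
               :+ (z :* (u :- con 2ℚ) :+ (z :- con 2ℚ :+ con 1ℚ)))
          refl z u)
        where
        0<p-1 = 0<+≤ (0<* 0<z (0≤+< 0≤u-2 0<1)) 0≤u-2
        0≤r-z²u = 0≤+ (0≤* (ℚ.<⇒≤ 0<z) 0≤u-2) (0≤+ 0≤z-2 0≤1)
        0<r = 0<+≤ (0<* 0<z (0<* 0<z 0<u)) 0≤r-z²u

    2≤^ : ∀ {z} → 2ℚ ℚ.≤ z → ∀ n → 2ℚ ℚ.≤ z ^ℚ suc n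
    2≤^ {z} 2≤z zero    = ℚ.≤-trans 2≤z (ℚ.≤-reflexive (≡.sym (ℚ.*-identityʳ z)))
    2≤^ {z} 2≤z (suc n) = ≤-by
      (0≤+ (0≤+ (0≤* (≤⇒0≤ 2≤z) (ℚ.≤-trans (ℚ.<⇒≤ 0<2) ih)) (≤⇒0≤ ih)) (ℚ.≤-trans (ℚ.<⇒≤ 0<2) ih))
      (solve 2 (λ z u → z :* u :- con 2ℚ := (z :- con 2ℚ) :* u :+ (u :- con 2ℚ) :+ u) refl z (z ^ℚ suc n))
      where ih = 2≤^ 2≤z n

    salem-extension : ∀ k a → Extension (ℚC.salem k a) (ℝC.salem k (ℚ⇒ℝ a))
    salem-extension k a = record
      { extends = λ x n → cong₂ (λ u v → (seq x n ℚ.* seq x n ℚ.- a ℚ.* seq x n ℚ.+ 1ℚ) ℚ.* (seq x n ℚ.+ 1ℚ)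
            ℚ.* (u ℚ.- 1ℚ) ℚ.* (v ℚ.- 1ℚ) ℚ.- seq x n ℚ.* v)
          (seq-^ x k n) (seq-^ x (suc k) n)
      ; congruent = λ {x} {y} → ℝC.salem-cong k (ℚ⇒ℝ a) {x} {y} }

  abstract
    salemRoot : ∀ k → 1 ℕ.≤ k → ∀ a → 2ℚ ℚ.+ 1ℚ ℚ.≤ a →
                ∃[ α ] ℝC.salem k (ℚ⇒ℝ a) α ≃ 0ℝ × (∀ n → a ℚ.- 1ℚ ℚ.≤ seq α n)
    salemRoot (suc k) _ a 3≤a =
      let α , root , bounds = intermediateValue (salem-extension (suc k) a)
            (≤-by {a ℚ.- 1ℚ} {a ℚ.+ 1ℚ} (ℚ.<⇒≤ 0<2)
              (solve 1 (λ a → a :+ con 1ℚ :- (a :- con 1ℚ) := con 2ℚ) refl a))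
            (ℚ.<⇒≤ (negative {a} {(a ℚ.- 1ℚ) ^ℚ suc k} {a ℚ.- 1ℚ} 2≤a-1 (2≤^ 2≤a-1 k)
              (solve 1 (λ a → a := a :- con 1ℚ :+ con 1ℚ) refl a)))
            (positive {a} {(a ℚ.+ 1ℚ) ^ℚ suc k} {a ℚ.+ 1ℚ} 2≤a+1 (2≤^ 2≤a+1 k)
              (solve 1 (λ a → a := a :+ con 1ℚ :- con 1ℚ) refl a))
      in α , root , λ n → proj₁ (bounds n)
      where
      2≤a-1 : 2ℚ ℚ.≤ a ℚ.- 1ℚ
      2≤a-1 = ≤-by (≤⇒0≤ 3≤a)
        (solve 1 (λ a → a :- con 1ℚ :- con 2ℚ := a :- con (2ℚ ℚ.+ 1ℚ)) refl a)
      2≤a+1 : 2ℚ ℚ.≤ a ℚ.+ 1ℚ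
      2≤a+1 = ℚ.≤-trans 2≤a-1 (≤-by (ℚ.<⇒≤ 0<2)
        (solve 1 (λ a → a :+ con 1ℚ :- (a :- con 1ℚ) := con 2ℚ) refl a))

-- ℂ as an integral domain.

module Complexes where

  open import Algebra.Bundles using (CommutativeRing)
  open import Algebra.Morphism.Structures using (IsRingHomomorphism)
  open import Data.Product.Base using (_,_)
  open import Data.Rational.Base as ℚ using (ℚ; 0ℚ; 1ℚ)
  import Data.Rational.Properties as ℚ
  open import Level using (0ℓ)
  open import Relation.Binary.PropositionalEquality using (refl)
  open import Relation.Nullary.Negation using (¬_)
  open import Defs
  open Reals
  open RealRoots

  private
    module ℝR = CommutativeRing ℝ-commutativeRing
    module Law = ComplexLaws ℝ-commutativeRing

  ≃ᶜ-refl : ∀ {z} → z ≃ᶜ z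
  ≃ᶜ-refl {z} = ≃-refl {re z} , ≃-refl {im z}

  ≃ᶜ-sym : ∀ {z w} → z ≃ᶜ w → w ≃ᶜ z
  ≃ᶜ-sym {z} {w} (p , q) = ≃-sym {re z} {re w} p , ≃-sym {im z} {im w} q

  ≃ᶜ-trans : ∀ {x y z} → x ≃ᶜ y → y ≃ᶜ z → x ≃ᶜ z
  ≃ᶜ-trans {x} {y} {z} (p , q) (p′ , q′) =
    ≃-trans {re x} {re y} {re z} p p′ , ≃-trans {im x} {im y} {im z} q q′

  ℂ-commutativeRing : CommutativeRing 0ℓ 0ℓ
  ℂ-commutativeRing = record
    { Carrier = ℂ ; _≈_ = _≃ᶜ_ ; _+_ = _+_ ; _*_ = _*_ ; -_ = -_ ; 0# = 0ℂ ; 1# = 1ℂ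
    ; isCommutativeRing = record
      { isRing = record
        { +-isAbelianGroup = record
          { isGroup = record
            { isMonoid = record
              { isSemigroup = record
                { isMagma = record
                  { isEquivalence = record
                    { refl  = λ {x} → ≃ᶜ-refl {x}
                    ; sym   = λ {x} {y} → ≃ᶜ-sym {x} {y}
                    ; trans = λ {x} {y} {z} → ≃ᶜ-trans {x} {y} {z} }
                  ; ∙-cong = λ {x} {x′} {y} {y′} (p , q) (p′ , q′) →
                      +ʳ-cong {re x} {re x′} {re y} {re y′} p p′ ,
                      +ʳ-cong {im x} {im x′} {im y} {im y′} q q′ }
                ; assoc = λ x y z →
                    ℝR.+-assoc (re x) (re y) (re z) , ℝR.+-assoc (im x) (im y) (im z) }
              ; identity = (λ x → ℝR.+-identityˡ (re x) , ℝR.+-identityˡ (im x))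
                         , (λ x → ℝR.+-identityʳ (re x) , ℝR.+-identityʳ (im x)) }
            ; inverse = (λ x → ℝR.-‿inverseˡ (re x) , ℝR.-‿inverseˡ (im x))
                      , (λ x → ℝR.-‿inverseʳ (re x) , ℝR.-‿inverseʳ (im x))
            ; ⁻¹-cong = λ {x} {y} (p , q) → -ʳ-cong {re x} {re y} p , -ʳ-cong {im x} {im y} q }
          ; comm = λ x y → ℝR.+-comm (re x) (re y) , ℝR.+-comm (im x) (im y) }
        ; *-cong = λ {x} {x′} {y} {y′} (p , q) (p′ , q′) →
            +ʳ-cong {re x *ʳ re y} {re x′ *ʳ re y′} { -ʳ (im x *ʳ im y)} { -ʳ (im x′ *ʳ im y′)}
              (*ʳ-cong {re x} {re x′} {re y} {re y′} p p′)
              (-ʳ-cong {im x *ʳ im y} {im x′ *ʳ im y′} (*ʳ-cong {im x} {im x′} {im y} {im y′} q q′)) ,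
            +ʳ-cong {re x *ʳ im y} {re x′ *ʳ im y′} {im x *ʳ re y} {im x′ *ʳ re y′}
              (*ʳ-cong {re x} {re x′} {im y} {im y′} p q′) (*ʳ-cong {im x} {im x′} {re y} {re y′} q p′)
        ; *-assoc = λ x y z →
            Law.*-assoc-re (re x) (im x) (re y) (im y) (re z) (im z) ,
            Law.*-assoc-im (re x) (im x) (re y) (im y) (re z) (im z)
        ; *-identity =
            (λ x → Law.*-identityˡ-re (re x) (im x) ,
                   Law.*-identityˡ-im (re x) (im x)) ,
            (λ x → Law.*-identityʳ-re (re x) (im x) ,
                   Law.*-identityʳ-im (re x) (im x))
        ; distrib =
            (λ x y z →
              Law.distribˡ-re (re x) (im x) (re y) (im y) (re z) (im z) ,
              Law.distribˡ-im (re x) (im x) (re y) (im y) (re z) (im z)) ,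
            (λ x y z →
              Law.distribʳ-re (re x) (im x) (re y) (im y) (re z) (im z) ,
              Law.distribʳ-im (re x) (im x) (re y) (im y) (re z) (im z)) }
      ; *-comm = λ x y →
          Law.*-comm-re (re x) (im x) (re y) (im y) ,
          Law.*-comm-im (re x) (im x) (re y) (im y) } }

  normSq≃0 : ∀ z → normSq z ≃ 0ℝ → z ≃ᶜ 0ℂ
  normSq≃0 z h =
    sumOfSquares {re z} {im z} h ,
    sumOfSquares {im z} {re z} (≃-trans {im z *ʳ im z +ʳ re z *ʳ re z} {normSq z} {0ℝ}
      (ℝR.+-comm (im z *ʳ im z) (re z *ʳ re z)) h)

  normSq-* : ∀ z w → normSq (z * w) ≃ normSq z *ʳ normSq w
  normSq-* z w = Law.normSq-* (re z) (im z) (re w) (im w)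

  normSq-cong : ∀ {z w} → z ≃ᶜ w → normSq z ≃ normSq w
  normSq-cong {z} {w} (p , q) = +ʳ-cong {re z *ʳ re z} {re w *ʳ re w} {im z *ʳ im z} {im w *ʳ im w}
    (*ʳ-cong {re z} {re w} {re z} {re w} p p) (*ʳ-cong {im z} {im w} {im z} {im w} q q)

  -- The norm is multiplicative and vanishes only at 0, so the claim reduces to `domain` in ℝ.
  ℂ-domain : ∀ {z w} → z * w ≃ᶜ 0ℂ → ¬ z ≃ᶜ 0ℂ → w ≃ᶜ 0ℂ
  ℂ-domain {z} {w} zw≃0 z≄0 = normSq≃0 w (domain {normSq z} {normSq w}
    (≃-trans {normSq z *ʳ normSq w} {normSq (z * w)} {0ℝ}
      (≃-sym {normSq (z * w)} {normSq z *ʳ normSq w} (normSq-* z w))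
      (≃-trans {normSq (z * w)} {normSq 0ℂ} {0ℝ} (normSq-cong {z * w} {0ℂ} zw≃0)
        (pointwise {normSq 0ℂ} {0ℝ} λ _ → refl)))
    (λ h → z≄0 (normSq≃0 z h)))

  1≄0 : ¬ 1ℂ ≃ᶜ 0ℂ
  1≄0 (h , _) = ℚ.1≢0 (ℚ⇒ℝ-injective {1ℚ} {0ℚ} h)

  ℝ⇒ℂ-hom : IsRingHomomorphism (CommutativeRing.rawRing ℝ-commutativeRing)
                               (CommutativeRing.rawRing ℂ-commutativeRing) ℝ⇒ℂ
  ℝ⇒ℂ-hom = record
    { isSemiringHomomorphism = record
      { isNearSemiringHomomorphism = record
        { +-isMonoidHomomorphism = record
          { isMagmaHomomorphism = record
            { isRelHomomorphism = record { cong = λ h → h , ≃-refl {0ℝ} }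
            ; homo = λ x y → ≃-refl {x +ʳ y} , pointwise {0ℝ} {0ℝ +ʳ 0ℝ} λ _ → refl }
          ; ε-homo = ≃ᶜ-refl {0ℂ} }
        ; *-homo = λ x y →
            Law.embed-*-re x y ,
            Law.embed-*-im x y }
      ; 1#-homo = ≃ᶜ-refl {1ℂ} }
    ; -‿homo = λ x → ≃-refl { -ʳ x} , pointwise {0ℝ} { -ʳ 0ℝ} λ _ → refl }

  ℚ⇒ℝ-hom : IsRingHomomorphism ℚ.+-*-rawRing (CommutativeRing.rawRing ℝ-commutativeRing) ℚ⇒ℝ
  ℚ⇒ℝ-hom = record
    { isSemiringHomomorphism = record
      { isNearSemiringHomomorphism = record
        { +-isMonoidHomomorphism = record
          { isMagmaHomomorphism = record
            { isRelHomomorphism = record { cong = λ { {x} refl → ≃-refl {ℚ⇒ℝ x} } }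
            ; homo = λ x y → pointwise {ℚ⇒ℝ (x ℚ.+ y)} {ℚ⇒ℝ x +ʳ ℚ⇒ℝ y} λ _ → refl }
          ; ε-homo = ≃-refl {0ℝ} }
        ; *-homo = λ x y → pointwise {ℚ⇒ℝ (x ℚ.* y)} {ℚ⇒ℝ x *ʳ ℚ⇒ℝ y} λ _ → refl }
      ; 1#-homo = ≃-refl {1ℝ} }
    ; -‿homo = λ x → pointwise {ℚ⇒ℝ (ℚ.- x)} { -ʳ ℚ⇒ℝ x} λ _ → refl }

  ℂ-isDomain : Polynomials.IsDomain ℂ-commutativeRing
  ℂ-isDomain = record
    { 1≉0    = 1≄0
    ; domain = λ {z} {w} → ℂ-domain {z} {w}
    }

-- The interval [-2, 2], the unit disc and the unit circle.

module ComplexFacts where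

  open import Algebra.Bundles using (CommutativeRing)
  open import Algebra.Morphism.Structures using (IsRingHomomorphism)
  import Algebra.Morphism.Construct.Composition as Composition
  open import Data.List.Base using (List; []; _∷_)
  open import Data.List.Relation.Unary.All using (All; []; _∷_)
  open import Data.Product.Base using (Σ-syntax; ∃-syntax; _×_; _,_; proj₁; proj₂)
  open import Data.Rational.Base as ℚ using (ℚ; 0ℚ; 1ℚ; ½; ∣_∣)
  import Data.Rational.Properties as ℚ
  open import Data.Rational.Solver using (module +-*-Solver)
  open import Data.Vec.Base as Vec using (Vec; []; _∷_)
  open import Relation.Binary.PropositionalEquality using (_≡_; refl; subst)
  open import Relation.Nullary.Negation using (¬_)
  open import Defs
  open Rationals
  open Reals
  open RealRoots
  open Complexes
  open +-*-Solver

  module ℝR = CommutativeRing ℝ-commutativeRing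
  module ℂP = Polynomials ℂ-commutativeRing
  private
    module ℝP = Polynomials ℝ-commutativeRing
    module E = Embedding.Embedding ℝ-commutativeRing ℂ-commutativeRing ℝ⇒ℂ-hom
    module Circleℝ = Embedding.Circle ℝ-commutativeRing
    module Circleℂ = Embedding.Circle ℂ-commutativeRing

  ℚ⇒ℂ-hom : IsRingHomomorphism ℚ.+-*-rawRing (CommutativeRing.rawRing ℂ-commutativeRing) ℚ⇒ℂ
  ℚ⇒ℂ-hom = Composition.isRingHomomorphism (λ {x} {y} {z} → ≃ᶜ-trans {x} {y} {z}) ℚ⇒ℝ-hom ℝ⇒ℂ-hom

  -- Bounds on every term instead of the order of ℝ: the bisection roots satisfy them, and later
  -- inequalities can be checked termwise in ℚ.
  Bounded : ℝ → Set
  Bounded x = ∀ n → ℚ.- 2ℚ ℚ.≤ seq x n × seq x n ℚ.≤ 2ℚ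

  Interval : ℂ → Set
  Interval z = Σ[ x ∈ ℝ ] Bounded x × z ≡ ℝ⇒ℂ x

  private
    near : ∀ {x y} → x ≃ y → ∀ {ε} → 0ℚ ℚ.< ε → ∃[ n ] seq x n ℚ.- seq y n ℚ.≤ ε × seq y n ℚ.- seq x n ℚ.≤ ε
    near {x} {y} h {ε} 0<ε = let n , p = witness (h ε 0<ε) in
      n , ℚ.≤-trans (p≤∣p∣ (seq x n ℚ.- seq y n)) p ,
      ℚ.≤-trans (p≤∣p∣ (seq y n ℚ.- seq x n)) (subst (ℚ._≤ ε) (∣p-q∣≡∣q-p∣ (seq x n) (seq y n)) p)

    ½<1 : ½ ℚ.< 1ℚ
    ½<1 = <-by {½} {1ℚ} 0<½ refl

  module _ {a : ℚ} (4≤a : 4ℚ ℚ.≤ a) where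

    private
      2≤a-x : ∀ {x} → x ℚ.≤ 2ℚ → 2ℚ ℚ.≤ a ℚ.- x
      2≤a-x {x} x≤2 = ≤-by (0≤+ (≤⇒0≤ 4≤a) (≤⇒0≤ x≤2))
        (solve 2 (λ a x → a :- x :- con 2ℚ := a :- con 4ℚ :+ (con 2ℚ :- x)) refl a x)

      1≤2 : 1ℚ ℚ.≤ 2ℚ
      1≤2 = ≤-by {1ℚ} {2ℚ} 0≤1 refl

      2≤product : ∀ {x y} → x ℚ.≤ 2ℚ → 1ℚ ℚ.≤ y → 2ℚ ℚ.≤ (a ℚ.- x) ℚ.* y
      2≤product {x} {y} x≤2 1≤y = subst (ℚ._≤ (a ℚ.- x) ℚ.* y) (ℚ.*-identityʳ 2ℚ)
        (*-mono {2ℚ} {a ℚ.- x} {1ℚ} {y} (ℚ.<⇒≤ 0<2) (ℚ.≤-trans 0≤1 1≤y) (2≤a-x x≤2) 1≤y)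

    product : ∀ bs → All Interval bs →
              Σ[ y ∈ ℝ ] (∀ n → 1ℚ ℚ.≤ seq y n) × ℂP.∏[x- bs ] (ℚ⇒ℂ a) ≃ᶜ ℝ⇒ℂ y
    product []       []                     = 1ℝ , (λ n → ℚ.≤-refl) , ≃ᶜ-refl {1ℂ}
    product (b ∷ bs) ((x , x∈ , refl) ∷ is) =
      let y , 1≤y , h = product bs is in
      (ℚ⇒ℝ a +ʳ -ʳ x) *ʳ y ,
      (λ n → ℚ.≤-trans 1≤2 (2≤product (proj₂ (x∈ n)) (1≤y n))) ,
      E.φ-factor (ℚ⇒ℝ a) x y {ℂP.∏[x- bs ] (ℚ⇒ℂ a)} h

    -- Every factor a - b is termwise at least 2, hence so is the product; comparing it with r at
    -- accuracy ½ leaves r ≥ 3/2.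
    far : ∀ b bs → All Interval (b ∷ bs) → ∀ r → ℂP.∏[x- b ∷ bs ] (ℚ⇒ℂ a) ≃ᶜ ℚ⇒ℂ r → 1ℚ ℚ.< r
    far b bs ((x , x∈ , refl) ∷ is) r h =
      let y , 1≤y , e = product bs is
          z = (ℚ⇒ℝ a +ʳ -ʳ x) *ʳ y
          P = ℂP.∏[x- b ∷ bs ] (ℚ⇒ℂ a)
          e′ = E.φ-factor (ℚ⇒ℝ a) x y {ℂP.∏[x- bs ] (ℚ⇒ℂ a)} e
          n , z-r≤½ , _ = near {z} {ℚ⇒ℝ r}
            (≃-trans {z} {re P} {ℚ⇒ℝ r} (≃-sym {re P} {z} (proj₁ e′)) (proj₁ h)) 0<½
          s = (a ℚ.- seq x n) ℚ.* seq y n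
      in ℚ.<-≤-trans (<-by {1ℚ} {1ℚ ℚ.+ ½} 0<½ refl)
        (≤-by {1ℚ ℚ.+ ½} {r}
          (0≤+ (≤⇒0≤ z-r≤½) (≤⇒0≤ (2≤product (proj₂ (x∈ n)) (1≤y n))))
          (solve 2 (λ r s → r :- (con 1ℚ :+ con ½) := con ½ :- (s :- r) :+ (s :- con 2ℚ)) refl r s))

  -- If α + α′ = x ≤ 2, then α α′ = α (x - α) ≤ 0 because α ≥ 2, against α α′ = 1.
  outside : ∀ α → (∀ n → 2ℚ ℚ.≤ seq α n) → ∀ {α′ b} → Interval b →
            ℝ⇒ℂ α * α′ ≃ᶜ 1ℂ → ¬ ℝ⇒ℂ α + α′ ≃ᶜ b
  outside α 2≤α {α′} (x , x∈ , refl) αα′≃1 α+α′≃x =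
    let n , _ , 1-y≤½ = near {α *ʳ (x +ʳ -ʳ α)} {1ℝ}
          (proj₁ (E.φ-reciprocal {α} {x} {α′} α+α′≃x αα′≃1)) 0<½
        s = seq α n
        t = seq x n
    in ℚ.<-irrefl refl (ℚ.<-≤-trans ½<1 (ℚ.≤-trans
      (≤-by {1ℚ} {1ℚ ℚ.- s ℚ.* (t ℚ.- s)}
        (0≤* (ℚ.≤-trans (ℚ.<⇒≤ 0<2) (2≤α n)) (0≤+ (≤⇒0≤ (2≤α n)) (≤⇒0≤ (proj₂ (x∈ n)))))
        (solve 2 (λ s t → con 1ℚ :- s :* (t :- s) :- con 1ℚ := s :* (s :- con 2ℚ :+ (con 2ℚ :- t))) refl s t))
      1-y≤½))

  -- |w|² ≤ α² |w|² = |α w|² = 1.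
  normSq-inverse : ∀ α → (∀ n → 1ℚ ℚ.≤ seq α n) → ∀ {w} → ℝ⇒ℂ α * w ≃ᶜ 1ℂ → normSq w ≤ 1ℝ
  normSq-inverse α 1≤α {w} αw≃1 =
    ≤ʳ-trans {normSq w} {normSq (ℝ⇒ℂ α) *ʳ normSq w} {1ℝ}
      (≤-pointwise {normSq w} {normSq (ℝ⇒ℂ α) *ʳ normSq w} λ n →
        ≤-by (0≤* (1≤α² n) (0≤+ (0≤p² (seq (re w) n)) (0≤p² (seq (im w) n))))
          (solve 2 (λ s N → (s :* s :+ con 0ℚ :* con 0ℚ) :* N :- N
              := ((s :- con 1ℚ) :* (s :- con 1ℚ :+ con 1ℚ :+ con 1ℚ)) :* N) refl (seq α n) (seq (normSq w) n)))
      (≃⇒≤ {normSq (ℝ⇒ℂ α) *ʳ normSq w} {1ℝ}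
        (≃-trans {normSq (ℝ⇒ℂ α) *ʳ normSq w} {normSq (ℝ⇒ℂ α * w)} {1ℝ}
          (≃-sym {normSq (ℝ⇒ℂ α * w)} {normSq (ℝ⇒ℂ α) *ʳ normSq w} (normSq-* (ℝ⇒ℂ α) w))
          (≃-trans {normSq (ℝ⇒ℂ α * w)} {normSq 1ℂ} {1ℝ} (normSq-cong {ℝ⇒ℂ α * w} {1ℂ} αw≃1)
            (pointwise {normSq 1ℂ} {1ℝ} λ _ → refl))))
    where
    1≤α² : ∀ n → 0ℚ ℚ.≤ (seq α n ℚ.- 1ℚ) ℚ.* (seq α n ℚ.- 1ℚ ℚ.+ 1ℚ ℚ.+ 1ℚ)
    1≤α² n = let 0≤s-1 = ≤⇒0≤ (1≤α n) in 0≤* 0≤s-1 (0≤+ (0≤+ 0≤s-1 0≤1) 0≤1)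

  -- For w = p + iq the equation w (x - w) = 1 gives q (x - 2p) = 0. Which factor vanishes is
  -- undecidable, but `≃` is stable: if |w|² were not 1, `onLine` would exclude q ≃ 0, so x ≃ 2p,
  -- and `onCircle` applies.
  normSq-unit : ∀ {w w′ b} → Interval b → w * w′ ≃ᶜ 1ℂ → w + w′ ≃ᶜ b → normSq w ≃ 1ℝ
  normSq-unit {w} {w′} (x , x∈ , refl) ww′≃1 w+w′≃x =
    ≃-stable {N} {1ℝ} λ N≄1 → N≄1 (fromDifference (domain {im w} {d} q·d≃0
      (λ q≃0 → N≄1 (fromDifference-1 (squareZero {N-1} {p²[4-x²]} 0≤p²[4-x²]
        (Circleℝ.onLine {re w} {im w} {x} real imaginary q≃0))))))
    where
    N N-1 d p²[4-x²] : ℝ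
    N = normSq w
    N-1 = N +ʳ -ʳ 1ℝ
    d = x +ʳ -ʳ re w +ʳ -ʳ re w
    p²[4-x²] = re w *ʳ re w *ʳ (1ℝ +ʳ 1ℝ +ʳ 1ℝ +ʳ 1ℝ +ʳ -ʳ (x *ʳ x))

    equation : w * (ℝ⇒ℂ x + - w) ≃ᶜ 1ℂ
    equation = Circleℂ.reciprocal {w} {w′} {ℝ⇒ℂ x} ww′≃1 w+w′≃x

    real = proj₁ equation
    imaginary = proj₂ equation

    q·d≃0 : im w *ʳ d ≃ 0ℝ
    q·d≃0 = Circleℝ.q[x-2p]≈0 {re w} {im w} {x} real imaginary

    0≤p²[4-x²] : ∀ n → 0ℚ ℚ.≤ seq p²[4-x²] n
    0≤p²[4-x²] n = 0≤* (0≤p² (seq (re w) n)) (subst (0ℚ ℚ.≤_)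
      (solve 1 (λ t → (con 2ℚ :- t) :* (t :- :- con 2ℚ)
        := con 1ℚ :+ con 1ℚ :+ con 1ℚ :+ con 1ℚ :- t :* t) refl (seq x n))
      (0≤* (≤⇒0≤ (proj₂ (x∈ n))) (≤⇒0≤ (proj₁ (x∈ n)))))

    fromDifference-1 : N-1 ≃ 0ℝ → N ≃ 1ℝ
    fromDifference-1 h ε 0<ε = weaken
      (λ {n} → subst (λ t → ∣ t ∣ ℚ.≤ ε)
        (solve 1 (λ t → t :- con 1ℚ :- con 0ℚ := t :- con 1ℚ) refl (seq N n))) (h ε 0<ε)

    fromDifference : d ≃ 0ℝ → N ≃ 1ℝ
    fromDifference h = fromDifference-1 (Circleℝ.onCircle {re w} {im w} {x} real imaginary h)

  -- A point w = h + is of the unit circle with w + w⁻¹ = x.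
  module UnitCircle (x : ℝ) (x∈ : Bounded x) where

    h : ℝ
    h = ℚ⇒ℝ ½ *ʳ x

    private
      1-h² : ℝ
      1-h² = 1ℝ +ʳ -ʳ (h *ʳ h)

      bounds : ∀ n → 0ℚ ℚ.≤ seq 1-h² n × seq 1-h² n ℚ.≤ 1ℚ
      bounds n =
        subst (0ℚ ℚ.≤_)
          (solve 1 (λ t → con ½ :* (con 2ℚ :- t) :* (con ½ :* (t :- :- con 2ℚ))
            := con 1ℚ :- con ½ :* t :* (con ½ :* t)) refl (seq x n))
          (0≤* (0≤* (ℚ.<⇒≤ 0<½) (≤⇒0≤ (proj₂ (x∈ n)))) (0≤* (ℚ.<⇒≤ 0<½) (≤⇒0≤ (proj₁ (x∈ n))))) ,
        ≤-by (0≤p² (seq h n)) (solve 1 (λ t → con 1ℚ :- (con 1ℚ :- t :* t) := t :* t) refl (seq h n))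

      root : ∃[ s ] s *ʳ s ≃ 1-h²
      root = squareRoot 1-h² bounds

    abstract
      s : ℝ
      s = proj₁ root

      s²≃1-h² : s *ʳ s ≃ 1-h²
      s²≃1-h² = proj₂ root

    h+h≃x : h +ʳ h ≃ x
    h+h≃x = pointwise {h +ʳ h} {x} λ n → ½+½ (seq x n)

    h²+s²≃1 : h *ʳ h +ʳ s *ʳ s ≃ 1ℝ
    h²+s²≃1 = ≃-trans {h *ʳ h +ʳ s *ʳ s} {h *ʳ h +ʳ 1-h²} {1ℝ}
      (+ʳ-cong {h *ʳ h} {h *ʳ h} {s *ʳ s} {1-h²} (≃-refl {h *ʳ h}) s²≃1-h²)
      (pointwise {h *ʳ h +ʳ 1-h²} {1ℝ} λ n →
        solve 1 (λ t → t :+ (con 1ℚ :- t) := con 1ℚ) refl (seq (h *ʳ h) n))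

    point conjugate : ℂ
    point = h +i s
    conjugate = h +i (-ʳ s)

    point*conjugate : point * conjugate ≃ᶜ 1ℂ
    point*conjugate =
      Circleℝ.product-real {h} {s} {x} h+h≃x h²+s²≃1 ,
      Circleℝ.product-imaginary {h} {s} {x} h+h≃x h²+s²≃1

    point+conjugate : point + conjugate ≃ᶜ ℝ⇒ℂ x
    point+conjugate = h+h≃x , ℝR.-‿inverseʳ s

    module _ (x≄2 : ¬ x ≃ ℚ⇒ℝ 2ℚ) (x≄-2 : ¬ x ≃ ℚ⇒ℝ (ℚ.- 2ℚ)) where

      -- s = 0 would give h = ±1 and thus x = ±2.
      s≄0 : ¬ s ≃ 0ℝ
      s≄0 s≃0 = x≄-2 (≃-trans {x} { -ʳ (1ℝ +ʳ 1ℝ)} {ℚ⇒ℝ (ℚ.- 2ℚ)}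
        (Circleℝ.h≈-1⇒x≈-2 {h} {s} {x} h+h≃x h²+s²≃1
          (domain {h +ʳ -ʳ 1ℝ} {h +ʳ 1ℝ} (Circleℝ.real⇒±1 {h} {s} {x} h+h≃x h²+s²≃1 s≃0)
            λ h-1≃0 → x≄2 (≃-trans {x} {1ℝ +ʳ 1ℝ} {ℚ⇒ℝ 2ℚ}
              (Circleℝ.h≈1⇒x≈2 {h} {s} {x} h+h≃x h²+s²≃1 h-1≃0)
              (pointwise {1ℝ +ʳ 1ℝ} {ℚ⇒ℝ 2ℚ} λ _ → refl))))
        (pointwise { -ʳ (1ℝ +ʳ 1ℝ)} {ℚ⇒ℝ (ℚ.- 2ℚ)} λ _ → refl))

      private
        -- The form is |p + q w|² with w = h + is, so q s = 0 and p + q h = 0; as s is not 0, first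
        -- q and then p vanishes.
        p≃0 : ∀ p q → p *ʳ p +ʳ p *ʳ q *ʳ x +ʳ q *ʳ q ≃ 0ℝ → p ≃ 0ℝ
        p≃0 p q N≃0 =
          let squares = Circleℝ.definite {h} {s} {x} h+h≃x h²+s²≃1 {p} {q} N≃0
              P = p +ʳ q *ʳ h
              S = q *ʳ s
              P≃0 = sumOfSquares {P} {S} squares
              S≃0 = sumOfSquares {S} {P} (≃-trans {S *ʳ S +ʳ P *ʳ P} {P *ʳ P +ʳ S *ʳ S} {0ℝ}
                      (ℝR.+-comm (S *ʳ S) (P *ʳ P)) squares)
              q≃0 = domain {s} {q} (≃-trans {s *ʳ q} {S} {0ℝ} (ℝR.*-comm s q) S≃0) s≄0
          in ≃-trans {p} {P} {0ℝ} (≃-sym {P} {p} (≃-trans {P} {p +ʳ 0ℝ} {p}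
              (+ʳ-cong {p} {p} {q *ʳ h} {0ℝ} (≃-refl {p})
                (≃-trans {q *ʳ h} {0ℝ *ʳ h} {0ℝ} (*ʳ-cong {q} {0ℝ} {h} {h} q≃0 (≃-refl {h})) (ℝR.zeroˡ h)))
              (ℝR.+-identityʳ p))) P≃0

      definite : ∀ {d e} (f : Vec ℚ d) (g : Vec ℚ e) →
        let u = ℂP.monic (Vec.map ℚ⇒ℂ f) (ℝ⇒ℂ x)
            v = ℂP.low (Vec.map ℚ⇒ℂ g) (ℝ⇒ℂ x) in
        u * u + u * v * ℝ⇒ℂ x + v * v ≃ᶜ 0ℂ → u ≃ᶜ 0ℂ
      definite f g N≃0 =
        let u = ℂP.monic (Vec.map ℚ⇒ℂ f) (ℝ⇒ℂ x)
            v = ℂP.low (Vec.map ℚ⇒ℂ g) (ℝ⇒ℂ x)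
            p = ℝP.monic (Vec.map ℚ⇒ℝ f) x
            q = ℝP.low (Vec.map ℚ⇒ℝ g) x
            u≃p = ≃ᶜ-sym {ℝ⇒ℂ p} {u} (E.φ-monic ℚ⇒ℝ f x)
            v≃q = ≃ᶜ-sym {ℝ⇒ℂ q} {v} (E.φ-low ℚ⇒ℝ g x)
            N = p *ʳ p +ʳ p *ʳ q *ʳ x +ʳ q *ʳ q
            Nᶜ = u * u + u * v * ℝ⇒ℂ x + v * v
            Nᶜ≃N = E.φ-norm {u} {v} {ℝ⇒ℂ x} {p} {q} {x} u≃p v≃q (≃ᶜ-refl {ℝ⇒ℂ x})
            p≃0′ = p≃0 p q (≃-trans {N} {re Nᶜ} {0ℝ} (≃-sym {re Nᶜ} {N} (proj₁ Nᶜ≃N)) (proj₁ N≃0))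
        in ≃ᶜ-trans {u} {ℝ⇒ℂ p} {0ℂ} u≃p (p≃0′ , ≃-refl {0ℝ})

-- Salem property, degree and units for one value of the parameter.

module SalemNumber where

  open import Data.Fin.Base using (Fin; zero)
  open import Data.Integer.Base using (ℤ; +_)
  open import Data.List.Base as List using (List; tabulate)
  import Data.List.Properties as List
  open import Data.List.Relation.Unary.All as All using (All)
  import Data.List.Relation.Unary.All.Properties as All
  open import Data.List.Relation.Unary.AllPairs using (AllPairs)
  import Data.List.Relation.Unary.AllPairs.Properties as AllPairs
  open import Data.List.Relation.Unary.Any using (here; there)
  open import Data.Nat.Base as ℕ using (ℕ; suc)
  open import Data.Product.Base using (_,_; proj₁; proj₂)
  open import Data.Rational.Base as ℚ using (ℚ; 1ℚ)
  import Data.Rational.Properties as ℚ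
  open import Data.Vec.Base as Vec using (Vec; []; _∷_)
  import Data.Vec.Properties as Vec
  open import Function.Base using (_∘_)
  open import Relation.Binary.PropositionalEquality as ≡ using (_≡_; _≢_; refl; cong; subst)
  open import Relation.Nullary.Negation using (¬_)
  open import Defs
  open Rationals
  open Reals
  open RealRoots
  open Samples
  open Complexes
  open ComplexFacts

  module ℂC = Chebyshev ℂ-commutativeRing
  private
    module H = SalemPolynomials.Homomorphism ℝ-commutativeRing ℂ-commutativeRing ℝ⇒ℂ-hom
    module Conj = Conjugates ℂ-commutativeRing ℚ⇒ℂ ℚ⇒ℂ-hom
      ℂ-isDomain

  eval≡monic : ∀ {d} (f : Monic ℚ d) z → eval f z ≡ ℂP.monic (Vec.map ℚ⇒ℂ f) z
  eval≡monic []      z = refl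
  eval≡monic (c ∷ f) z = cong (λ t → ℚ⇒ℂ c + z * t) (eval≡monic f z)

  isAlgebraicInteger : ∀ {z d} (f : Vec ℤ d) → ℂP.monic (Vec.map (ℚ⇒ℂ ∘ fromℤ) f) z ≃ᶜ 0ℂ →
                       IsAlgebraicInteger z
  isAlgebraicInteger {z} f h = _ , f , subst (_≃ᶜ 0ℂ) (≡.sym (≡.trans
    (eval≡monic (Vec.map fromℤ f) z)
    (cong (λ g → ℂP.monic g z) (≡.sym (Vec.map-∘ ℚ⇒ℂ fromℤ f))))) h

  module SalemNumber
    (k a : ℕ) (4≤a : 4ℚ ℚ.≤ fromℕ a)
    (α : ℝ) (2≤α : ∀ n → 2ℚ ℚ.≤ seq α n)
    (α-root : ℝC.salem (suc k) (ℚ⇒ℝ (fromℕ a)) α ≃ 0ℝ)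
    (β : Fin (suc (suc k)) → ℝ)
    (β-root : ∀ i → ℝC.trace (suc k) (ℚ⇒ℝ (fromℕ a)) (β i) ≃ 0ℝ)
    (β-bounded : ∀ i → Bounded (β i))
    (β-distinct : ∀ i j → i ≢ j → ¬ β i ≃ β j)
    (2-notRoot  : ¬ ℝC.trace (suc k) (ℚ⇒ℝ (fromℕ a)) (ℚ⇒ℝ 2ℚ) ≃ 0ℝ)
    (-2-notRoot : ¬ ℝC.trace (suc k) (ℚ⇒ℝ (fromℕ a)) (ℚ⇒ℝ (ℚ.- 2ℚ)) ≃ 0ℝ)
    where

    private
      A : ℝ
      A = ℚ⇒ℝ (fromℕ a)

      αᶜ-root : ℂC.salem (suc k) (ℝ⇒ℂ A) (ℝ⇒ℂ α) ≃ᶜ 0ℂ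
      αᶜ-root = ≃ᶜ-trans {ℂC.salem (suc k) (ℝ⇒ℂ A) (ℝ⇒ℂ α)} {ℝ⇒ℂ (ℝC.salem (suc k) A α)} {0ℂ}
        (≃ᶜ-sym {ℝ⇒ℂ (ℝC.salem (suc k) A α)} {ℂC.salem (suc k) (ℝ⇒ℂ A) (ℝ⇒ℂ α)} (H.φ-salem (suc k) A α))
        (α-root , ≃-refl {0ℝ})

      traceᶜ-root : ∀ x → ℝC.trace (suc k) A x ≃ 0ℝ → ℂC.trace (suc k) (ℝ⇒ℂ A) (ℝ⇒ℂ x) ≃ᶜ 0ℂ
      traceᶜ-root x h = ≃ᶜ-trans {ℂC.trace (suc k) (ℝ⇒ℂ A) (ℝ⇒ℂ x)} {ℝ⇒ℂ (ℝC.trace (suc k) A x)} {0ℂ}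
        (≃ᶜ-sym {ℝ⇒ℂ (ℝC.trace (suc k) A x)} {ℂC.trace (suc k) (ℝ⇒ℂ A) (ℝ⇒ℂ x)} (H.φ-trace (suc k) A x))
        (h , ≃-refl {0ℝ})

      bs : List ℂ
      bs = tabulate (ℝ⇒ℂ ∘ β)

      bs-interval : All Interval bs
      bs-interval = All.tabulate⁺ {f = ℝ⇒ℂ ∘ β} λ i → β i , β-bounded i , refl

      1≤α : ∀ n → 1ℚ ℚ.≤ seq α n
      1≤α n = ℚ.≤-trans (≤-by {1ℚ} {2ℚ} 0≤1 refl) (2≤α n)

      bs-distinct : AllPairs (λ z w → ¬ z ≃ᶜ w) bs
      bs-distinct = AllPairs.tabulate⁺ {f = ℝ⇒ℂ ∘ β} λ {i} {j} i≢j e → β-distinct i j i≢j (proj₁ e)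

      bs-roots : All (λ b → ℂC.trace (suc k) (ℝ⇒ℂ A) b ≃ᶜ 0ℂ) bs
      bs-roots = All.tabulate⁺ {f = ℝ⇒ℂ ∘ β} λ i → traceᶜ-root (β i) (β-root i)

      outside′ : ∀ α′ b → Interval b → ℝ⇒ℂ α * α′ ≃ᶜ 1ℂ → ¬ ℝ⇒ℂ α + α′ ≃ᶜ b
      outside′ α′ b = outside α 2≤α {α′} {b}

      module S = Conj.Salem k (+ a) Interval (far 4≤a) (ℝ⇒ℂ α) αᶜ-root outside′
        bs bs-interval bs-distinct bs-roots (List.length-tabulate (ℝ⇒ℂ ∘ β))

      -- Any of the small roots would do. This one supplies both the conjugate on the unit circle
      -- and the definite form of the degree bound.
      β₀ : ℝ
      β₀ = β zero

      module U = UnitCircle β₀ (β-bounded zero)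

      β₀≄2 : ¬ β₀ ≃ ℚ⇒ℝ 2ℚ
      β₀≄2 e = 2-notRoot (≃-trans {ℝC.trace (suc k) A (ℚ⇒ℝ 2ℚ)} {ℝC.trace (suc k) A β₀} {0ℝ}
        (ℝC.trace-cong (suc k) A {ℚ⇒ℝ 2ℚ} {β₀} (≃-sym {β₀} {ℚ⇒ℝ 2ℚ} e)) (β-root zero))

      β₀≄-2 : ¬ β₀ ≃ ℚ⇒ℝ (ℚ.- 2ℚ)
      β₀≄-2 e = -2-notRoot (≃-trans {ℝC.trace (suc k) A (ℚ⇒ℝ (ℚ.- 2ℚ))} {ℝC.trace (suc k) A β₀} {0ℝ}
        (ℝC.trace-cong (suc k) A {ℚ⇒ℝ (ℚ.- 2ℚ)} {β₀} (≃-sym {β₀} {ℚ⇒ℝ (ℚ.- 2ℚ)} e)) (β-root zero))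

      definite = U.definite β₀≄2 β₀≄-2
      β₀-root = traceᶜ-root β₀ (β-root zero)

      least : ∀ {e} (g : Monic ℚ e) → IsRoot g (ℝ⇒ℂ α) → S.degree ℕ.≤ e
      least g h = S.degree-minimal {ℝ⇒ℂ β₀} β₀-root definite g
        (subst (_≃ᶜ 0ℂ) (eval≡monic g (ℝ⇒ℂ α)) h)

      minimal-root : ∀ {w} → ℂC.salem (suc k) (ℝ⇒ℂ A) w ≃ᶜ 0ℂ → IsRoot (proj₁ S.minimal) w
      minimal-root {w} h = subst (_≃ᶜ 0ℂ) (≡.sym (eval≡monic (proj₁ S.minimal) w))
        (≃ᶜ-trans {ℂP.monic (Vec.map ℚ⇒ℂ (proj₁ S.minimal)) w} {ℂC.salem (suc k) (ℝ⇒ℂ A) w} {0ℂ}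
          (proj₂ S.minimal w) h)

      isMinimal : IsMinimalPolynomial (proj₁ S.minimal) (ℝ⇒ℂ α)
      isMinimal = minimal-root {ℝ⇒ℂ α} αᶜ-root , least

      conjugate-root : ∀ {w} → IsConjugate (ℝ⇒ℂ α) w → ℂC.salem (suc k) (ℝ⇒ℂ A) w ≃ᶜ 0ℂ
      conjugate-root {w} (d , f , (fα≃0 , f-least) , fw≃0) =
        S.conjugate⇒root {ℝ⇒ℂ β₀} β₀-root definite f
          (subst (_≃ᶜ 0ℂ) (eval≡monic f (ℝ⇒ℂ α)) fα≃0)
          (λ g h → f-least g (subst (_≃ᶜ 0ℂ) (≡.sym (eval≡monic g (ℝ⇒ℂ α))) h))
          {w} (subst (_≃ᶜ 0ℂ) (eval≡monic f w) fw≃0)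

      -- The value of w + w⁻¹ is known only under double negation, hence the detour through
      -- `≤-stable`. The value α + α⁻¹ leaves w = α⁻¹; every other value puts w on the unit circle.
      others≤1 : ∀ w → IsConjugate (ℝ⇒ℂ α) w → ¬ w ≃ᶜ ℝ⇒ℂ α → normSq w ≤ 1ℝ
      others≤1 w c w≄α = ≤-stable {normSq w} {1ℝ} λ ≰1 →
        let fw≃0 = conjugate-root {w} c in
        S.traceValue {w} fw≃0 λ
          { (here e) → ≰1 (≤ʳ-trans {normSq w} {normSq (S.inv (ℝ⇒ℂ α))} {1ℝ}
              (≃⇒≤ {normSq w} {normSq (S.inv (ℝ⇒ℂ α))}
                (normSq-cong {w} {S.inv (ℝ⇒ℂ α)} (S.realRoots {w} fw≃0 e w≄α)))
              (normSq-inverse α 1≤α {S.inv (ℝ⇒ℂ α)} (S.inv-inverse {ℝ⇒ℂ α} αᶜ-root)))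
          ; (there e) → ≰1 (≃⇒≤ {normSq w} {1ℝ}
              (let b∈ , sum = All.lookupAny bs-interval e in
               normSq-unit {w} {S.inv w} b∈ (S.inv-inverse {w} fw≃0) sum)) }

      point-root : ℂC.salem (suc k) (ℝ⇒ℂ A) U.point ≃ᶜ 0ℂ
      point-root = SalemPolynomials.Roots.trace⇒salem ℂ-commutativeRing (suc k) (ℝ⇒ℂ A)
        {U.point} {U.conjugate} U.point*conjugate
        (≃ᶜ-trans {ℂC.trace (suc k) (ℝ⇒ℂ A) (U.point + U.conjugate)} {ℂC.trace (suc k) (ℝ⇒ℂ A) (ℝ⇒ℂ β₀)} {0ℂ}
          (ℂC.trace-cong (suc k) (ℝ⇒ℂ A) {U.point + U.conjugate} {ℝ⇒ℂ β₀} U.point+conjugate) β₀-root)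

    isSalem : IsSalem α
    isSalem = record
      { isAlgebraicInteger = let _ , f , h = S.integral {ℝ⇒ℂ α} αᶜ-root in
          isAlgebraicInteger {ℝ⇒ℂ α} f h
      ; 1<α = 1ℚ , 0<1 , always 2≤α
      ; others≤1 = others≤1
      ; onUnitCircle = U.point , (_ , proj₁ S.minimal , isMinimal , minimal-root {U.point} point-root) , U.h²+s²≃1
      }

    hasDegree : HasDegree (ℝ⇒ℂ α) (suc (suc (suc k)) ℕ.+ suc (suc (suc k)))
    hasDegree = proj₁ S.minimal , isMinimal

    isUnit : ∀ m q → m ℕ.* q ≡ suc (suc k) → IsUnit (ℝ⇒ℂ α ^ m + - 1ℂ)
    isUnit m q mq≡ =
      let (_ , f , h) , w , product , (_ , g , h′) = S.power-minus-1 m q mq≡ in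
      isAlgebraicInteger {ℝ⇒ℂ α ^ m + - 1ℂ} f h , w , product , isAlgebraicInteger {w} g h′

    unique : ∀ r → ℝC.salem (suc k) (ℚ⇒ℝ r) α ≃ 0ℝ → r ≡ fromℕ a
    unique r h = S.parameter-unique r
      (≃ᶜ-trans {ℂC.salem (suc k) (ℚ⇒ℂ r) (ℝ⇒ℂ α)} {ℝ⇒ℂ (ℝC.salem (suc k) (ℚ⇒ℝ r) α)} {0ℂ}
        (≃ᶜ-sym {ℝ⇒ℂ (ℝC.salem (suc k) (ℚ⇒ℝ r) α)} {ℂC.salem (suc k) (ℚ⇒ℂ r) (ℝ⇒ℂ α)}
          (H.φ-salem (suc k) (ℚ⇒ℝ r) α))
        (h , ≃-refl {0ℝ}))

-- Choice of the exponents k and the parameters a.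

open import Data.Integer.Base using (+_)
import Data.Integer.Properties as ℤ
open import Data.List.Base using (List; []; _∷_)
open import Data.List.Membership.Propositional using (_∈_)
open import Data.List.Relation.Unary.All using (All; []; _∷_)
open import Data.List.Relation.Unary.Any using (here; there)
open import Data.Nat.Base as ℕ using (ℕ; zero; suc; z≤n; s≤s)
open import Data.Nat.Divisibility as ℕ using (_∣_; divides)
import Data.Nat.Properties as ℕ
open import Data.Product.Base using (Σ-syntax; ∃-syntax; _×_; _,_; proj₁; proj₂)
open import Data.Rational.Base as ℚ using (ℚ; 0ℚ; 1ℚ)
import Data.Rational.Properties as ℚ
open import Data.Rational.Solver using (module +-*-Solver)
open import Level using (0ℓ)
open import Relation.Binary.PropositionalEquality as ≡ using (_≡_; refl; cong; subst)
open import Relation.Nullary.Negation using (¬_)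
open import Relation.Unary using (Pred)
open import Defs
open Rationals
open Reals
open RealRoots
open Samples
open TraceRoots
open SalemRoot

-- The multiple is kept in the form `suc L`, so that it is positive; each step replaces it by
-- `suc n′ * suc L`.
commonMultiple : ∀ F → All (λ n → 0 ℕ.< n) F → ∃[ L ] ∀ n → n ∈ F → n ∣ suc L
commonMultiple []           []        = 0 , λ _ ()
commonMultiple (suc n′ ∷ F) (_ ∷ pos) =
  let L , h = commonMultiple F pos in
  L ℕ.+ n′ ℕ.* suc L , λ
    { n (here refl) → ℕ.m∣m*n (suc L)
    ; n (there n∈F) → ℕ.∣-trans (h n n∈F) (ℕ.n∣m*n (suc n′)) }

module SalemFamily (m : ℕ) where

  private
    P : SamplePoints (suc (m ℕ.+ m))
    P = samplePoints m

    open SamplePoints P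

  -- At least 4, so that a is at a distance of at least 2 from [-2, 2], and beyond the threshold
  -- from which R alternates at the sample points.
  parameter : ℕ → ℕ
  parameter i = i ℕ.+ (4 ℕ.+ threshold)

  parameter-injective : ∀ {i j} → parameter i ≡ parameter j → i ≡ j
  parameter-injective {i} {j} = ℕ.+-cancelʳ-≡ (4 ℕ.+ threshold) i j

  private
    4≤ : ∀ i → 4ℚ ℚ.≤ fromℕ (parameter i)
    4≤ i = fromℕ-mono {4} {parameter i}
      (ℕ.≤-trans (ℕ.m≤m+n 4 threshold) (ℕ.m≤n+m (4 ℕ.+ threshold) i))

    threshold≤ : ∀ i → threshold ℕ.≤ parameter i
    threshold≤ i = ℕ.≤-trans (ℕ.m≤n+m threshold 4) (ℕ.m≤n+m (4 ℕ.+ threshold) i)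

    3≤4 : 2ℚ ℚ.+ 1ℚ ℚ.≤ 4ℚ
    3≤4 = ≤-by {2ℚ ℚ.+ 1ℚ} {4ℚ} 0≤1 refl

    root : ∀ i → ∃[ α ] ℝC.salem (suc (m ℕ.+ m)) (ℚ⇒ℝ (fromℕ (parameter i))) α ≃ 0ℝ ×
                 (∀ n → fromℕ (parameter i) ℚ.- 1ℚ ℚ.≤ seq α n)
    root i = salemRoot (suc (m ℕ.+ m)) (s≤s z≤n) (fromℕ (parameter i)) (ℚ.≤-trans 3≤4 (4≤ i))

  salemNumber : ℕ → ℝ
  salemNumber i = proj₁ (root i)

  private
    2≤salemNumber : ∀ i n → 2ℚ ℚ.≤ seq (salemNumber i) n
    2≤salemNumber i n = bound {fromℕ (parameter i)} (4≤ i) (proj₂ (proj₂ (root i)) n)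
      where
      bound : ∀ {a s} → 4ℚ ℚ.≤ a → a ℚ.- 1ℚ ℚ.≤ s → 2ℚ ℚ.≤ s
      bound {a} {s} 4≤a a-1≤s = ≤-by {2ℚ} {s} (0≤+ (0≤+ (≤⇒0≤ 4≤a) (≤⇒0≤ a-1≤s)) 0≤1)
        (let open +-*-Solver in
          solve 2 (λ a s → s :- con 2ℚ := a :- con 4ℚ :+ (s :- (a :- con 1ℚ)) :+ con 1ℚ) refl a s)

    negative : ∀ i j → j ℕ.≤ suc (suc (m ℕ.+ m)) →
      ℚC.sign j ℚ.* ℚC.trace (suc (m ℕ.+ m)) (fromℕ (parameter i)) (τ j) ℚ.< 0ℚ
    negative i = alternates (parameter i) (threshold≤ i)

    ¬R : ℕ → ℚ → Set
    ¬R i t = ¬ ℝC.trace (suc (m ℕ.+ m)) (ℚ⇒ℝ (fromℕ (parameter i))) (ℚ⇒ℝ t) ≃ 0ℝ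

    module N (i : ℕ) = SalemNumber.SalemNumber (m ℕ.+ m) (parameter i) (4≤ i)
      (salemNumber i) (2≤salemNumber i) (proj₁ (proj₂ (root i)))
      (roots P (fromℕ (parameter i)) (negative i))
      (roots-root P (fromℕ (parameter i)) (negative i))
      (roots-bounds P (fromℕ (parameter i)) (negative i))
      (roots-distinct P (fromℕ (parameter i)) (negative i))
      (subst (¬R i) first (R-at-τ P (fromℕ (parameter i)) (negative i) 0 z≤n))
      (subst (¬R i) last (R-at-τ P (fromℕ (parameter i)) (negative i) (suc (suc (m ℕ.+ m))) ℕ.≤-refl))

  degree : ℕ
  degree = suc (suc (suc (m ℕ.+ m))) ℕ.+ suc (suc (suc (m ℕ.+ m)))

  isSalem : ∀ i → IsSalem (salemNumber i)
  isSalem i = N.isSalem i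

  hasDegree : ∀ i → HasDegree (ℝ⇒ℂ (salemNumber i)) degree
  hasDegree i = N.hasDegree i

  isUnit : ∀ i n → n ∣ suc m → IsUnit (ℝ⇒ℂ (salemNumber i) ^ n + - 1ℂ)
  isUnit i n n∣1+m = N.isUnit i n (ℕ.quotient n∣2+2m) (≡.sym (ℕ.m∣n⇒n≡m*quotient n∣2+2m))
    where
    -- Here k = 2m + 1, so k + 1 is twice m + 1: divisibility of m + 1 suffices, and k is odd
    -- whatever F is.
    n∣2+2m : n ∣ suc (suc (m ℕ.+ m))
    n∣2+2m = subst (n ∣_) (cong suc (ℕ.+-suc m m)) (ℕ.∣m∣n⇒∣m+n n∣1+m n∣1+m)

  salemNumber-injective : ∀ {i j} → salemNumber i ≃ salemNumber j → i ≡ j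
  salemNumber-injective {i} {j} h = parameter-injective (ℤ.+-injective (fromℤ-injective
    (N.unique j (fromℕ (parameter i))
      (≃-trans {R (salemNumber j)} {R (salemNumber i)} {0ℝ}
        (ℝC.salem-cong (suc (m ℕ.+ m)) (ℚ⇒ℝ (fromℕ (parameter i))) {salemNumber j} {salemNumber i}
          (≃-sym {salemNumber i} {salemNumber j} h))
        (proj₁ (proj₂ (root i)))))))
    where
    R : ℝ → ℝ
    R = ℝC.salem (suc (m ℕ.+ m)) (ℚ⇒ℝ (fromℕ (parameter i)))

mainTheorem4 :
    (F : List ℕ) → All (λ n → 0 ℕ.< n) F →
    Σ[ N ∈ Pred ℕ 0ℓ ]
      (∀ d → N d → 0 ℕ.< d × 2 ∣ d) ×
      Infinite _≡_ N ×
      (∀ d → N d →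
        Infinite _≃_ (λ α →
          IsSalem α ×
          HasDegree (ℝ⇒ℂ α) d ×
          (∀ n → n ∈ F → IsUnit (ℝ⇒ℂ α ^ n + - 1ℂ))))
mainTheorem4 F positive =
  -- The degree is twice that of R, that is 2 (k + 2), or 4 m + 6 for k = 2m + 1; distinct j give
  -- distinct m and hence distinct degrees.
  (λ d → ∃[ j ] d ≡ SalemFamily.degree (m j)) ,
  (λ { d (j , refl) → s≤s z≤n , even (suc (suc (suc (m j ℕ.+ m j)))) }) ,
  ((λ j → SalemFamily.degree (m j)) , (λ {i} {j} → degree-injective {i} {j}) , λ j → j , refl) ,
  λ { d (j , refl) →
    SalemFamily.salemNumber (m j) , (λ {i} {i′} → SalemFamily.salemNumber-injective (m j) {i} {i′}) , λ i →
      SalemFamily.isSalem (m j) i , SalemFamily.hasDegree (m j) i ,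
      λ n n∈F → SalemFamily.isUnit (m j) i n (ℕ.∣-trans (proj₂ multiple n n∈F) (ℕ.n∣m*n (suc j))) }
  where
  multiple : ∃[ L ] ∀ n → n ∈ F → n ∣ suc L
  multiple = commonMultiple F positive

  -- 1 + m j = (1 + j)(1 + L)
  m : ℕ → ℕ
  m j = proj₁ multiple ℕ.+ j ℕ.* suc (proj₁ multiple)

  double-injective : ∀ {a b} → a ℕ.+ a ≡ b ℕ.+ b → a ≡ b
  double-injective {zero}  {zero}  _ = refl
  double-injective {suc a} {suc b} e = cong suc (double-injective
    (ℕ.suc-injective (≡.trans (≡.sym (ℕ.+-suc a a)) (≡.trans (ℕ.suc-injective e) (ℕ.+-suc b b)))))

  degree-injective : ∀ {i j} → SalemFamily.degree (m i) ≡ SalemFamily.degree (m j) → i ≡ j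
  degree-injective {i} {j} e = ℕ.*-cancelʳ-≡ i j (suc (proj₁ multiple))
    (ℕ.+-cancelˡ-≡ (proj₁ multiple) _ _ (double-injective
      (ℕ.suc-injective (ℕ.suc-injective (ℕ.suc-injective (double-injective e))))))

  even : ∀ h → 2 ∣ h ℕ.+ h
  even h = divides h (≡.trans (cong (h ℕ.+_) (≡.sym (ℕ.+-identityʳ h))) (ℕ.*-comm 2 h))
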